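{- Let $E: y^2 = x^3 + a_4x + a_6$ with $a_4, a_6 \in \mathbb{Z}$ be an elliptic curve over $\mathbb{Q}$. Let $(u,v) \in \mathbb{Z}^2$ be map-suitable for $E$, and suppose that $-D_E(u,v)$ is a negative fundamental discriminant. Then the map $\Phi_{u,v}: E(\mathbb{Q}) \to \mathrm{CL}(-D_E(u,v))$ is a group homomorphism.
   Context: Notation: $d_E(u,v) := v(u^3 + a_4uv^2 - a_6v^3)$ and $D_E(u,v) := 4d_E(u,v)$. A pair $(u,v)\in\mathbb{Z}^2$ is called map-suitable for $E$ if $u$, $v$, $3u^2 + a_4v^2$ and $D_E(u,v)$ are all positive. $\mathrm{CL}(-D)$ denotes the class group of discriminant $-D$, identified with the group of $\mathrm{SL}_2(\mathbb{Z})$-equivalence classes of primitive positive definite integral binary quadratic forms of discriminant $-D$ under Gauss composition. Definition of $\Phi_{u,v}$: $\Phi_{u,v}(\mathcal{O})$ is the identity class. For $P \neq \mathcal{O}$, write $P = (A/C^2, B/C^3)$ with $A,B,C\in\mathbb{Z}$, $\gcd(A,C)=\gcd(B,C)=1$, $C>0$; put $a := Av + C^2u$, $g := \gcd(C,v)$, and choose an integer $\mu$ with $(C^3/g^2)\mu \equiv 1 \pmod{va/g^2}$ (such $\mu$ exists). Then $\Phi_{u,v}(P)$ is the class of the form $\frac{va}{g^2}x^2 + 2\mu\frac{Bv^2}{g^2}xy + \frac{\mu^2 B^2v^4/g^4 + d_E(u,v)}{va/g^2}y^2$, which is a positive definite integral form of discriminant $-D_E(u,v)$ whose class does not depend on the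 choice of $\mu$. -}

module Defs where

open import Data.Nat using (ℕ)
open import Data.Integer as ℤ using (ℤ; +_; _≤_; _<_)
open import Data.Integer.Divisibility using (_∣_)
open import Data.Integer.GCD using (gcd)
open import Data.Rational as ℚ using (ℚ; 0ℚ)
open import Data.Rational.Properties using () renaming (_≟_ to _≟ℚ_)
open import Data.Product using (_×_; ∃; ∃-syntax; _,_)
open import Data.Sum using (_⊎_)
open import Relation.Binary.PropositionalEquality using (_≡_; _≢_)
open import Relation.Nullary using (¬_; yes; no)
open import Data.Unit using (⊤)

ι : ℤ → ℚ
ι z = z ℚ./ 1

IsElliptic : ℤ → ℤ → Set
IsElliptic a₄ a₆ = (+ 4) ℤ.* (a₄ ℤ.* a₄ ℤ.* a₄) ℤ.+ (+ 27) ℤ.* (a₆ ℤ.* a₆) ≢ ℤ.0ℤ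

data Point : Set where
  𝒪   : Point
  aff : ℚ → ℚ → Point

OnCurve : ℤ → ℤ → Point → Set
OnCurve a₄ a₆ 𝒪 = ⊤
OnCurve a₄ a₆ (aff x y) = y ℚ.* y ≡ x ℚ.* x ℚ.* x ℚ.+ ι a₄ ℚ.* x ℚ.+ ι a₆

-- The chord-tangent group law on E(ℚ) (standard formulas).
-- For two affine points with equal x-coordinates on E one has y₂ = ±y₁;
-- if y₁ + y₂ = 0 the sum is 𝒪, otherwise y₁ = y₂ ≠ 0 and the tangent
-- slope (3x₁² + a₄)/(2y₁) is written as (3x₁² + a₄)/(y₁ + y₂).
addE : ℤ → ℤ → Point → Point → Point
addE a₄ a₆ 𝒪 Q = Q
addE a₄ a₆ (aff x₁ y₁) 𝒪 = aff x₁ y₁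
addE a₄ a₆ (aff x₁ y₁) (aff x₂ y₂) with x₂ ℚ.- x₁ ≟ℚ 0ℚ
... | no  dx≢0 =
  let λ' = ℚ._÷_ (y₂ ℚ.- y₁) (x₂ ℚ.- x₁) {{ℚ.≢-nonZero dx≢0}}
      x₃ = λ' ℚ.* λ' ℚ.- x₁ ℚ.- x₂
  in aff x₃ (λ' ℚ.* (x₁ ℚ.- x₃) ℚ.- y₁)
... | yes _ with y₁ ℚ.+ y₂ ≟ℚ 0ℚ
...   | yes _ = 𝒪
...   | no  s≢0 =
  let λ' = ℚ._÷_ (ι (+ 3) ℚ.* x₁ ℚ.* x₁ ℚ.+ ι a₄) (y₁ ℚ.+ y₂) {{ℚ.≢-nonZero s≢0}}
      x₃ = λ' ℚ.* λ' ℚ.- x₁ ℚ.- x₂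
  in aff x₃ (λ' ℚ.* (x₁ ℚ.- x₃) ℚ.- y₁)

dE : ℤ → ℤ → ℤ → ℤ → ℤ
dE a₄ a₆ u v = v ℤ.* (u ℤ.* u ℤ.* u ℤ.+ a₄ ℤ.* u ℤ.* (v ℤ.* v) ℤ.- a₆ ℤ.* (v ℤ.* v ℤ.* v))

DE : ℤ → ℤ → ℤ → ℤ → ℤ
DE a₄ a₆ u v = (+ 4) ℤ.* dE a₄ a₆ u v

MapSuitable : ℤ → ℤ → ℤ → ℤ → Set
MapSuitable a₄ a₆ u v =
  (ℤ.0ℤ < u) × (ℤ.0ℤ < v) ×
  (ℤ.0ℤ < (+ 3) ℤ.* (u ℤ.* u) ℤ.+ a₄ ℤ.* (v ℤ.* v)) × (ℤ.0ℤ < DE a₄ a₆ u v)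

SquareFree : ℤ → Set
SquareFree m = ∀ (k : ℤ) → (k ℤ.* k) ∣ m → k ∣ ℤ.1ℤ

FundamentalDisc : ℤ → Set
FundamentalDisc Δ =
  ((+ 4) ∣ (Δ ℤ.- ℤ.1ℤ) × SquareFree Δ)
  ⊎ (∃[ m ] (Δ ≡ (+ 4) ℤ.* m) × ((+ 4) ∣ (m ℤ.- (+ 2)) ⊎ (+ 4) ∣ (m ℤ.- (+ 3))) × SquareFree m)

-- Integral binary quadratic forms  a x² + b xy + c y²

record Form : Set where
  constructor form
  field
    a b c : ℤ

-- SL₂(ℤ)-equivalence: g(x,y) = f(px + qy, rx + sy) with ps − qr = 1
_∼_ : Form → Form → Set
form a b c ∼ form a' b' c' =
  ∃[ p ] ∃[ q ] ∃[ r ] ∃[ s ]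
    (p ℤ.* s ℤ.- q ℤ.* r ≡ ℤ.1ℤ) ×
    (a' ≡ a ℤ.* (p ℤ.* p) ℤ.+ b ℤ.* (p ℤ.* r) ℤ.+ c ℤ.* (r ℤ.* r)) ×
    (b' ≡ (+ 2) ℤ.* a ℤ.* (p ℤ.* q) ℤ.+ b ℤ.* (p ℤ.* s ℤ.+ q ℤ.* r) ℤ.+ (+ 2) ℤ.* c ℤ.* (r ℤ.* s)) ×
    (c' ≡ a ℤ.* (q ℤ.* q) ℤ.+ b ℤ.* (q ℤ.* s) ℤ.+ c ℤ.* (s ℤ.* s))

-- Gauss composition of classes, in Dirichlet's form: the class of h is the
-- Gauss composite of the classes of f and g iff there are a₁,a₂ > 0, B, c
-- with gcd(a₁,a₂,B) = 1, f ∼ (a₁, B, a₂c), g ∼ (a₂, B, a₁c), h ∼ (a₁a₂, B, c).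
IsComposite : Form → Form → Form → Set
IsComposite f g h =
  ∃[ a₁ ] ∃[ a₂ ] ∃[ B ] ∃[ c ]
    (ℤ.0ℤ < a₁) × (ℤ.0ℤ < a₂) × (gcd (gcd a₁ a₂) B ≡ ℤ.1ℤ) ×
    (f ∼ form a₁ B (a₂ ℤ.* c)) × (g ∼ form a₂ B (a₁ ℤ.* c)) ×
    (h ∼ form (a₁ ℤ.* a₂) B c)

-- The map Φ_{u,v}.  Since the form depends on the choice of μ (its class
-- does not), Φ is given as the relation "f is a form produced by the
-- recipe for P".  The exact integer quotients appearing in the recipe are
-- described by their defining equations (g > 0, so they are unique).

IsPhiForm : ℤ → ℤ → ℤ → ℤ → Point → Form → Set
IsPhiForm a₄ a₆ u v 𝒪 f = f ≡ form ℤ.1ℤ ℤ.0ℤ (dE a₄ a₆ u v)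
IsPhiForm a₄ a₆ u v (aff x y) f =
  ∃[ A ] ∃[ B ] ∃[ C ]
    (ℤ.0ℤ < C) ×
    (x ℚ.* ι (C ℤ.* C) ≡ ι A) × (y ℚ.* ι (C ℤ.* C ℤ.* C) ≡ ι B) ×
    (gcd A C ≡ ℤ.1ℤ) × (gcd B C ≡ ℤ.1ℤ) ×
    (let a  = A ℤ.* v ℤ.+ C ℤ.* C ℤ.* u
         g  = gcd C v
         g² = g ℤ.* g
     in ∃[ μ ] ∃[ α ] ∃[ κ ] ∃[ β ] ∃[ γ ]
          (α ℤ.* g² ≡ v ℤ.* a) × (κ ℤ.* g² ≡ C ℤ.* C ℤ.* C) ×
          (α ∣ (κ ℤ.* μ ℤ.- ℤ.1ℤ)) ×
          (β ℤ.* g² ≡ (+ 2) ℤ.* μ ℤ.* B ℤ.* (v ℤ.* v)) ×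
          -- γ = (μ²B²v⁴/g⁴ + d_E)/(va/g²)
          (γ ℤ.* α ℤ.* (g² ℤ.* g²) ≡ μ ℤ.* μ ℤ.* (B ℤ.* B) ℤ.* (v ℤ.* v ℤ.* (v ℤ.* v))
                                      ℤ.+ dE a₄ a₆ u v ℤ.* (g² ℤ.* g²)) ×
          (f ≡ form α β γ))

{-# OPTIONS --safe #-}
module Submission where

open import Defs

-- Write P = (A/C², B/C³), and let T = (-u/v, √-d/v²) be the point of E over ℚ(√-d) above x = -u/v.
-- The form of P corresponds to the ideal of the primes modulo which P ≡ T.  If P₁ + P₂ + P₃ = 0, the
-- linear function of the line through the Pᵢ, evaluated at T and cleared of denominators, gives an
-- element θ = X + Y√-d whose norm is the product of the norms αᵢ of the three ideals and which lies in
-- each of them; the claim is that θ generates their product.  This is checked prime by prime: ramified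
-- primes divide each αᵢ at most once, so the norm decides; for the other primes θ is not divisible by p
-- unless p divides some denominator Cₖ, and then Pᵢ ≡ -Pⱼ mod p, so p divides the ideals of Pᵢ and Pⱼ
-- through conjugate primes.  Ideals are avoided throughout: that θ generates the product is expressed
-- by the integrality of a 2×2×2 cube, from which Dirichlet composition is read off.

-- Clearing denominators by v² C₁C₂C₃ gives an element of norm v a₁a₂a₃ with aᵢ = Aᵢv + Cᵢ²u,
-- whereas α₁α₂α₃ = v³a₁a₂a₃/(g₁g₂g₃)². The missing factor v/(g₁g₂g₃) makes Y = v c₁c₂c₃ an integer,
-- where cᵢ = Cᵢ/gᵢ; X is an integer only because the norm equation makes X² one. That -4d is
-- fundamental enters twice: 2 and the primes dividing d are ramified, and v, a divisor of d, is
-- squarefree, which keeps αᵢ prime to Cᵢ. The condition 3u² + a₄v² > 0 makes the αᵢ of the two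
-- summands positive, as Dirichlet composition demands of leading coefficients. Since a cube says
-- that a product of three ideals is principal, it presents the composite of the first two forms as
-- the conjugate of the third; so P₁ + P₂ is reached through the third point -(P₁ + P₂) of the line.
-- The divisibilities behind the cube are proved by exhibiting, for each prime p, a multiplier prime
-- to p.

module LinearCombination where
  open import Data.Integer using (+_; -_; _+_; _-_; _*_; 0ℤ)
  open import Data.Integer.Properties using (*-zeroʳ; +-identityʳ; +-inverseʳ)
  open import Relation.Binary.PropositionalEquality using (_≡_; refl; trans; cong)

  private
    kill : ∀ c {l r} → l ≡ r → c * (l - r) ≡ 0ℤ
    kill c {l} refl = trans (cong (c *_) (+-inverseʳ l)) (*-zeroʳ c)

  -- Certificates of ideal membership: the coefficients `c` exhibit x - y as a combination of the
  -- hypotheses l = r, and the remaining polynomial identity goes to the ring solver. Most equations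
  -- below are proved in this way; the accompanying `lemma` is the expanded certificate.
  ≡-lin₁ : ∀ {x y l r} c → l ≡ r → x ≡ y + c * (l - r) → x ≡ y
  ≡-lin₁ {y = y} c e i = trans i (trans (cong (λ z → y + z) (kill c e)) (+-identityʳ y))

  ≡-lin₂ : ∀ {x y l r l' r'} c → l ≡ r → ∀ c' → l' ≡ r' → x ≡ y + c * (l - r) + c' * (l' - r') → x ≡ y
  ≡-lin₂ c e c' e' i = ≡-lin₁ c e (≡-lin₁ c' e' i)

  ≡-lin₃ : ∀ {x y l r l' r' l'' r''} c → l ≡ r → ∀ c' → l' ≡ r' → ∀ c'' → l'' ≡ r'' →
        x ≡ y + c * (l - r) + c' * (l' - r') + c'' * (l'' - r'') → x ≡ y
  ≡-lin₃ c e c' e' c'' e'' i = ≡-lin₁ c e (≡-lin₂ c' e' c'' e'' i)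

-- Prime divisors, Bézout relations and local-to-global divisibility in ℤ.

module Divisibility where
  open import Data.Nat.Base using (ℕ; zero; suc)
  import Data.Nat.Base as ℕ
  import Data.Nat.Properties as ℕ
  import Data.Nat.Divisibility as ℕ
  open import Data.Nat.GCD using (module Bézout; mkGCD; module GCD)
  open import Data.Nat.ListAction using (product)
  open import Data.Nat.Primality using (Prime; euclidsLemma; prime⇒irreducible; ¬prime[1]; ¬prime[0])
  open import Data.Nat.Primality.Factorisation using (factorise)
  open import Data.Integer using (+_; -_; _+_; _-_; _*_; 0ℤ; 1ℤ; ≢-nonZero) renaming (∣_∣ to abs)
  open import Data.Integer.Properties using (*-cancelˡ-≡; i*j≡0⇒i≡0∨j≡0; abs-*; pos-*; ∣i∣≡0⇒i≡0; *-identityˡ; *-identityʳ; *-comm; *-zeroʳ)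
  open import Data.Integer.Divisibility.Signed using (_∣_; divides; _∣?_; ∣ᵤ⇒∣; ∣⇒∣ᵤ; ∣-trans; 0∣⇒≡0; m∣∣m∣; ∣m∣∣m; ∣m∣n⇒∣m+n; ∣m⇒∣m*n; ∣n⇒∣m*n)
  open import Data.Integer.Tactic.RingSolver using (solve-∀)
  open import Data.List.Base using ([]; _∷_)
  open import Data.List.Relation.Unary.All using (All; []; _∷_)
  open import Data.Product using (_×_; ∃-syntax; _,_; proj₁; proj₂)
  open import Data.Sum using (_⊎_; inj₁; inj₂)
  open import Data.Empty using (⊥-elim)
  open import Relation.Nullary using (¬_; yes; no)
  open import Relation.Binary.PropositionalEquality using (_≡_; _≢_; refl; sym; trans; cong; subst)
  open LinearCombination

  cancel : ∀ {i j k} → i ≢ 0ℤ → i * j ≡ i * k → j ≡ k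
  cancel {i} {j} {k} i≢0 = *-cancelˡ-≡ i j k {{≢-nonZero i≢0}}

  *-≢0 : ∀ {i j} → i ≢ 0ℤ → j ≢ 0ℤ → i * j ≢ 0ℤ
  *-≢0 {i} i≢0 j≢0 e with i*j≡0⇒i≡0∨j≡0 i e
  ... | inj₁ i≡0 = i≢0 i≡0
  ... | inj₂ j≡0 = j≢0 j≡0

  ∣-lin₁ : ∀ {k x z} → k ∣ x → ∀ a → z ≡ a * x → k ∣ z
  ∣-lin₁ k∣x a refl = ∣n⇒∣m*n a k∣x

  ∣-lin₂ : ∀ {k x y z} → k ∣ x → ∀ a → k ∣ y → ∀ b → z ≡ a * x + b * y → k ∣ z
  ∣-lin₂ k∣x a k∣y b refl = ∣m∣n⇒∣m+n (∣n⇒∣m*n a k∣x) (∣n⇒∣m*n b k∣y)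

  euclid : ∀ {p} → Prime p → ∀ x y → + p ∣ x * y → + p ∣ x ⊎ + p ∣ y
  euclid pp x y p∣xy
    with euclidsLemma (abs x) (abs y) pp (subst (_ ℕ.∣_) (abs-* x y) (∣⇒∣ᵤ p∣xy))
  ... | inj₁ h = inj₁ (∣ᵤ⇒∣ h)
  ... | inj₂ h = inj₂ (∣ᵤ⇒∣ h)

  ∤-* : ∀ {p} → Prime p → ∀ {x y} → ¬ + p ∣ x → ¬ + p ∣ y → ¬ + p ∣ x * y
  ∤-* pp {x} {y} p∤x p∤y h with euclid pp x y h
  ... | inj₁ k = p∤x k
  ... | inj₂ k = p∤y k

  euclid-sq : ∀ {p} → Prime p → ∀ x → + p ∣ x * x → + p ∣ x
  euclid-sq pp x h with euclid pp x x h
  ... | inj₁ k = k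
  ... | inj₂ k = k

  prime∤1 : ∀ {p} → Prime p → ¬ + p ∣ 1ℤ
  prime∤1 pp h = ¬prime[1] (subst Prime (ℕ.∣1⇒≡1 (∣⇒∣ᵤ h)) pp)

  prime≢0 : ∀ {p} → Prime p → + p ≢ 0ℤ
  prime≢0 pp refl = ¬prime[0] pp

  prime∣prime : ∀ {p q} → Prime p → Prime q → + q ∣ + p → q ≡ p
  prime∣prime pp pq h with prime⇒irreducible pp (∣⇒∣ᵤ h)
  ... | inj₁ q≡1 = ⊥-elim (¬prime[1] (subst Prime q≡1 pq))
  ... | inj₂ q≡p = q≡p

  gcd-bézout : ∀ a b → ∃[ g ] ∃[ k ] ∃[ l ] (k * a + l * b ≡ + g) × (+ g ∣ a) × (+ g ∣ b)
  gcd-bézout a b with mkGCD (abs a) (abs b)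
  ... | g , G = g , go (Bézout.identity G)
    where
    g∣a = ∣ᵤ⇒∣ {+ g} {a} (proj₁ (GCD.commonDivisor G))
    g∣b = ∣ᵤ⇒∣ {+ g} {b} (proj₂ (GCD.commonDivisor G))
    fromℕ : ∀ x y z w → g ℕ.+ x ℕ.* y ≡ z ℕ.* w → + g + + x * + y ≡ + z * + w
    fromℕ x y z w e = trans (cong (λ t → + g + t) (sym (pos-* x y)))
                            (trans (cong +_ e) (pos-* z w))
    go : Bézout.Identity g (abs a) (abs b) → ∃[ k ] ∃[ l ] (k * a + l * b ≡ + g) × (+ g ∣ a) × (+ g ∣ b)
    go i with m∣∣m∣ {a} | m∣∣m∣ {b} | i
    ... | divides ε e | divides δ f | Bézout.+- x y h =
      + x * ε , - (+ y) * δ , ≡-lin₃ (- 1ℤ) (fromℕ y (abs b) x (abs a) h) (- (+ x)) e (+ y) f (lemma (+ x) (+ y) ε δ (+ g) a b (+ (abs a)) (+ (abs b))) , g∣a , g∣b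
      where
      lemma : ∀ x y ε δ g a b a' b' →
        x * ε * a + - y * δ * b ≡ g + (- 1ℤ) * (g + y * b' - x * a') + - x * (a' - ε * a) + y * (b' - δ * b)
      lemma = solve-∀
    ... | divides ε e | divides δ f | Bézout.-+ x y h =
      - (+ x) * ε , + y * δ , ≡-lin₃ (- 1ℤ) (fromℕ x (abs a) y (abs b) h) (+ x) e (- (+ y)) f (lemma (+ x) (+ y) ε δ (+ g) a b (+ (abs a)) (+ (abs b))) , g∣a , g∣b
      where
      lemma : ∀ x y ε δ g a b a' b' →
        - x * ε * a + y * δ * b ≡ g + (- 1ℤ) * (g + x * a' - y * b') + x * (a' - ε * a) + - y * (b' - δ * b)
      lemma = solve-∀

  noPrimeDivisor⇒1 : ∀ n → n ≢ 0 → (∀ p → Prime p → ¬ + p ∣ + n) → n ≡ 1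
  noPrimeDivisor⇒1 zero    n≢0 _ = ⊥-elim (n≢0 refl)
  noPrimeDivisor⇒1 (suc n) _   h with factorise (suc n)
  ... | record { factors = [] ; isFactorisation = e } = e
  ... | record { factors = p ∷ ps ; isFactorisation = e ; factorsPrime = pp ∷ _ } =
    ⊥-elim (h p pp (∣ᵤ⇒∣ (ℕ.divides (product ps) (trans e (ℕ.*-comm p (product ps))))))

  bézout-noCommonPrime : ∀ a b → a ≢ 0ℤ → (∀ p → Prime p → + p ∣ a → ¬ + p ∣ b) →
                    ∃[ k ] ∃[ l ] k * a + l * b ≡ 1ℤ
  bézout-noCommonPrime a b a≢0 h with gcd-bézout a b
  ... | g , k , l , e , g∣a , g∣b = k , l , trans e (cong +_ g≡1)
    where
    g≡1 : g ≡ 1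
    g≡1 = noPrimeDivisor⇒1 g (λ { refl → a≢0 (0∣⇒≡0 g∣a) })
            (λ p pp p∣g → h p pp (∣-trans p∣g g∣a) (∣-trans p∣g g∣b))

  bézout-prime : ∀ {p} → Prime p → ∀ m → ¬ + p ∣ m → ∃[ k ] ∃[ l ] k * + p + l * m ≡ 1ℤ
  bézout-prime {p} pp m p∤m = bézout-noCommonPrime (+ p) m (prime≢0 pp)
    λ q pq q∣p q∣m → p∤m (subst (λ r → + r ∣ m) (prime∣prime pp pq q∣p) q∣m)

  primeFactors : ∀ n → n ≢ 0ℤ → ∃[ ps ] All Prime ps × (abs n ≡ product ps)
  primeFactors n n≢0 with abs n in eq
  ... | zero = ⊥-elim (n≢0 (∣i∣≡0⇒i≡0 eq))
  ... | suc n' with factorise (suc n')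
  ... | record { factors = ps ; isFactorisation = e ; factorsPrime = pps } = ps , pps , e

  -- The m with n ∣ m z form an ideal of ℤ that lies in no prime ideal (n itself belongs to it,
  -- which settles the p not dividing n), so it contains 1. Concretely, n ∣ |n| z is trivial and the
  -- prime factors of |n| are stripped from this multiplier one by one.
  ∣-local-global : ∀ n z → n ≢ 0ℤ →
    (∀ p → Prime p → + p ∣ n → ∃[ m ] (¬ + p ∣ m) × (n ∣ m * z)) → n ∣ z
  ∣-local-global n z n≢0 loc with primeFactors n n≢0
  ... | ps , pps , e =
    go ps pps (subst (λ t → + t ∣ n) e ∣m∣∣m) (∣m⇒∣m*n z (subst (λ t → n ∣ + t) e m∣∣m∣))
    where
    go : ∀ ps → All Prime ps → + product ps ∣ n → n ∣ + product ps * z → n ∣ z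
    go [] _ _ h = subst (n ∣_) (*-identityˡ z) h
    go (p ∷ ps) (pp ∷ pps) p*ps∣n h
      with loc p pp (∣-trans (divides (+ product ps) (trans (pos-* p (product ps)) (*-comm (+ p) _))) p*ps∣n)
    ... | m , p∤m , n∣mz with bézout-prime pp m p∤m
    -- With k p + l m = 1 one has M z = k (p M z) + l M (m z), and n divides both terms.
    ... | k , l , e₁ = go ps pps (∣-trans (divides (+ p) (pos-* p (product ps))) p*ps∣n)
      (∣-lin₂ h k n∣mz (l * M)
        (≡-lin₂ (- (M * z)) e₁ (- (k * z)) (pos-* p (product ps)) (lemma M z k l m (+ p) (+ product (p ∷ ps)))))
      where
      M = + product ps
      lemma : ∀ M z k l m p pM →
        M * z ≡ k * (pM * z) + l * M * (m * z) + - (M * z) * (k * p + l * m - 1ℤ) + - (k * z) * (pM - p * M)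
      lemma = solve-∀

  -- After division by the gcd, b'² = q a'² and k a' + l b' = 1. Expanding b' = b' (k a' + l b')²
  -- and replacing b'² by q a'² leaves a multiple of a', which is the witness.
  square-∣ : ∀ a b → a ≢ 0ℤ → a * a ∣ b * b → a ∣ b
  square-∣ a b a≢0 h with gcd-bézout a b
  square-∣ a b a≢0 (divides q e) | g , k , l , e₁ , divides a' refl , divides b' refl =
    divides (b' * (k * k * a' + + 2 * k * l * b' + l * l * q * a'))
      (≡-lin₂ (- (b' * (k * a' + l * b' + 1ℤ) * + g)) e₂ (b' * l * l * + g) e₃ (lemma₂ k l q (+ g) a' b'))
    where
    g≢0 : + g ≢ 0ℤ
    g≢0 g≡0 = a≢0 (trans (cong (a' *_) g≡0) (*-zeroʳ a'))
    lemma₀ : ∀ k l g a' b' → g * (k * a' + l * b') ≡ k * (a' * g) + l * (b' * g)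
    lemma₀ = solve-∀
    e₂ : k * a' + l * b' ≡ 1ℤ
    e₂ = cancel g≢0 (trans (lemma₀ k l (+ g) a' b') (trans e₁ (sym (*-identityʳ (+ g)))))
    lemma₁ : ∀ g x y → g * g * (x * y) ≡ x * g * (y * g)
    lemma₁ = solve-∀
    lemma₁' : ∀ g q x → q * (x * g * (x * g)) ≡ g * g * (q * (x * x))
    lemma₁' = solve-∀
    e₃ : b' * b' ≡ q * (a' * a')
    e₃ = cancel (*-≢0 g≢0 g≢0) (trans (lemma₁ (+ g) b' b') (trans e (lemma₁' (+ g) q a')))
    lemma₂ : ∀ k l q g a' b' →
      b' * g ≡ b' * (k * k * a' + + 2 * k * l * b' + l * l * q * a') * (a' * g)
               + - (b' * (k * a' + l * b' + 1ℤ) * g) * (k * a' + l * b' - 1ℤ)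
               + b' * l * l * g * (b' * b' - q * (a' * a'))
    lemma₂ = solve-∀

  -- The argument is adjusted one prime at a time by the Chinese remainder theorem.
  coprimeValue : ∀ a b c → (∀ p → Prime p → ∃[ t ] ¬ + p ∣ a + + 2 * b * t + c * (t * t)) →
    ∀ ps → All Prime ps →
    ∃[ t ] (∀ q → Prime q → + q ∣ + product ps → ¬ + q ∣ a + + 2 * b * t + c * (t * t))
  coprimeValue a b c loc [] _ = 0ℤ , λ q pq q∣1 _ → prime∤1 pq q∣1
  coprimeValue a b c loc (p ∷ ps) (pp ∷ pps) with coprimeValue a b c loc ps pps
  ... | t , ih with + p ∣? a + + 2 * b * t + c * (t * t)
  ...   | no p∤ft = t , λ q pq q∣pm → case (euclid pq (+ p) (+ product ps) (subst (+ q ∣_) (pos-* p (product ps)) q∣pm)) pq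
    where
    case : ∀ {q} → (+ q ∣ + p) ⊎ (+ q ∣ + product ps) → Prime q → ¬ + q ∣ a + + 2 * b * t + c * (t * t)
    case (inj₁ q∣p) pq = subst (λ r → ¬ + r ∣ _) (sym (prime∣prime pp pq q∣p)) p∤ft
    case (inj₂ q∣m) pq = ih _ pq q∣m
  -- Here p is not among the primes of `ps`, since none of those divides f(t). So m = `product ps`
  -- is invertible modulo p, and t' = t + l m (tₚ - t) is t modulo m and tₚ modulo p.
  ...   | yes p∣ft with loc p pp | bézout-prime pp (+ product ps) (λ p∣m → ih p pp p∣m p∣ft)
  ...     | tₚ , p∤ftₚ | k , l , e =
    t' , λ q pq q∣pm → case (euclid pq (+ p) m (subst (+ q ∣_) (pos-* p (product ps)) q∣pm)) pq
    where
    m = + product ps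
    f = λ t → a + + 2 * b * t + c * (t * t)
    t' = t + l * m * (tₚ - t)
    lemma₁ : ∀ a b c t l m tₚ → let t' = t + l * m * (tₚ - t) in
      a + + 2 * b * t + c * (t * t) ≡
        1ℤ * (a + + 2 * b * t' + c * (t' * t')) + - (l * (tₚ - t) * (+ 2 * b + c * (t + t'))) * m
    lemma₁ = solve-∀
    lemma₂ : ∀ a b c t k p l m tₚ → let t' = t + l * m * (tₚ - t) in
      a + + 2 * b * tₚ + c * (tₚ * tₚ) ≡
        1ℤ * (a + + 2 * b * t' + c * (t' * t')) + k * (tₚ - t) * (+ 2 * b + c * (tₚ + t')) * p
        + (t - tₚ) * (+ 2 * b + c * (tₚ + t')) * (k * p + l * m - 1ℤ)
    lemma₂ = solve-∀
    case : ∀ {q} → (+ q ∣ + p) ⊎ (+ q ∣ m) → Prime q → ¬ + q ∣ f t'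
    case {q} (inj₁ q∣p) pq q∣ft' = p∤ftₚ (subst (λ r → + r ∣ f tₚ) (prime∣prime pp pq q∣p)
      (∣-lin₂ q∣ft' 1ℤ q∣p (k * (tₚ - t) * (+ 2 * b + c * (tₚ + t')))
        (≡-lin₁ ((t - tₚ) * (+ 2 * b + c * (tₚ + t'))) e (lemma₂ a b c t k (+ p) l m tₚ))))
    case (inj₂ q∣m) pq q∣ft' = ih _ pq q∣m
      (∣-lin₂ q∣ft' 1ℤ q∣m (- (l * (tₚ - t) * (+ 2 * b + c * (t + t')))) (lemma₁ a b c t l m tₚ))

-- Equivalence of forms through ideals, and what a cube says about its three forms.

module Cubes where
  open import Data.Nat.Base using (ℕ)
  open import Data.Nat.Primality using (Prime)
  open import Data.Integer using (ℤ; +_; -_; _+_; _-_; _*_; 0ℤ; 1ℤ)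
  open import Data.Integer.Properties using (*-comm; *-assoc)
  open import Data.Integer.Divisibility.Signed using (_∣_)
  open import Data.Integer.Tactic.RingSolver using (solve-∀; solve)
  open import Data.List.Base using ([]; _∷_)
  open import Data.Product using (_×_; _,_)
  open import Relation.Binary.PropositionalEquality using (_≡_; _≢_; refl; sym; trans; cong; cong₂)
  open LinearCombination
  open Divisibility

  -- p behaves like a ramified prime of ℤ[√-d], expressed through norms x² + d y².
  record Ramified (d : ℤ) (p : ℕ) : Set where
    field
      ∣-product : ∀ {x y x' y'} → + p ∣ x * x + d * (y * y) → + p ∣ x' * x' + d * (y' * y') →
                  (+ p ∣ x * x' - d * (y * y')) × (+ p ∣ x * y' + y * x')
      ∣-square  : ∀ {x y} → + p * + p ∣ x * x + d * (y * y) → (+ p ∣ x) × (+ p ∣ y)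
  open Ramified public

  -- For d > 0 this amounts to -4d being a fundamental discriminant.
  record MaximalOrder (d : ℤ) : Set where
    field
      ramified-∣d : ∀ {p} → Prime p → + p ∣ d → Ramified d p
      ramified-2  : Ramified d 2
  open MaximalOrder public

  -- A vector (p, r) with f(p, r) = n extends to an equivalence of (α, 2b, γ) with (n, 2B, c) as soon as
  -- B + √-d maps it into n times the ideal of (α, 2b, γ); the quotient (q, s) is the second column.
  ∼-fromIdeal : ∀ {d α b γ n B c} p q r s → n ≢ 0ℤ →
    b * b + d ≡ α * γ → B * B + d ≡ n * c →
    α * (p * p) + + 2 * b * (p * r) + γ * (r * r) ≡ n →
    (B - b) * p - γ * r ≡ n * q → (B + b) * r + α * p ≡ n * s →
    form α (+ 2 * b) γ ∼ form n (+ 2 * B) c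
  ∼-fromIdeal {d} {α} {b} {γ} {n} {B} {c} p q r s n≢0 disc disc' val eq es =
    p , q , r , s ,
    cancel n≢0 (≡-lin₃ 1ℤ val (- r) (sym eq) p (sym es) (detL α b γ n B p q r s)) ,
    sym val ,
    cancel n≢0 (≡-lin₃ (+ 2 * (α * p + b * r)) eq (+ 2 * (b * p + γ * r)) es (- (+ 2 * B)) val (midL α b γ n B p q r s)) ,
    -- The last coefficient comes from multiplicativity of norms: at the vector (B + √-d)(p, r) = n
    -- (q, s) the form takes the value (B² + d) n, so B² + d is n times its value at (q, s).
    cancel (*-≢0 n≢0 n≢0) (trans (*-assoc n n c) (trans (cong (n *_) (sym disc')) fin))
    where
    detL : ∀ α b γ n B p q r s → n * (p * s - q * r) ≡ n * 1ℤ
      + 1ℤ * (α * (p * p) + + 2 * b * (p * r) + γ * (r * r) - n)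
      + - r * (n * q - ((B - b) * p - γ * r)) + p * (n * s - ((B + b) * r + α * p))
    detL = solve-∀
    midL : ∀ α b γ n B p q r s → n * (+ 2 * B) ≡
      n * (+ 2 * α * (p * q) + + 2 * b * (p * s + q * r) + + 2 * γ * (r * s))
      + + 2 * (α * p + b * r) * ((B - b) * p - γ * r - n * q)
      + + 2 * (b * p + γ * r) * ((B + b) * r + α * p - n * s)
      + - (+ 2 * B) * (α * (p * p) + + 2 * b * (p * r) + γ * (r * r) - n)
    midL = solve-∀
    h : ∀ q s → ℤ
    h q s = α * (q * q) + + 2 * b * (q * s) + γ * (s * s)
    scale : ∀ α b γ n q s → n * n * (α * (q * q) + + 2 * b * (q * s) + γ * (s * s)) ≡
      α * (n * q * (n * q)) + + 2 * b * (n * q * (n * s)) + γ * (n * s * (n * s))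
    scale = solve-∀
    mult : ∀ α b γ B d p r → let q' = (B - b) * p - γ * r; s' = (B + b) * r + α * p in
      (B * B + d) * (α * (p * p) + + 2 * b * (p * r) + γ * (r * r)) ≡
      α * (q' * q') + + 2 * b * (q' * s') + γ * (s' * s')
      + (α * (p * p) + + 2 * b * (p * r) + γ * (r * r)) * (b * b + d - α * γ)
    mult = solve-∀
    fin : n * (B * B + d) ≡ n * n * h q s
    fin = sym (trans (scale α b γ n q s)
      (trans (cong₂ (λ q' s' → α * (q' * q') + + 2 * b * (q' * s') + γ * (s' * s')) (sym eq) (sym es))
      (trans (sym (≡-lin₁ (α * (p * p) + + 2 * b * (p * r) + γ * (r * r)) disc (mult α b γ B d p r)))
      (trans (cong ((B * B + d) *_) val) (*-comm (B * B + d) n)))))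

  ∼-translate : ∀ {d α b γ B c} k → α ≢ 0ℤ → b * b + d ≡ α * γ → B * B + d ≡ α * c → B ≡ b + α * k →
    form α (+ 2 * b) γ ∼ form α (+ 2 * B) c
  ∼-translate {d} {α} {b} {γ} {B} {c} k α≢0 disc disc' refl =
    ∼-fromIdeal {d} {α} {b} {γ} {α} {b + α * k} {c} 1ℤ k 0ℤ 1ℤ α≢0 disc disc' (solve (α ∷ b ∷ γ ∷ [])) (solve (α ∷ b ∷ γ ∷ k ∷ [])) (solve (α ∷ b ∷ k ∷ []))

  -- Bhargava's cube: Y, s₁, s₂, s₃, s₁₂, s₁₃, s₂₃, s₁₂₃ are the √-d-coordinates of θ ∏ (bᵢ + √-d)/αᵢ over
  -- the subsets of {1,2,3}, where θ = X + Y √-d generates the product of the three ideals.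
  record Cube (d α₁ b₁ α₂ b₂ α₃ b₃ : ℤ) : Set where
    field
      X Y s₁ s₂ s₃ s₁₂ s₁₃ s₂₃ s₁₂₃ : ℤ
      norm : X * X + d * (Y * Y) ≡ α₁ * α₂ * α₃
      e₁   : X + Y * b₁ ≡ α₁ * s₁
      e₂   : X + Y * b₂ ≡ α₂ * s₂
      e₃   : X + Y * b₃ ≡ α₃ * s₃
      e₁₂  : X * (b₁ + b₂) + Y * (b₁ * b₂ - d) ≡ α₁ * α₂ * s₁₂
      e₁₃  : X * (b₁ + b₃) + Y * (b₁ * b₃ - d) ≡ α₁ * α₃ * s₁₃
      e₂₃  : X * (b₂ + b₃) + Y * (b₂ * b₃ - d) ≡ α₂ * α₃ * s₂₃
      e₁₂₃ : X * (b₁ * b₂ + b₁ * b₃ + b₂ * b₃ - d) + Y * (b₁ * b₂ * b₃ - d * (b₁ + b₂ + b₃))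
             ≡ α₁ * α₂ * α₃ * s₁₂₃

  module _ {d α₁ b₁ γ₁ α₂ b₂ γ₂ α₃ b₃ γ₃ : ℤ}
    (α₁≢0 : α₁ ≢ 0ℤ) (α₂≢0 : α₂ ≢ 0ℤ) (α₃≢0 : α₃ ≢ 0ℤ)
    (disc₁ : b₁ * b₁ + d ≡ α₁ * γ₁) (disc₂ : b₂ * b₂ + d ≡ α₂ * γ₂) (disc₃ : b₃ * b₃ + d ≡ α₃ * γ₃)
    (cube : Cube d α₁ b₁ α₂ b₂ α₃ b₃) where
    open Cube cube

    private
      -- Polar form of (α₃, -2b₃, γ₃), which is the norm divided by α₃ on the lattice with basis α₃,
      -- -b₃ + √-d. In this basis θ has coordinates (s₃, Y), and θ₂ = θ (b₂ + √-d)/α₂ has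
      -- coordinates (s₂₃, s₂).
      hVal : ℤ → ℤ → ℤ → ℤ → ℤ
      hVal p r q s = α₃ * (p * q) - b₃ * (p * s + q * r) + γ₃ * (r * s)

      -- With `pairL` this shows that both coordinates of (b + √-d) θ are divisible by α. In the
      -- names below, r and p mark the second and the first coordinate; x₁ and x₂ stand for
      -- multiplication by b₁ + √-d and b₂ + √-d on θ, x₁₂ for multiplication by b₁ + √-d on θ₂.
      singleL : ∀ α b s → X + Y * b ≡ α * s → α * s ≡ (b - b₃) * Y + α₃ * s₃
      singleL α b s e = ≡-lin₂ (- 1ℤ) e 1ℤ e₃ (lemma α b b₃ X Y s (α₃ * s₃))
        where
        lemma : ∀ α b b₃ X Y s z → α * s ≡ (b - b₃) * Y + z + - 1ℤ * (X + Y * b - α * s) + 1ℤ * (X + Y * b₃ - z)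
        lemma = solve-∀
      x₁r : α₁ * s₁ ≡ (b₁ - b₃) * Y + α₃ * s₃
      x₁r = singleL α₁ b₁ s₁ e₁
      x₂r : α₂ * s₂ ≡ (b₂ - b₃) * Y + α₃ * s₃
      x₂r = singleL α₂ b₂ s₂ e₂

      pairL : ∀ α b s → X * (b + b₃) + Y * (b * b₃ - d) ≡ α * α₃ * s → α * s ≡ (b + b₃) * s₃ - γ₃ * Y
      pairL α b s e = cancel α₃≢0 (≡-lin₃ (- 1ℤ) e (b + b₃) e₃ (- Y) disc₃ (lemma α b s α₃ b₃ γ₃ s₃ X Y d))
        where
        lemma : ∀ α b s α₃ b₃ γ₃ s₃ X Y d → α₃ * (α * s) ≡ α₃ * ((b + b₃) * s₃ - γ₃ * Y)
          + - 1ℤ * (X * (b + b₃) + Y * (b * b₃ - d) - α * α₃ * s) + (b + b₃) * (X + Y * b₃ - α₃ * s₃)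
          + - Y * (b₃ * b₃ + d - α₃ * γ₃)
        lemma = solve-∀

      x₁p : α₁ * s₁₃ ≡ (b₁ + b₃) * s₃ - γ₃ * Y
      x₁p = pairL α₁ b₁ s₁₃ e₁₃
      x₂p : α₂ * s₂₃ ≡ (b₂ + b₃) * s₃ - γ₃ * Y
      x₂p = pairL α₂ b₂ s₂₃ e₂₃

      x₁₂r : α₁ * s₁₂ ≡ (b₁ - b₃) * s₂ + α₃ * s₂₃
      x₁₂r = cancel α₂≢0 (≡-lin₃ (- 1ℤ) e₁₂ 1ℤ e₂₃ (b₁ - b₃) e₂ (lemma α₁ b₁ α₂ b₂ α₃ b₃ s₁₂ s₂ s₂₃ X Y d))
        where
        lemma : ∀ α₁ b₁ α₂ b₂ α₃ b₃ s₁₂ s₂ s₂₃ X Y d → α₂ * (α₁ * s₁₂) ≡ α₂ * ((b₁ - b₃) * s₂ + α₃ * s₂₃)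
          + - 1ℤ * (X * (b₁ + b₂) + Y * (b₁ * b₂ - d) - α₁ * α₂ * s₁₂)
          + 1ℤ * (X * (b₂ + b₃) + Y * (b₂ * b₃ - d) - α₂ * α₃ * s₂₃)
          + (b₁ - b₃) * (X + Y * b₂ - α₂ * s₂)
        lemma = solve-∀

      x₁₂p : α₁ * s₁₂₃ ≡ (b₁ + b₃) * s₂₃ - γ₃ * s₂
      x₁₂p = cancel (*-≢0 α₂≢0 α₃≢0)
        (≡-lin₂ (- 1ℤ) e₁₂₃ (b₁ + b₃) e₂₃ (≡-lin₂ (- (α₃ * γ₃)) e₂ (- (X + Y * b₂)) disc₃
          (lemma α₁ b₁ α₂ b₂ α₃ b₃ γ₃ s₁₂₃ s₂ s₂₃ X Y d)))
        where
        lemma : ∀ α₁ b₁ α₂ b₂ α₃ b₃ γ₃ s₁₂₃ s₂ s₂₃ X Y d →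
          α₂ * α₃ * (α₁ * s₁₂₃) ≡ α₂ * α₃ * ((b₁ + b₃) * s₂₃ - γ₃ * s₂)
          + - 1ℤ * (X * (b₁ * b₂ + b₁ * b₃ + b₂ * b₃ - d) + Y * (b₁ * b₂ * b₃ - d * (b₁ + b₂ + b₃)) - α₁ * α₂ * α₃ * s₁₂₃)
          + (b₁ + b₃) * (X * (b₂ + b₃) + Y * (b₂ * b₃ - d) - α₂ * α₃ * s₂₃)
          + - (α₃ * γ₃) * (X + Y * b₂ - α₂ * s₂)
          + - (X + Y * b₂) * (b₃ * b₃ + d - α₃ * γ₃)
        lemma = solve-∀

      -- (b₂ - √-d)(b₂ + √-d) = α₂γ₂ on the pair (θ, θ(b₂ + √-d)/α₂)
      y₂p : γ₂ * s₃ ≡ (b₂ - b₃) * s₂₃ + γ₃ * s₂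
      y₂p = cancel α₂≢0 (≡-lin₃ (- s₃) disc₂ (- (b₂ - b₃)) x₂p (- γ₃) x₂r (≡-lin₁ s₃ disc₃ (lemma α₂ b₂ γ₂ α₃ b₃ γ₃ s₃ s₂ s₂₃ Y d)))
        where
        lemma : ∀ α₂ b₂ γ₂ α₃ b₃ γ₃ s₃ s₂ s₂₃ Y d → α₂ * (γ₂ * s₃) ≡ α₂ * ((b₂ - b₃) * s₂₃ + γ₃ * s₂)
          + - s₃ * (b₂ * b₂ + d - α₂ * γ₂)
          + - (b₂ - b₃) * (α₂ * s₂₃ - ((b₂ + b₃) * s₃ - γ₃ * Y))
          + - γ₃ * (α₂ * s₂ - ((b₂ - b₃) * Y + α₃ * s₃))
          + s₃ * (b₃ * b₃ + d - α₃ * γ₃)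
        lemma = solve-∀
      y₂r : γ₂ * Y ≡ (b₂ + b₃) * s₂ - α₃ * s₂₃
      y₂r = cancel α₂≢0 (≡-lin₃ (- Y) disc₂ (- (b₂ + b₃)) x₂r α₃ x₂p (≡-lin₁ Y disc₃ (lemma α₂ b₂ γ₂ α₃ b₃ γ₃ s₃ s₂ s₂₃ Y d)))
        where
        lemma : ∀ α₂ b₂ γ₂ α₃ b₃ γ₃ s₃ s₂ s₂₃ Y d → α₂ * (γ₂ * Y) ≡ α₂ * ((b₂ + b₃) * s₂ - α₃ * s₂₃)
          + - Y * (b₂ * b₂ + d - α₂ * γ₂)
          + - (b₂ + b₃) * (α₂ * s₂ - ((b₂ - b₃) * Y + α₃ * s₃))
          + α₃ * (α₂ * s₂₃ - ((b₂ + b₃) * s₃ - γ₃ * Y))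
          + Y * (b₃ * b₃ + d - α₃ * γ₃)
        lemma = solve-∀

      -- On the span of θ and θ₂ the form becomes α₁ (α₂, 2b₂, γ₂); `h₀₀`, `h₀₁` and `h₁₁` are the
      -- Gram matrix. The reasons are N(θ) = α₁α₂α₃, N(θ₂) = N(θ) γ₂/α₂, and that θ₂ times the
      -- conjugate of θ has rational part N(θ) b₂/α₂.
      h₀₀ : hVal s₃ Y s₃ Y ≡ α₁ * α₂
      h₀₀ = cancel α₃≢0 (≡-lin₃ 1ℤ norm (b₃ * Y - X - α₃ * s₃) e₃ (- (Y * Y)) disc₃ (lemma α₁ α₂ α₃ b₃ γ₃ s₃ X Y d))
        where
        lemma : ∀ α₁ α₂ α₃ b₃ γ₃ s₃ X Y d → α₃ * (α₃ * (s₃ * s₃) - b₃ * (s₃ * Y + s₃ * Y) + γ₃ * (Y * Y)) ≡ α₃ * (α₁ * α₂)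
          + 1ℤ * (X * X + d * (Y * Y) - α₁ * α₂ * α₃)
          + (b₃ * Y - X - α₃ * s₃) * (X + Y * b₃ - α₃ * s₃)
          + - (Y * Y) * (b₃ * b₃ + d - α₃ * γ₃)
        lemma = solve-∀
      h₀₁ : hVal s₃ Y s₂₃ s₂ ≡ α₁ * b₂
      h₀₁ = cancel α₂≢0 (≡-lin₃ (α₃ * s₃ - b₃ * Y) x₂p (γ₃ * Y - b₃ * s₃) x₂r b₂ h₀₀ (lemma α₁ α₂ b₂ α₃ b₃ γ₃ s₃ s₂ s₂₃ Y))
        where
        lemma : ∀ α₁ α₂ b₂ α₃ b₃ γ₃ s₃ s₂ s₂₃ Y →
          α₂ * (α₃ * (s₃ * s₂₃) - b₃ * (s₃ * s₂ + s₂₃ * Y) + γ₃ * (Y * s₂)) ≡ α₂ * (α₁ * b₂)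
          + (α₃ * s₃ - b₃ * Y) * (α₂ * s₂₃ - ((b₂ + b₃) * s₃ - γ₃ * Y))
          + (γ₃ * Y - b₃ * s₃) * (α₂ * s₂ - ((b₂ - b₃) * Y + α₃ * s₃))
          + b₂ * (α₃ * (s₃ * s₃) - b₃ * (s₃ * Y + s₃ * Y) + γ₃ * (Y * Y) - α₁ * α₂)
        lemma = solve-∀
      h₁₁ : hVal s₂₃ s₂ s₂₃ s₂ ≡ α₁ * γ₂
      h₁₁ = cancel α₂≢0 (≡-lin₃ (α₃ * s₂₃ - b₃ * s₂) x₂p (γ₃ * s₂ - b₃ * s₂₃) x₂r γ₂ h₀₀
             (≡-lin₂ (- (α₃ * s₃ - b₃ * Y)) y₂p (- (γ₃ * Y - b₃ * s₃)) y₂r (lemma α₁ α₂ b₂ γ₂ α₃ b₃ γ₃ s₃ s₂ s₂₃ Y)))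
        where
        lemma : ∀ α₁ α₂ b₂ γ₂ α₃ b₃ γ₃ s₃ s₂ s₂₃ Y →
          α₂ * (α₃ * (s₂₃ * s₂₃) - b₃ * (s₂₃ * s₂ + s₂₃ * s₂) + γ₃ * (s₂ * s₂)) ≡ α₂ * (α₁ * γ₂)
          + (α₃ * s₂₃ - b₃ * s₂) * (α₂ * s₂₃ - ((b₂ + b₃) * s₃ - γ₃ * Y))
          + (γ₃ * s₂ - b₃ * s₂₃) * (α₂ * s₂ - ((b₂ - b₃) * Y + α₃ * s₃))
          + γ₂ * (α₃ * (s₃ * s₃) - b₃ * (s₃ * Y + s₃ * Y) + γ₃ * (Y * Y) - α₁ * α₂)
          + - (α₃ * s₃ - b₃ * Y) * (γ₂ * s₃ - ((b₂ - b₃) * s₂₃ + γ₃ * s₂))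
          + - (γ₃ * Y - b₃ * s₃) * (γ₂ * Y - ((b₂ + b₃) * s₂ - α₃ * s₂₃))
        lemma = solve-∀

    -- The vector is θ + t θ₂, where the form has the value α₁ a. As B is b₁ modulo α₁ and b₂ + γ₂ t
    -- modulo a, multiplication by B + √-d makes this vector divisible by α₁ and by a, hence by α₁
    -- a, and `∼-fromIdeal` applies. The sign of b₃ appears because the product of the first two
    -- ideals is inverse to the third.
    cube⇒∼ : ∀ {a B c} t k l m₁ m₂ → a ≢ 0ℤ →
      a ≡ α₂ + + 2 * b₂ * t + γ₂ * (t * t) → B ≡ b₁ + α₁ * k → B ≡ b₂ + γ₂ * t + a * l →
      m₁ * α₁ + m₂ * a ≡ 1ℤ → B * B + d ≡ α₁ * a * c →
      form α₃ (+ 2 * (- b₃)) γ₃ ∼ form (α₁ * a) (+ 2 * B) c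
    cube⇒∼ {a} {B} {c} t k l m₁ m₂ a≢0 ea eB₁ eB₂ em eB =
      ∼-fromIdeal {d} {α₃} { - b₃} {γ₃} {α₁ * a} {B} {c} p q r s (*-≢0 α₁≢0 a≢0)
        (trans (negSq b₃ d) disc₃) eB val eq es
      where
      p = s₃ + t * s₂₃
      r = Y + t * s₂
      p₁ = k * p + s₁₃ + t * s₁₂₃
      r₁ = k * r + s₁ + t * s₁₂
      -- (b₂ + γ₂ t + √-d)(θ + t θ₂) = a θ₂, because (b₂ + √-d) θ₂ = 2b₂ θ₂ - γ₂ θ; the summand a l
      -- of B adds a l (θ + t θ₂).
      p₂ = l * s₃ + (1ℤ + t * l) * s₂₃
      r₂ = l * Y + (1ℤ + t * l) * s₂
      q = m₁ * p₂ + m₂ * p₁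
      s = m₁ * r₂ + m₂ * r₁
      negSq : ∀ b d → - b * - b + d ≡ b * b + d
      negSq = solve-∀
      valL : ∀ α₁ α₂ b₂ γ₂ α₃ b₃ γ₃ s₃ s₂₃ Y s₂ t a → let p = s₃ + t * s₂₃; r = Y + t * s₂ in
        α₃ * (p * p) + + 2 * - b₃ * (p * r) + γ₃ * (r * r) ≡ α₁ * a
        + 1ℤ * (α₃ * (s₃ * s₃) - b₃ * (s₃ * Y + s₃ * Y) + γ₃ * (Y * Y) - α₁ * α₂)
        + + 2 * t * (α₃ * (s₃ * s₂₃) - b₃ * (s₃ * s₂ + s₂₃ * Y) + γ₃ * (Y * s₂) - α₁ * b₂)
        + t * t * (α₃ * (s₂₃ * s₂₃) - b₃ * (s₂₃ * s₂ + s₂₃ * s₂) + γ₃ * (s₂ * s₂) - α₁ * γ₂)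
        + - α₁ * (a - (α₂ + + 2 * b₂ * t + γ₂ * (t * t)))
      valL = solve-∀
      val : α₃ * (p * p) + + 2 * - b₃ * (p * r) + γ₃ * (r * r) ≡ α₁ * a
      val = ≡-lin₃ 1ℤ h₀₀ (+ 2 * t) h₀₁ (t * t) h₁₁ (≡-lin₁ (- α₁) ea (valL α₁ α₂ b₂ γ₂ α₃ b₃ γ₃ s₃ s₂₃ Y s₂ t a))
      q₁ : (B - - b₃) * p - γ₃ * r ≡ α₁ * p₁
      q₁ = ≡-lin₃ p eB₁ (- 1ℤ) x₁p (- t) x₁₂p (lemma B b₁ α₁ k b₃ γ₃ s₃ s₂₃ Y s₂ s₁₃ s₁₂₃ t)
        where
        lemma : ∀ B b₁ α₁ k b₃ γ₃ s₃ s₂₃ Y s₂ s₁₃ s₁₂₃ t → let p = s₃ + t * s₂₃; r = Y + t * s₂ in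
          (B - - b₃) * p - γ₃ * r ≡ α₁ * (k * p + s₁₃ + t * s₁₂₃)
          + p * (B - (b₁ + α₁ * k)) + - 1ℤ * (α₁ * s₁₃ - ((b₁ + b₃) * s₃ - γ₃ * Y))
          + - t * (α₁ * s₁₂₃ - ((b₁ + b₃) * s₂₃ - γ₃ * s₂))
        lemma = solve-∀
      s₁' : (B + - b₃) * r + α₃ * p ≡ α₁ * r₁
      s₁' = ≡-lin₃ r eB₁ (- 1ℤ) x₁r (- t) x₁₂r (lemma B b₁ α₁ k α₃ b₃ s₃ s₂₃ Y s₂ s₁ s₁₂ t)
        where
        lemma : ∀ B b₁ α₁ k α₃ b₃ s₃ s₂₃ Y s₂ s₁ s₁₂ t → let p = s₃ + t * s₂₃; r = Y + t * s₂ in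
          (B + - b₃) * r + α₃ * p ≡ α₁ * (k * r + s₁ + t * s₁₂)
          + r * (B - (b₁ + α₁ * k)) + - 1ℤ * (α₁ * s₁ - ((b₁ - b₃) * Y + α₃ * s₃))
          + - t * (α₁ * s₁₂ - ((b₁ - b₃) * s₂ + α₃ * s₂₃))
        lemma = solve-∀
      q₂ : (B - - b₃) * p - γ₃ * r ≡ a * p₂
      q₂ = ≡-lin₃ p eB₂ (- 1ℤ) x₂p t y₂p (≡-lin₁ (- s₂₃) ea (lemma B α₂ b₂ γ₂ a l b₃ γ₃ s₃ s₂₃ Y s₂ t))
        where
        lemma : ∀ B α₂ b₂ γ₂ a l b₃ γ₃ s₃ s₂₃ Y s₂ t → let p = s₃ + t * s₂₃; r = Y + t * s₂ in
          (B - - b₃) * p - γ₃ * r ≡ a * (l * s₃ + (1ℤ + t * l) * s₂₃)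
          + p * (B - (b₂ + γ₂ * t + a * l)) + - 1ℤ * (α₂ * s₂₃ - ((b₂ + b₃) * s₃ - γ₃ * Y))
          + t * (γ₂ * s₃ - ((b₂ - b₃) * s₂₃ + γ₃ * s₂)) + - s₂₃ * (a - (α₂ + + 2 * b₂ * t + γ₂ * (t * t)))
        lemma = solve-∀
      s₂' : (B + - b₃) * r + α₃ * p ≡ a * r₂
      s₂' = ≡-lin₃ r eB₂ (- 1ℤ) x₂r t y₂r (≡-lin₁ (- s₂) ea (lemma B α₂ b₂ γ₂ a l α₃ b₃ s₃ s₂₃ Y s₂ t))
        where
        lemma : ∀ B α₂ b₂ γ₂ a l α₃ b₃ s₃ s₂₃ Y s₂ t → let p = s₃ + t * s₂₃; r = Y + t * s₂ in
          (B + - b₃) * r + α₃ * p ≡ a * (l * Y + (1ℤ + t * l) * s₂)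
          + r * (B - (b₂ + γ₂ * t + a * l)) + - 1ℤ * (α₂ * s₂ - ((b₂ - b₃) * Y + α₃ * s₃))
          + t * (γ₂ * Y - ((b₂ + b₃) * s₂ - α₃ * s₂₃)) + - s₂ * (a - (α₂ + + 2 * b₂ * t + γ₂ * (t * t)))
        lemma = solve-∀
      merge : ∀ z x y → z ≡ α₁ * x → z ≡ a * y → z ≡ α₁ * a * (m₁ * y + m₂ * x)
      merge z x y e e' = ≡-lin₃ (m₂ * a) e (m₁ * α₁) e' (- z) em (lemma z x y α₁ a m₁ m₂)
        where
        lemma : ∀ z x y α₁ a m₁ m₂ → z ≡ α₁ * a * (m₁ * y + m₂ * x) + m₂ * a * (z - α₁ * x) + m₁ * α₁ * (z - a * y)
          + - z * (m₁ * α₁ + m₂ * a - 1ℤ)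
        lemma = solve-∀
      eq : (B - - b₃) * p - γ₃ * r ≡ α₁ * a * q
      eq = merge ((B - - b₃) * p - γ₃ * r) p₁ p₂ q₁ q₂
      es : (B + - b₃) * r + α₃ * p ≡ α₁ * a * s
      es = merge ((B + - b₃) * r + α₃ * p) r₁ r₂ s₁' s₂'

-- Dirichlet composition of united forms.

module Composition where
  open import Data.Nat.Base using (ℕ; zero; suc; z≤n; s≤s)
  import Data.Nat.Divisibility as ℕ
  import Data.Nat.GCD as ℕ
  open import Data.Nat.Primality using (Prime; prime[2])
  open import Data.Integer using (ℤ; +_; -[1+_]; -_; _+_; _-_; _*_; 0ℤ; 1ℤ; _<_; _≤_; +<+; +≤+) renaming (∣_∣ to abs)
  open import Data.Integer.Properties using (pos-*; *-assoc; *-zeroʳ; +-identityʳ; <-irrefl; +-mono-≤-<; _≟_)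
  open import Data.Integer.Divisibility.Signed using (_∣_; divides; _∣?_; ∣ᵤ⇒∣; ∣⇒∣ᵤ; ∣-trans; m∣∣m∣)
  open import Data.Integer.GCD using (gcd)
  open import Data.Integer.Tactic.RingSolver using (solve-∀)
  open import Data.Product using (_×_; ∃-syntax; _,_; proj₂)
  open import Data.Sum using (inj₁; inj₂; [_,_]′)
  open import Data.Empty using (⊥-elim)
  open import Relation.Nullary using (¬_; yes; no)
  open import Relation.Binary.PropositionalEquality using (_≡_; _≢_; refl; sym; trans; cong; subst)
  open LinearCombination
  open Divisibility
  open Cubes

  pos⇒≢0 : ∀ {i} → 0ℤ < i → i ≢ 0ℤ
  pos⇒≢0 h refl = <-irrefl refl h

  *-pos : ∀ {i j} → 0ℤ < i → 0ℤ < j → 0ℤ < i * j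
  *-pos {+ suc m} {+ suc n} _ _ = +<+ (s≤s z≤n)
  *-pos {+ suc m} {+ zero} _ h = ⊥-elim (<-irrefl refl h)
  *-pos {+ zero} h _ = ⊥-elim (<-irrefl refl h)

  *-pos-cancelˡ : ∀ {i j} → 0ℤ < i → 0ℤ < i * j → 0ℤ < j
  *-pos-cancelˡ {+ suc m} {+ suc n} _ _ = +<+ (s≤s z≤n)
  *-pos-cancelˡ {+ suc m} {+ zero} _ h = ⊥-elim (<-irrefl (sym (*-zeroʳ (+ suc m))) h)
  *-pos-cancelˡ {+ suc m} { -[1+ n ]} _ ()
  *-pos-cancelˡ {+ zero} h _ = ⊥-elim (<-irrefl refl h)

  0≤square : ∀ x → 0ℤ ≤ x * x
  0≤square (+ n) = subst (0ℤ ≤_) (pos-* n n) (+≤+ z≤n)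
  0≤square -[1+ n ] = +≤+ z≤n

  0<square : ∀ {x} → x ≢ 0ℤ → 0ℤ < x * x
  0<square {+ zero} h = ⊥-elim (h refl)
  0<square {+ suc n} _ = +<+ (s≤s z≤n)
  0<square { -[1+ n ]} _ = +<+ (s≤s z≤n)

  0<x²+dy² : ∀ {d} x y → 0ℤ < d → (y ≡ 0ℤ → x ≢ 0ℤ) → 0ℤ < x * x + d * (y * y)
  0<x²+dy² {d} x y 0<d h with y ≟ 0ℤ
  ... | yes refl = subst (0ℤ <_) (sym (trans (cong (λ z → x * x + z) (*-zeroʳ d)) (+-identityʳ (x * x)))) (0<square (h refl))
  ... | no y≢0  = +-mono-≤-< (0≤square x) (*-pos 0<d (0<square y≢0))

  bézout⇒gcd≡1 : ∀ m₁ m₂ a b c → m₁ * a + m₂ * b ≡ 1ℤ → gcd (gcd a b) c ≡ 1ℤ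
  bézout⇒gcd≡1 m₁ m₂ a b c e = cong +_ (ℕ.∣1⇒≡1 (ℕ.∣-trans (ℕ.gcd[m,n]∣m (ℕ.gcd (abs a) (abs b)) (abs c)) (∣⇒∣ᵤ g∣1)))
    where
    g = gcd a b
    g∣1 : g ∣ 1ℤ
    g∣1 = ∣-lin₂ (∣ᵤ⇒∣ {g} {a} (ℕ.gcd[m,n]∣m (abs a) (abs b))) m₁ (∣ᵤ⇒∣ {g} {b} (ℕ.gcd[m,n]∣n (abs a) (abs b))) m₂ (sym e)

  *-∣-mono : ∀ {i j k l} → i ∣ j → k ∣ l → i * k ∣ j * l
  *-∣-mono {i} {j} {k} {l} (divides q refl) (divides r refl) = divides (q * r) (lemma q i r k)
    where
    lemma : ∀ q i r k → q * i * (r * k) ≡ q * r * (i * k)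
    lemma = solve-∀

  module _ {d : ℤ} (max : MaximalOrder d) {α b γ : ℤ} (disc : b * b + d ≡ α * γ) where

    ramified⇒∤both : ∀ {p} → Prime p → Ramified d p → + p ∣ α → ¬ + p ∣ γ
    ramified⇒∤both pp ram p∣α p∣γ =
      prime∤1 pp (proj₂ (∣-square ram {b} {1ℤ} (subst (_ ∣_) (trans (sym disc) (lemma b d)) (*-∣-mono p∣α p∣γ))))
      where
      lemma : ∀ b d → b * b + d ≡ b * b + d * (1ℤ * 1ℤ)
      lemma = solve-∀

    -- Such a prime is 2 or divides b, hence also d = αγ - b². Either way it is ramified, whereas p²
    -- ∣ αγ = b² + d·1² would then force p ∣ 1.
    primitivity : ∀ {p} → Prime p → + p ∣ α → + p ∣ + 2 * b → ¬ + p ∣ γ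
    primitivity {p} pp p∣α p∣2b p∣γ with euclid pp (+ 2) b p∣2b
    ... | inj₁ p∣2 = ramified⇒∤both pp (subst (Ramified d) (sym (prime∣prime prime[2] pp p∣2)) (ramified-2 max)) p∣α p∣γ
    ... | inj₂ p∣b = ramified⇒∤both pp (ramified-∣d max pp
            (∣-lin₂ p∣α γ p∣b (- b) (≡-lin₁ 1ℤ disc (lemma α b γ d)))) p∣α p∣γ
      where
      lemma : ∀ α b γ d → d ≡ γ * α + - b * b + 1ℤ * (b * b + d - α * γ)
      lemma = solve-∀

    -- Vanishing at 0, 1 and -1 would give p ∣ α and p ∣ 2γ. This yields p ∣ γ even for p = 2, where
    -- the middle term is zero anyway, and then p ∣ 2b, against `primitivity`.
    nonzeroValue : ∀ p → Prime p → ∃[ t ] ¬ + p ∣ α + + 2 * b * t + γ * (t * t)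
    nonzeroValue p pp with + p ∣? α
    ... | no p∤α = 0ℤ , λ h → p∤α (subst (+ p ∣_) (lemma α b γ) h)
      where
      lemma : ∀ α b γ → α + + 2 * b * 0ℤ + γ * (0ℤ * 0ℤ) ≡ α
      lemma = solve-∀
    ... | yes p∣α with + p ∣? α + + 2 * b * 1ℤ + γ * (1ℤ * 1ℤ)
    ...   | no h = 1ℤ , h
    ...   | yes h₁ = - 1ℤ , λ h₂ → primitivity pp p∣α (p∣2b h₂) (p∣γ h₂)
      where
      lemma₁ : ∀ α b γ → + 2 * γ ≡ 1ℤ * (1ℤ * (α + + 2 * b * 1ℤ + γ * (1ℤ * 1ℤ)) + - (+ 2) * α) + 1ℤ * (α + + 2 * b * - 1ℤ + γ * (- 1ℤ * - 1ℤ))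
      lemma₁ = solve-∀
      lemma₂ : ∀ α b γ → γ ≡ 1ℤ * (1ℤ * (α + + 2 * b * 1ℤ + γ * (1ℤ * 1ℤ)) + - 1ℤ * α) + - b * + 2
      lemma₂ = solve-∀
      lemma₃ : ∀ α b γ → + 2 * b ≡ 1ℤ * (1ℤ * (α + + 2 * b * 1ℤ + γ * (1ℤ * 1ℤ)) + - 1ℤ * α) + - 1ℤ * γ
      lemma₃ = solve-∀
      p∣γ : + p ∣ α + + 2 * b * - 1ℤ + γ * (- 1ℤ * - 1ℤ) → + p ∣ γ
      p∣γ h₂ = [ (λ p∣2 → ∣-lin₂ (∣-lin₂ h₁ 1ℤ p∣α (- 1ℤ) refl) 1ℤ p∣2 (- b) (lemma₂ α b γ)) , (λ p∣γ' → p∣γ') ]′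
        (euclid pp (+ 2) γ (∣-lin₂ (∣-lin₂ h₁ 1ℤ p∣α (- (+ 2)) refl) 1ℤ h₂ 1ℤ (lemma₁ α b γ)))
      p∣2b : + p ∣ α + + 2 * b * - 1ℤ + γ * (- 1ℤ * - 1ℤ) → + p ∣ + 2 * b
      p∣2b h₂ = ∣-lin₂ (∣-lin₂ h₁ 1ℤ p∣α (- 1ℤ) refl) 1ℤ (p∣γ h₂) (- 1ℤ) (lemma₃ α b γ)

    -- The classical preparation for Dirichlet composition, making leading coefficients coprime.
    -- Only vectors (1, t) are used, since they extend to determinant 1 without a further choice.
    valueCoprimeTo : ∀ n → n ≢ 0ℤ → ∃[ t ] ∃[ k ] ∃[ l ] k * n + l * (α + + 2 * b * t + γ * (t * t)) ≡ 1ℤ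
    valueCoprimeTo n n≢0 with primeFactors n n≢0
    ... | ps , pps , e with coprimeValue α b γ nonzeroValue ps pps
    ... | t , h = t , bézout-noCommonPrime n (α + + 2 * b * t + γ * (t * t)) n≢0
            λ p pp p∣n → h p pp (subst (λ x → + p ∣ + x) e (∣-trans p∣n m∣∣m∣))

  chineseRemainder : ∀ m₁ m₂ α a b b' → m₁ * α + m₂ * a ≡ 1ℤ →
    ∃[ B ] ∃[ k ] ∃[ l ] (B ≡ b + α * k) × (B ≡ b' + a * l)
  chineseRemainder m₁ m₂ α a b b' e = _ , m₁ * (b' - b) , - m₂ * (b' - b) , refl , ≡-lin₁ (b' - b) e (lemma m₁ m₂ α a b b')
    where
    lemma : ∀ m₁ m₂ α a b b' → b + α * (m₁ * (b' - b)) ≡ b' + a * (- m₂ * (b' - b)) + (b' - b) * (m₁ * α + m₂ * a - 1ℤ)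
    lemma = solve-∀

  coprime-*-∣ : ∀ m₁ m₂ α a z → m₁ * α + m₂ * a ≡ 1ℤ → α ∣ z → a ∣ z → ∃[ c ] z ≡ α * a * c
  coprime-*-∣ m₁ m₂ α a z e (divides x e₁) (divides y e₂) =
    m₁ * y + m₂ * x , ≡-lin₃ (m₂ * a) e₁ (m₁ * α) e₂ (- z) e (lemma z x y α a m₁ m₂)
    where
    lemma : ∀ z x y α a m₁ m₂ → z ≡ α * a * (m₁ * y + m₂ * x) + m₂ * a * (z - x * α) + m₁ * α * (z - y * a)
      + - z * (m₁ * α + m₂ * a - 1ℤ)
    lemma = solve-∀

  -- Completing the square: α a = (α + b t)² + d t².
  value-pos : ∀ {d α b γ a} t → 0ℤ < d → 0ℤ < α → b * b + d ≡ α * γ → a ≡ α + + 2 * b * t + γ * (t * t) → 0ℤ < a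
  value-pos {d} {α} {b} {γ} {a} t 0<d 0<α disc ea = *-pos-cancelˡ 0<α (subst (0ℤ <_) eq
      (0<x²+dy² (α + b * t) t 0<d λ t≡0 e → pos⇒≢0 0<α
        (trans (sym (trans (cong (λ z → α + b * z) t≡0) (trans (cong (λ z → α + z) (*-zeroʳ b)) (+-identityʳ α)))) e)))
    where
    lemma : ∀ α b γ d a t → (α + b * t) * (α + b * t) + d * (t * t) ≡ α * a + t * t * (b * b + d - α * γ)
      + - α * (a - (α + + 2 * b * t + γ * (t * t)))
    lemma = solve-∀
    eq : (α + b * t) * (α + b * t) + d * (t * t) ≡ α * a
    eq = ≡-lin₂ (t * t) disc (- α) ea (lemma α b γ d a t)

  module _ {d α₁ b₁ γ₁ α₂ b₂ γ₂ α₃ b₃ γ₃ : ℤ} (max : MaximalOrder d) (0<d : 0ℤ < d)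
    (0<α₁ : 0ℤ < α₁) (0<α₂ : 0ℤ < α₂) (α₃≢0 : α₃ ≢ 0ℤ)
    (disc₁ : b₁ * b₁ + d ≡ α₁ * γ₁) (disc₂ : b₂ * b₂ + d ≡ α₂ * γ₂) (disc₃ : b₃ * b₃ + d ≡ α₃ * γ₃)
    (cube : Cube d α₁ b₁ α₂ b₂ α₃ b₃) where

    private
      module Concordant {a B c : ℤ} (t k l m₁ m₂ : ℤ) (ea : a ≡ α₂ + + 2 * b₂ * t + γ₂ * (t * t))
        (em : m₁ * α₁ + m₂ * a ≡ 1ℤ) (eB₁ : B ≡ b₁ + α₁ * k) (eB₂ : B ≡ b₂ + γ₂ * t + a * l)
        (eB : B * B + d ≡ α₁ * a * c) where

        0<a : 0ℤ < a
        0<a = value-pos {d} {α₂} {b₂} {γ₂} {a} t 0<d 0<α₂ disc₂ ea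
        comm : ∀ x y z → x * y * z ≡ y * (x * z)
        comm = solve-∀
        valL : ∀ a α b γ t → α * (1ℤ * 1ℤ) + + 2 * b * (1ℤ * t) + γ * (t * t) ≡ a + - 1ℤ * (a - (α + + 2 * b * t + γ * (t * t)))
        valL = solve-∀
        qL : ∀ B a b₂ γ₂ t l → (B - b₂) * 1ℤ - γ₂ * t ≡ a * l + 1ℤ * (B - (b₂ + γ₂ * t + a * l))
        qL = solve-∀
        sL : ∀ B a α₂ b₂ γ₂ t l →
          (B + b₂) * t + α₂ * 1ℤ ≡ a * (1ℤ + t * l) + t * (B - (b₂ + γ₂ * t + a * l))
            + - 1ℤ * (a - (α₂ + + 2 * b₂ * t + γ₂ * (t * t)))
        sL = solve-∀

        f∼ : form α₁ (+ 2 * b₁) γ₁ ∼ form α₁ (+ 2 * B) (a * c)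
        f∼ = ∼-translate {d} {α₁} {b₁} {γ₁} {B} {a * c} k (pos⇒≢0 0<α₁) disc₁ (trans eB (*-assoc α₁ a c)) eB₁
        g∼ : form α₂ (+ 2 * b₂) γ₂ ∼ form a (+ 2 * B) (α₁ * c)
        -- The matrix has columns (1, t) and (l, 1 + t l).
        g∼ = ∼-fromIdeal {d} {α₂} {b₂} {γ₂} {a} {B} {α₁ * c} 1ℤ l t (1ℤ + t * l) (pos⇒≢0 0<a) disc₂
          (trans eB (comm α₁ a c)) (≡-lin₁ (- 1ℤ) ea (valL a α₂ b₂ γ₂ t)) (≡-lin₁ 1ℤ eB₂ (qL B a b₂ γ₂ t l))
          (≡-lin₂ t eB₂ (- 1ℤ) ea (sL B a α₂ b₂ γ₂ t l))
        h∼ : form α₃ (+ 2 * - b₃) γ₃ ∼ form (α₁ * a) (+ 2 * B) c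
        h∼ = cube⇒∼ {d} {α₁} {b₁} {γ₁} {α₂} {b₂} {γ₂} {α₃} {b₃} {γ₃} (pos⇒≢0 0<α₁) (pos⇒≢0 0<α₂) α₃≢0 disc₁ disc₂ disc₃ cube {a} {B} {c} t k l m₁ m₂ (pos⇒≢0 0<a) ea eB₁ eB₂ em eB

        composite : IsComposite (form α₁ (+ 2 * b₁) γ₁) (form α₂ (+ 2 * b₂) γ₂) (form α₃ (+ 2 * - b₃) γ₃)
        composite = α₁ , a , + 2 * B , c , 0<α₁ , 0<a , bézout⇒gcd≡1 m₁ m₂ α₁ a (+ 2 * B) em , f∼ , g∼ , h∼

      ∣₁ : ∀ {B} k → B ≡ b₁ + α₁ * k → α₁ ∣ B * B + d
      ∣₁ {B} k eB = divides (γ₁ + + 2 * b₁ * k + α₁ * (k * k))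
        (≡-lin₂ (B + (b₁ + α₁ * k)) eB 1ℤ disc₁ (lemma B α₁ b₁ γ₁ d k))
        where
        lemma : ∀ B α₁ b₁ γ₁ d k → B * B + d ≡ (γ₁ + + 2 * b₁ * k + α₁ * (k * k)) * α₁
          + (B + (b₁ + α₁ * k)) * (B - (b₁ + α₁ * k)) + 1ℤ * (b₁ * b₁ + d - α₁ * γ₁)
        lemma = solve-∀

      ∣₂ : ∀ {a B} t l → a ≡ α₂ + + 2 * b₂ * t + γ₂ * (t * t) → B ≡ b₂ + γ₂ * t + a * l → a ∣ B * B + d
      ∣₂ {a} {B} t l ea eB = divides (γ₂ + + 2 * (b₂ + γ₂ * t) * l + a * (l * l))
        (≡-lin₃ (B + (b₂ + γ₂ * t + a * l)) eB 1ℤ disc₂ (- γ₂) ea (lemma B a α₂ b₂ γ₂ d t l))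
        where
        lemma : ∀ B a α₂ b₂ γ₂ d t l → B * B + d ≡ (γ₂ + + 2 * (b₂ + γ₂ * t) * l + a * (l * l)) * a
            + (B + (b₂ + γ₂ * t + a * l)) * (B - (b₂ + γ₂ * t + a * l)) + 1ℤ * (b₂ * b₂ + d - α₂ * γ₂)
            + - γ₂ * (a - (α₂ + + 2 * b₂ * t + γ₂ * (t * t)))
        lemma = solve-∀

    private
      Goal : Set
      Goal = IsComposite (form α₁ (+ 2 * b₁) γ₁) (form α₂ (+ 2 * b₂) γ₂) (form α₃ (+ 2 * - b₃) γ₃)

      choose-c : ∀ {a B} t k l m₁ m₂ → a ≡ α₂ + + 2 * b₂ * t + γ₂ * (t * t) → m₁ * α₁ + m₂ * a ≡ 1ℤ →
        B ≡ b₁ + α₁ * k → B ≡ b₂ + γ₂ * t + a * l → (∃[ c ] B * B + d ≡ α₁ * a * c) → Goal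
      choose-c {a} {B} t k l m₁ m₂ ea em eB₁ eB₂ (c , eB) = Concordant.composite {a} {B} {c} t k l m₁ m₂ ea em eB₁ eB₂ eB

      choose-B : ∀ {a} t m₁ m₂ → a ≡ α₂ + + 2 * b₂ * t + γ₂ * (t * t) → m₁ * α₁ + m₂ * a ≡ 1ℤ →
        (∃[ B ] ∃[ k ] ∃[ l ] (B ≡ b₁ + α₁ * k) × (B ≡ b₂ + γ₂ * t + a * l)) → Goal
      choose-B {a} t m₁ m₂ ea em (B , k , l , eB₁ , eB₂) = choose-c {a} {B} t k l m₁ m₂ ea em eB₁ eB₂
        (coprime-*-∣ m₁ m₂ α₁ a (B * B + d) em (∣₁ {B} k eB₁) (∣₂ {a} {B} t l ea eB₂))

      choose-t : (∃[ t ] ∃[ m₁ ] ∃[ m₂ ] m₁ * α₁ + m₂ * (α₂ + + 2 * b₂ * t + γ₂ * (t * t)) ≡ 1ℤ) → Goal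
      choose-t (t , m₁ , m₂ , em) = choose-B {α₂ + + 2 * b₂ * t + γ₂ * (t * t)} t m₁ m₂ refl em
        (chineseRemainder m₁ m₂ α₁ (α₂ + + 2 * b₂ * t + γ₂ * (t * t)) b₁ (b₂ + γ₂ * t) em)

    -- The second form is replaced by an equivalent one whose leading coefficient a, its value at
    -- (1, t), is prime to α₁. The Chinese remainder theorem supplies a common middle coefficient
    -- 2B, and α₁ a ∣ B² + d supplies c. The cube identifies the class of (α₁ a, 2B, c).
    cube⇒composite : IsComposite (form α₁ (+ 2 * b₁) γ₁) (form α₂ (+ 2 * b₂) γ₂) (form α₃ (+ 2 * - b₃) γ₃)
    cube⇒composite = choose-t (valueCoprimeTo max {α₂} {b₂} {γ₂} disc₂ α₁ (pos⇒≢0 0<α₁))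

-- Integrality of the cube, one prime at a time.

module LocalConditions where
  open import Data.Nat.Primality using (Prime)
  open import Data.Integer using (ℤ; +_; -_; _+_; _-_; _*_; 0ℤ; 1ℤ)
  open import Data.Integer.Divisibility.Signed using (_∣_; divides; _∣?_; ∣-refl; ∣m⇒∣m*n; ∣n⇒∣m*n)
  open import Data.Integer.Tactic.RingSolver using (solve-∀)
  open import Data.Product using (_×_; ∃-syntax; _,_; proj₁; proj₂)
  open import Data.Sum using (_⊎_; inj₁; inj₂)
  open import Relation.Nullary using (¬_; yes; no)
  open import Relation.Binary.PropositionalEquality using (_≡_; _≢_; sym; trans; cong₂; subst)
  open LinearCombination
  open Divisibility
  open Cubes
  open Composition

  private
    1sq : ∀ b d → b * b + d ≡ b * b + d * (1ℤ * 1ℤ)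
    1sq = solve-∀

  ∣disc : ∀ {p d α b γ} → + p ∣ α → b * b + d ≡ α * γ → + p ∣ b * b + d * (1ℤ * 1ℤ)
  ∣disc {p} {d} {α} {b} {γ} p∣α e = subst (+ p ∣_) (trans (sym e) (1sq b d)) (∣m⇒∣m*n γ p∣α)

  ramified-squarefree : ∀ {p d α b γ} → Prime p → Ramified d p → b * b + d ≡ α * γ → ¬ + p * + p ∣ α
  ramified-squarefree {p} {d} {α} {b} {γ} pp ram e h =
    prime∤1 pp (proj₂ (∣-square ram {b} {1ℤ} (subst (+ p * + p ∣_) (trans (sym e) (1sq b d)) (∣m⇒∣m*n γ h))))

  cofactor-∤ : ∀ {p d α b γ} → Prime p → Ramified d p → b * b + d ≡ α * γ → ∀ q → α ≡ q * + p → ¬ + p ∣ q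
  cofactor-∤ {p} {d} {α} {b} {γ} pp ram e q α≡qp p∣q = ramified-squarefree {p} {d} {α} {b} {γ} pp ram e
    (subst (+ p * + p ∣_) (sym α≡qp) (*-∣-mono p∣q (∣-refl {+ p})))

  module _ {d X Y : ℤ} where

    -- S is the √-d-coordinate of θ w w' with w = b + √-d and w' = b' + √-d. Each case names a
    -- multiplier prime to p whose product with S is visibly divisible by α α'.
    pair-∣ : ∀ α b γ α' b' γ' c → α ≢ 0ℤ → α' ≢ 0ℤ →
      b * b + d ≡ α * γ → b' * b' + d ≡ α' * γ' → X * X + d * (Y * Y) ≡ α * α' * c →
      α ∣ X + Y * b → α' ∣ X + Y * b' →
      (∀ p → Prime p → + p ∣ α → + p ∣ α' → Ramified d p ⊎ (¬ + p ∣ Y) ⊎ (¬ + p ∣ b - b')) →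
      α * α' ∣ X * (b + b') + Y * (b * b' - d)
    pair-∣ α b γ α' b' γ' c α≢0 α'≢0 e e' norm (divides s es) (divides s' es') H =
      ∣-local-global (α * α') S (*-≢0 α≢0 α'≢0) loc
      where
      S = X * (b + b') + Y * (b * b' - d)
      loc : ∀ p → Prime p → + p ∣ α * α' → ∃[ m ] (¬ + p ∣ m) × (α * α' ∣ m * S)
      loc p pp _ with + p ∣? α | + p ∣? α'
      -- S = (b + b')(X + Y b') - Y (b'² + d), so α' divides S.
      ... | no p∤α | _ = α , p∤α , divides ((b + b') * s' - Y * γ')
              (≡-lin₂ (α * (b + b')) es' (- (α * Y)) e' (lemma α b α' b' γ' s' X Y d))
        where
        lemma : ∀ α b α' b' γ' s' X Y d → α * (X * (b + b') + Y * (b * b' - d)) ≡ ((b + b') * s' - Y * γ') * (α * α')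
          + α * (b + b') * (X + Y * b' - s' * α') + - (α * Y) * (b' * b' + d - α' * γ')
        lemma = solve-∀
      ... | yes _ | no p∤α' = α' , p∤α' , divides ((b + b') * s - Y * γ)
              (≡-lin₂ (α' * (b + b')) es (- (α' * Y)) e (lemma α b γ α' b' s X Y d))
        where
        lemma : ∀ α b γ α' b' s X Y d → α' * (X * (b + b') + Y * (b * b' - d)) ≡ ((b + b') * s - Y * γ) * (α * α')
          + α' * (b + b') * (X + Y * b - s * α) + - (α' * Y) * (b * b + d - α * γ)
        lemma = solve-∀
      ... | yes p∣α | yes p∣α' with H p pp p∣α p∣α'
      -- Y S = (X + Y b)(X + Y b') - N(θ).
      ...   | inj₂ (inj₁ p∤Y) = Y , p∤Y , divides (s * s' - c)
              (≡-lin₃ (X + Y * b') es (s * α) es' (- 1ℤ) norm (lemma α b α' b' s s' c X Y d))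
        where
        lemma : ∀ α b α' b' s s' c X Y d → Y * (X * (b + b') + Y * (b * b' - d)) ≡ (s * s' - c) * (α * α')
          + (X + Y * b') * (X + Y * b - s * α) + s * α * (X + Y * b' - s' * α') + - 1ℤ * (X * X + d * (Y * Y) - α * α' * c)
        lemma = solve-∀
      -- (b - b') S = (X + Y b')(b² + d) - (X + Y b)(b'² + d).
      ...   | inj₂ (inj₂ p∤b-b') = b - b' , p∤b-b' , divides (γ * s' - γ' * s)
              (≡-lin₂ (X + Y * b') e (- (X + Y * b)) e'
                (≡-lin₂ (α * γ) es' (- (α' * γ')) es (lemma α b γ α' b' γ' s s' X Y d)))
        where
        lemma : ∀ α b γ α' b' γ' s s' X Y d → (b - b') * (X * (b + b') + Y * (b * b' - d)) ≡ (γ * s' - γ' * s) * (α * α')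
          + (X + Y * b') * (b * b + d - α * γ) + - (X + Y * b) * (b' * b' + d - α' * γ')
          + α * γ * (X + Y * b' - s' * α') + - (α' * γ') * (X + Y * b - s * α)
        lemma = solve-∀
      -- A ramified p divides α and α' exactly once, so p² ∣ S suffices: one factor p comes from θ,
      -- because p² ∣ N(θ), the other from w w'.
      loc p pp _ | yes (divides q eq) | yes (divides q' eq') | inj₁ ram =
        q * q' , ∤-* pp (cofactor-∤ {p} {d} {α} {b} {γ} pp ram e q eq) (cofactor-∤ {p} {d} {α'} {b'} {γ'} pp ram e' q' eq') ,
        subst (_∣ q * q' * S) (trans (reorder q q' (+ p)) (cong₂ _*_ (sym eq) (sym eq')))
          (*-∣-mono (∣-refl {q * q'}) pp∣S)
        where
        reorder : ∀ q q' p → q * q' * (p * p) ≡ q * p * (q' * p)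
        reorder = solve-∀
        p²∣N : + p * + p ∣ X * X + d * (Y * Y)
        p²∣N = subst (+ p * + p ∣_) (sym norm) (∣m⇒∣m*n c (*-∣-mono (divides q eq) (divides q' eq')))
        p∣XY = ∣-square ram {X} {Y} p²∣N
        p∣ww' = ∣-product ram {b} {1ℤ} {b'} {1ℤ} (∣disc {p} {d} {α} {b} {γ} (divides q eq) e) (∣disc {p} {d} {α'} {b'} {γ'} (divides q' eq') e')
        pp∣S : + p * + p ∣ S
        pp∣S = ∣-lin₂ (*-∣-mono (proj₁ p∣XY) (proj₂ p∣ww')) 1ℤ (*-∣-mono (proj₂ p∣XY) (proj₁ p∣ww')) 1ℤ (lemma b b' X Y d)
          where
          lemma : ∀ b b' X Y d → X * (b + b') + Y * (b * b' - d) ≡ 1ℤ * (X * (b * 1ℤ + 1ℤ * b')) + 1ℤ * (Y * (b * b' - d * (1ℤ * 1ℤ)))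
          lemma = solve-∀

    -- The same method for the √-d-coordinate S of θ w₁ w₂ w₃. Two alternatives remain, because an
    -- unramified prime dividing all three αᵢ will turn out not to divide Y.
    triple-∣ : ∀ α₁ b₁ γ₁ α₂ b₂ γ₂ α₃ b₃ γ₃ → α₁ ≢ 0ℤ → α₂ ≢ 0ℤ → α₃ ≢ 0ℤ →
      b₁ * b₁ + d ≡ α₁ * γ₁ → b₂ * b₂ + d ≡ α₂ * γ₂ → b₃ * b₃ + d ≡ α₃ * γ₃ →
      X * X + d * (Y * Y) ≡ α₁ * α₂ * α₃ →
      α₁ ∣ X + Y * b₁ → α₂ ∣ X + Y * b₂ → α₃ ∣ X + Y * b₃ →
      α₁ * α₂ ∣ X * (b₁ + b₂) + Y * (b₁ * b₂ - d) →
      α₁ * α₃ ∣ X * (b₁ + b₃) + Y * (b₁ * b₃ - d) →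
      α₂ * α₃ ∣ X * (b₂ + b₃) + Y * (b₂ * b₃ - d) →
      (∀ p → Prime p → + p ∣ α₁ → + p ∣ α₂ → + p ∣ α₃ → Ramified d p ⊎ (¬ + p ∣ Y)) →
      α₁ * α₂ * α₃ ∣ X * (b₁ * b₂ + b₁ * b₃ + b₂ * b₃ - d) + Y * (b₁ * b₂ * b₃ - d * (b₁ + b₂ + b₃))
    triple-∣ α₁ b₁ γ₁ α₂ b₂ γ₂ α₃ b₃ γ₃ α₁≢0 α₂≢0 α₃≢0 f₁ f₂ f₃ norm
      (divides s₁ e₁) (divides s₂ e₂) (divides s₃ e₃) (divides s₁₂ e₁₂) (divides s₁₃ e₁₃) (divides s₂₃ e₂₃) H =
      ∣-local-global (α₁ * α₂ * α₃) S (*-≢0 (*-≢0 α₁≢0 α₂≢0) α₃≢0) loc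
      where
      S = X * (b₁ * b₂ + b₁ * b₃ + b₂ * b₃ - d) + Y * (b₁ * b₂ * b₃ - d * (b₁ + b₂ + b₃))
      single : ∀ α₁ b₁ α₂ b₂ γ₂ α₃ b₃ s₃ s₂₃ → b₂ * b₂ + d ≡ α₂ * γ₂ → X + Y * b₃ ≡ s₃ * α₃ →
        X * (b₂ + b₃) + Y * (b₂ * b₃ - d) ≡ s₂₃ * (α₂ * α₃) →
        α₁ * (X * (b₁ * b₂ + b₁ * b₃ + b₂ * b₃ - d) + Y * (b₁ * b₂ * b₃ - d * (b₁ + b₂ + b₃)))
          ≡ ((b₁ + b₂) * s₂₃ - γ₂ * s₃) * (α₁ * α₂ * α₃)
      single α₁ b₁ α₂ b₂ γ₂ α₃ b₃ s₃ s₂₃ f₂ e₃ e₂₃ =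
        ≡-lin₃ (α₁ * (b₁ + b₂)) e₂₃ (- (α₁ * α₂ * γ₂)) e₃ (- (α₁ * (X + Y * b₃))) f₂ (lemma α₁ b₁ α₂ b₂ γ₂ α₃ b₃ s₃ s₂₃ X Y d)
        where
        lemma : ∀ α₁ b₁ α₂ b₂ γ₂ α₃ b₃ s₃ s₂₃ X Y d →
          α₁ * (X * (b₁ * b₂ + b₁ * b₃ + b₂ * b₃ - d) + Y * (b₁ * b₂ * b₃ - d * (b₁ + b₂ + b₃)))
          ≡ ((b₁ + b₂) * s₂₃ - γ₂ * s₃) * (α₁ * α₂ * α₃)
          + α₁ * (b₁ + b₂) * (X * (b₂ + b₃) + Y * (b₂ * b₃ - d) - s₂₃ * (α₂ * α₃))
          + - (α₁ * α₂ * γ₂) * (X + Y * b₃ - s₃ * α₃)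
          + - (α₁ * (X + Y * b₃)) * (b₂ * b₂ + d - α₂ * γ₂)
        lemma = solve-∀
      swap₂ : ∀ α₁ α₂ α₃ b₁ b₂ b₃ q X Y d →
        α₂ * (X * (b₁ * b₂ + b₁ * b₃ + b₂ * b₃ - d) + Y * (b₁ * b₂ * b₃ - d * (b₁ + b₂ + b₃))) ≡ q * (α₁ * α₂ * α₃)
        + 1ℤ * (α₂ * (X * (b₂ * b₁ + b₂ * b₃ + b₁ * b₃ - d) + Y * (b₂ * b₁ * b₃ - d * (b₂ + b₁ + b₃))) - q * (α₂ * α₁ * α₃))
      swap₂ = solve-∀
      swap₃ : ∀ α₁ α₂ α₃ b₁ b₂ b₃ q X Y d →
        α₃ * (X * (b₁ * b₂ + b₁ * b₃ + b₂ * b₃ - d) + Y * (b₁ * b₂ * b₃ - d * (b₁ + b₂ + b₃))) ≡ q * (α₁ * α₂ * α₃)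
        + 1ℤ * (α₃ * (X * (b₃ * b₁ + b₃ * b₂ + b₁ * b₂ - d) + Y * (b₃ * b₁ * b₂ - d * (b₃ + b₁ + b₂))) - q * (α₃ * α₁ * α₂))
      swap₃ = solve-∀
      loc : ∀ p → Prime p → + p ∣ α₁ * α₂ * α₃ → ∃[ m ] (¬ + p ∣ m) × (α₁ * α₂ * α₃ ∣ m * S)
      loc p pp _ with + p ∣? α₁ | + p ∣? α₂ | + p ∣? α₃
      ... | no p∤α₁ | _ | _ = α₁ , p∤α₁ , divides ((b₁ + b₂) * s₂₃ - γ₂ * s₃)
              (single α₁ b₁ α₂ b₂ γ₂ α₃ b₃ s₃ s₂₃ f₂ e₃ e₂₃)
      ... | yes _ | no p∤α₂ | _ = α₂ , p∤α₂ , divides ((b₂ + b₁) * s₁₃ - γ₁ * s₃)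
              (≡-lin₁ 1ℤ (single α₂ b₂ α₁ b₁ γ₁ α₃ b₃ s₃ s₁₃ f₁ e₃ e₁₃)
                 (swap₂ α₁ α₂ α₃ b₁ b₂ b₃ ((b₂ + b₁) * s₁₃ - γ₁ * s₃) X Y d))
      ... | yes _ | yes _ | no p∤α₃ = α₃ , p∤α₃ , divides ((b₃ + b₁) * s₁₂ - γ₁ * s₂)
              (≡-lin₁ 1ℤ (single α₃ b₃ α₁ b₁ γ₁ α₂ b₂ s₂ s₁₂ f₁ e₂ e₁₂)
                 (swap₃ α₁ α₂ α₃ b₁ b₂ b₃ ((b₃ + b₁) * s₁₂ - γ₁ * s₂) X Y d))
      ... | yes p∣α₁ | yes p∣α₂ | yes p∣α₃ with H p pp p∣α₁ p∣α₂ p∣α₃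
      -- Y S = (X + Y b₁) S₂₃ - (b₂ + b₃) N(θ), where S₂₃ is the √-d-coordinate of θ w₂ w₃.
      ...   | inj₂ p∤Y = Y , p∤Y , divides (s₁ * s₂₃ - (b₂ + b₃))
              (≡-lin₃ (X * (b₂ + b₃) + Y * (b₂ * b₃ - d)) e₁ (s₁ * α₁) e₂₃ (- (b₂ + b₃)) norm
                (lemma α₁ b₁ α₂ b₂ α₃ b₃ s₁ s₂₃ X Y d))
        where
        lemma : ∀ α₁ b₁ α₂ b₂ α₃ b₃ s₁ s₂₃ X Y d →
          Y * (X * (b₁ * b₂ + b₁ * b₃ + b₂ * b₃ - d) + Y * (b₁ * b₂ * b₃ - d * (b₁ + b₂ + b₃)))
          ≡ (s₁ * s₂₃ - (b₂ + b₃)) * (α₁ * α₂ * α₃)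
          + (X * (b₂ + b₃) + Y * (b₂ * b₃ - d)) * (X + Y * b₁ - s₁ * α₁)
          + s₁ * α₁ * (X * (b₂ + b₃) + Y * (b₂ * b₃ - d) - s₂₃ * (α₂ * α₃))
          + - (b₂ + b₃) * (X * X + d * (Y * Y) - α₁ * α₂ * α₃)
        lemma = solve-∀
      -- Three factors p have to be found. One comes from θ = p θ'; the norm of θ' is q₁q₂α₃, still
      -- divisible by p, so p divides θ' w₁ as well as w₂ w₃.
      loc p pp _ | yes (divides q₁ g₁) | yes (divides q₂ g₂) | yes (divides q₃ g₃) | inj₁ ram
        with ∣-square ram {X} {Y} (subst (+ p * + p ∣_) (sym norm) (∣m⇒∣m*n α₃ (*-∣-mono (divides q₁ g₁) (divides q₂ g₂))))
      ... | divides X' eX , divides Y' eY =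
        q₁ * q₂ * q₃ ,
        ∤-* pp (∤-* pp (cofactor-∤ {p} {d} {α₁} {b₁} {γ₁} pp ram f₁ q₁ g₁) (cofactor-∤ {p} {d} {α₂} {b₂} {γ₂} pp ram f₂ q₂ g₂))
               (cofactor-∤ {p} {d} {α₃} {b₃} {γ₃} pp ram f₃ q₃ g₃) ,
        subst (_∣ q₁ * q₂ * q₃ * S)
          (trans (reorder q₁ q₂ q₃ (+ p)) (cong₂ _*_ (cong₂ _*_ (sym g₁) (sym g₂)) (sym g₃)))
          (*-∣-mono (∣-refl {q₁ * q₂ * q₃}) p³∣S)
        where
        reorder : ∀ q₁ q₂ q₃ p → q₁ * q₂ * q₃ * (p * (p * p)) ≡ q₁ * p * (q₂ * p) * (q₃ * p)
        reorder = solve-∀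
        normL : ∀ p X' Y' d → p * p * (X' * X' + d * (Y' * Y')) ≡ X' * p * (X' * p) + d * (Y' * p * (Y' * p))
        normL = solve-∀
        norm' : X' * X' + d * (Y' * Y') ≡ q₁ * q₂ * α₃
        norm' = cancel (*-≢0 (prime≢0 pp) (prime≢0 pp)) (trans (normL (+ p) X' Y' d)
          (trans (cong₂ (λ x y → x * x + d * (y * y)) (sym eX) (sym eY))
          (trans norm (trans (cong₂ (λ x y → x * y * α₃) g₁ g₂) (reorder' q₁ q₂ α₃ (+ p))))))
          where
          reorder' : ∀ q₁ q₂ α p → q₁ * p * (q₂ * p) * α ≡ p * p * (q₁ * q₂ * α)
          reorder' = solve-∀
        p∣θ'w₁ = ∣-product ram {X'} {Y'} {b₁} {1ℤ}
          (subst (+ p ∣_) (sym norm') (∣n⇒∣m*n (q₁ * q₂) (divides q₃ g₃)))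
          (∣disc {p} {d} {α₁} {b₁} {γ₁} (divides q₁ g₁) f₁)
        p∣w₂w₃ = ∣-product ram {b₂} {1ℤ} {b₃} {1ℤ} (∣disc {p} {d} {α₂} {b₂} {γ₂} (divides q₂ g₂) f₂) (∣disc {p} {d} {α₃} {b₃} {γ₃} (divides q₃ g₃) f₃)
        p³∣S : + p * (+ p * + p) ∣ S
        p³∣S = ∣-lin₂ (*-∣-mono (∣-refl {+ p}) (*-∣-mono (proj₁ p∣θ'w₁) (proj₂ p∣w₂w₃))) 1ℤ
                      (*-∣-mono (∣-refl {+ p}) (*-∣-mono (proj₂ p∣θ'w₁) (proj₁ p∣w₂w₃))) 1ℤ
          (trans (cong₂ (λ X Y → X * (b₁ * b₂ + b₁ * b₃ + b₂ * b₃ - d) + Y * (b₁ * b₂ * b₃ - d * (b₁ + b₂ + b₃))) eX eY)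
                 (lemma b₁ b₂ b₃ X' Y' (+ p) d))
          where
          lemma : ∀ b₁ b₂ b₃ X' Y' p d →
            X' * p * (b₁ * b₂ + b₁ * b₃ + b₂ * b₃ - d) + Y' * p * (b₁ * b₂ * b₃ - d * (b₁ + b₂ + b₃))
            ≡ 1ℤ * (p * ((X' * b₁ - d * (Y' * 1ℤ)) * (b₂ * 1ℤ + 1ℤ * b₃)))
            + 1ℤ * (p * ((X' * 1ℤ + Y' * b₁) * (b₂ * b₃ - d * (1ℤ * 1ℤ))))
          lemma = solve-∀

-- Ramified primes of ℤ[√-d] for a fundamental discriminant.

module Ramification where
  open import Data.Nat.Base using (ℕ)
  import Data.Nat.Divisibility as ℕ
  open import Data.Nat.Primality using (Prime; prime[2])
  open import Data.Integer using (+_; -_; _+_; _-_; _*_; 1ℤ)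
  open import Data.Integer.Properties using (*-assoc)
  open import Data.Integer.Divisibility.Signed using (_∣_; divides; quotient; ∣ᵤ⇒∣; ∣⇒∣ᵤ; ∣-refl; ∣-trans; ∣m⇒∣-m; ∣n⇒∣m*n)
  open import Data.Integer.Tactic.RingSolver using (solve-∀)
  open import Data.Product using (_×_; _,_)
  open import Data.Sum using (inj₁; inj₂; [_,_]′)
  open import Data.Empty using (⊥-elim)
  open import Relation.Nullary using (¬_)
  open import Relation.Binary.PropositionalEquality using (_≡_; refl; sym; trans; cong; subst)
  open LinearCombination
  open Divisibility
  open Cubes
  open Composition

  private
    ∣d⇒∣x : ∀ {p d x y} → Prime p → + p ∣ d → + p ∣ x * x + d * (y * y) → + p ∣ x
    ∣d⇒∣x {p} {d} {x} {y} pp p∣d h = euclid-sq pp x (∣-lin₂ h 1ℤ p∣d (- (y * y)) (lemma x y d))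
      where
      lemma : ∀ x y d → x * x ≡ 1ℤ * (x * x + d * (y * y)) + - (y * y) * d
      lemma = solve-∀

  -- p ∣ x² + d y² forces p ∣ x. If p² ∣ x² + d y², then p² ∣ d y², and since p divides d only once,
  -- p ∣ y.
  ∣d⇒ramified : ∀ {p d} → Prime p → + p ∣ d → ¬ + p * + p ∣ d → Ramified d p
  ∣d⇒ramified {p} {d} pp p∣d p²∤d = record { ∣-product = λ {x} {y} {x'} {y'} → prod {x} {y} {x'} {y'} ; ∣-square = λ {x} {y} → square {x} {y} }
    where
    prod : ∀ {x y x' y'} → + p ∣ x * x + d * (y * y) → + p ∣ x' * x' + d * (y' * y') →
                  (+ p ∣ x * x' - d * (y * y')) × (+ p ∣ x * y' + y * x')
    prod {x} {y} {x'} {y'} h h' =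
      ∣-lin₂ p∣x x' p∣d (- (y * y')) (lemma₁ x y x' y' d) , ∣-lin₂ p∣x y' p∣x' y (lemma₂ x y x' y')
      where
      p∣x = ∣d⇒∣x {p} {d} {x} {y} pp p∣d h
      p∣x' = ∣d⇒∣x {p} {d} {x'} {y'} pp p∣d h'
      lemma₁ : ∀ x y x' y' d → x * x' - d * (y * y') ≡ x' * x + - (y * y') * d
      lemma₁ = solve-∀
      lemma₂ : ∀ x y x' y' → x * y' + y * x' ≡ y' * x + y * x'
      lemma₂ = solve-∀
    square : ∀ {x y} → + p * + p ∣ x * x + d * (y * y) → (+ p ∣ x) × (+ p ∣ y)
    square {x} {y} h = p∣x , go p∣d
      where
      p∣x : + p ∣ x
      p∣x = ∣d⇒∣x {p} {d} {x} {y} pp p∣d (∣-trans (divides (+ p) refl) h)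
      p²∣dy² : + p * + p ∣ d * (y * y)
      p²∣dy² = ∣-lin₂ h 1ℤ (*-∣-mono p∣x p∣x) (- 1ℤ) (lemma x (d * (y * y)))
        where
        lemma : ∀ x z → z ≡ 1ℤ * (x * x + z) + - 1ℤ * (x * x)
        lemma = solve-∀
      go : + p ∣ d → + p ∣ y
      go (divides d' e) = [ (λ p∣d' → ⊥-elim (p²∤d (subst (+ p * + p ∣_) (sym e) (*-∣-mono p∣d' (∣-refl {+ p}))))) ,
          euclid-sq pp y ]′ (euclid pp d' (y * y) (divides w (cancel (prime≢0 pp)
            (trans (lemma₁ d' (+ p) (y * y)) (trans (cong (_* (y * y)) (sym e)) (trans (_∣_.equality p²∣dy²) (lemma₂ w (+ p))))))))
        where
        w = quotient p²∣dy²
        lemma₁ : ∀ d' p z → p * (d' * z) ≡ d' * p * z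
        lemma₁ = solve-∀
        lemma₂ : ∀ q p → q * (p * p) ≡ p * (q * p)
        lemma₂ = solve-∀

  -- For odd d, x² + d y² is (x + y)² modulo 2. If x and y are both odd, then x² + d y² is 2 modulo
  -- 4, so divisibility by 4 makes both even.
  ≡1mod4⇒ramified-2 : ∀ {d} k → d ≡ 1ℤ + + 4 * k → Ramified d 2
  ≡1mod4⇒ramified-2 k refl = record { ∣-product = λ {x} {y} {x'} {y'} → prod {x} {y} {x'} {y'} ; ∣-square = λ {x} {y} → square {x} {y} }
    where
    d = 1ℤ + + 4 * k
    sum-even : ∀ x y → + 2 ∣ x * x + (1ℤ + + 4 * k) * (y * y) → + 2 ∣ x + y
    sum-even x y h = euclid-sq prime[2] (x + y) (∣-lin₂ h 1ℤ (∣-refl {+ 2}) (x * y - + 2 * k * (y * y)) (lemma x y k))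
      where
      lemma : ∀ x y k → (x + y) * (x + y) ≡ 1ℤ * (x * x + (1ℤ + + 4 * k) * (y * y)) + (x * y - + 2 * k * (y * y)) * + 2
      lemma = solve-∀
    prod : ∀ {x y x' y'} → + 2 ∣ x * x + d * (y * y) → + 2 ∣ x' * x' + d * (y' * y') →
                  (+ 2 ∣ x * x' - d * (y * y')) × (+ 2 ∣ x * y' + y * x')
    prod {x} {y} {x'} {y'} h h' =
      ∣-lin₂ (∣-lin₂ e x' (∣-refl {+ 2}) (- (+ 2 * k * (y * y'))) refl) 1ℤ e' (- y) (lemma₁ x y x' y' k) ,
      ∣-lin₂ (∣-lin₂ e y' (∣-refl {+ 2}) (- (y * y')) refl) 1ℤ e' y (lemma₂ x y x' y')
      where
      e = sum-even x y h
      e' = sum-even x' y' h'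
      lemma₁ : ∀ x y x' y' k → x * x' - (1ℤ + + 4 * k) * (y * y') ≡ 1ℤ * (x' * (x + y) + - (+ 2 * k * (y * y')) * + 2) + - y * (x' + y')
      lemma₁ = solve-∀
      lemma₂ : ∀ x y x' y' → x * y' + y * x' ≡ 1ℤ * (y' * (x + y) + - (y * y') * + 2) + y * (x' + y')
      lemma₂ = solve-∀
    square : ∀ {x y} → + 2 * + 2 ∣ x * x + d * (y * y) → (+ 2 ∣ x) × (+ 2 ∣ y)
    square {x} {y} (divides q eq) = go (sum-even x y (divides (q * + 2) (trans eq (sym (*-assoc q (+ 2) (+ 2))))))
      where
      go : + 2 ∣ x + y → (+ 2 ∣ x) × (+ 2 ∣ y)
      go (divides j e) = ∣-lin₂ (divides {+ 2} j e) 1ℤ 2∣y (- 1ℤ) (lemma₂ x y) , 2∣y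
        where
        lemma₁ : ∀ x y j k q → + 2 * (y * y) ≡ + 2 * ((q - j * j + j * y - k * (y * y)) * + 2)
          + (y - x - + 2 * j) * (x + y - j * + 2) + 1ℤ * (x * x + (1ℤ + + 4 * k) * (y * y) - q * (+ 2 * + 2))
        lemma₁ = solve-∀
        lemma₂ : ∀ x y → x ≡ 1ℤ * (x + y) + - 1ℤ * y
        lemma₂ = solve-∀
        2∣y : + 2 ∣ y
        2∣y = euclid-sq prime[2] y (divides (q - j * j + j * y - k * (y * y))
          (cancel {+ 2} (λ ()) (≡-lin₂ (y - x - + 2 * j) e 1ℤ eq (lemma₁ x y j k q))))

  -- As -4d is not 1 modulo 4, it is 4m with m = -d squarefree and m congruent to 2 or 3 modulo 4.
  -- In the first case 2 divides d, in the second d is 1 modulo 4.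
  fundamental⇒maximal : ∀ d → FundamentalDisc (- (+ 4 * d)) → MaximalOrder d
  fundamental⇒maximal d (inj₁ (4∣ , _)) = ⊥-elim (4∤1 (∣⇒∣ᵤ {+ 4} {1ℤ} (∣-lin₂ (∣ᵤ⇒∣ {+ 4} { - (+ 4 * d) - 1ℤ} 4∣) (- 1ℤ) (∣-refl {+ 4}) (- d) (lemma d))))
    where
    lemma : ∀ d → 1ℤ ≡ - 1ℤ * (- (+ 4 * d) - 1ℤ) + - d * + 4
    lemma = solve-∀
    4∤1 : ¬ (4 ℕ.∣ 1)
    4∤1 h with ℕ.∣1⇒≡1 h
    ... | ()
  fundamental⇒maximal d (inj₂ (m , e , 4∣ , sf)) = record { ramified-∣d = ram ; ramified-2 = two 4∣ }
    where
    lemma₁ : ∀ d m → + 4 * - d ≡ + 4 * m + 1ℤ * (- (+ 4 * d) - + 4 * m)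
    lemma₁ = solve-∀
    m≡-d : m ≡ - d
    m≡-d = sym (cancel {+ 4} (λ ()) (≡-lin₁ 1ℤ e (lemma₁ d m)))
    ram : ∀ {p} → Prime p → + p ∣ d → Ramified d p
    ram {p} pp p∣d = ∣d⇒ramified pp p∣d λ p²∣d →
      prime∤1 pp (∣ᵤ⇒∣ (sf (+ p) (∣⇒∣ᵤ (subst (+ p * + p ∣_) (sym m≡-d) (∣m⇒∣-m p²∣d)))))
    lemma₂ : ∀ d → d ≡ 1ℤ * (- 1ℤ * (- d - + 2) + - 1ℤ * + 2)
    lemma₂ = solve-∀
    lemma₃ : ∀ d q → d ≡ 1ℤ + + 4 * (- q - 1ℤ) + - 1ℤ * (- d - + 3 - q * + 4)
    lemma₃ = solve-∀
    4∣⇒2∣ : ∀ {z} → + 4 ∣ z → + 2 ∣ z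
    4∣⇒2∣ = ∣-trans (divides (+ 2) refl)
    three : + 4 ∣ - d - + 3 → Ramified d 2
    three (divides q e') = ≡1mod4⇒ramified-2 {d} (- q - 1ℤ) (≡-lin₁ (- 1ℤ) e' (lemma₃ d q))
    two : _ → Ramified d 2
    two (inj₁ h) = ram prime[2] (subst (+ 2 ∣_) (sym (lemma₂ d)) (∣n⇒∣m*n 1ℤ (∣-lin₂ (4∣⇒2∣ (subst (λ z → + 4 ∣ z - + 2) m≡-d (∣ᵤ⇒∣ {+ 4} {m - + 2} h))) (- 1ℤ) (∣-refl {+ 2}) (- 1ℤ) refl)))
    two (inj₂ h) = three (subst (λ z → + 4 ∣ z - + 3) m≡-d (∣ᵤ⇒∣ {+ 4} {m - + 3} h))

-- The recipe for Φ restated as congruences without μ.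

module Recipes where
  open import Data.Nat.Base using (ℕ)
  import Data.Nat.GCD as ℕ
  open import Data.Nat.Primality using (Prime)
  open import Data.Integer using (ℤ; +_; -_; _+_; _-_; _*_; 0ℤ; 1ℤ; _<_) renaming (∣_∣ to abs)
  open import Data.Integer.Properties using (*-identityʳ; *-zeroʳ)
  open import Data.Integer.Divisibility.Signed using (_∣_; divides; ∣ᵤ⇒∣; ∣⇒∣ᵤ; ∣-refl)
  open import Data.Integer.GCD using (gcd)
  open import Data.Integer.Tactic.RingSolver using (solve-∀)
  open import Data.Rational as ℚ using (ℚ)
  open import Data.Product using (_,_)
  open import Data.Empty using (⊥)
  open import Relation.Nullary using (¬_)
  open import Relation.Binary.PropositionalEquality using (_≡_; _≢_; refl; sym; trans; cong; subst)
  open LinearCombination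
  open Divisibility
  open Composition
  open Ramification

  gcd≡1⇒noCommonPrime : ∀ i j → gcd i j ≡ 1ℤ → ∀ {p} → Prime p → + p ∣ i → ¬ + p ∣ j
  gcd≡1⇒noCommonPrime i j e {p} pp p∣i p∣j = prime∤1 pp (subst (+ p ∣_) e (∣ᵤ⇒∣ {+ p} {gcd i j} (ℕ.gcd-greatest (∣⇒∣ᵤ p∣i) (∣⇒∣ᵤ p∣j))))

  -- The recipe of Φ with all quotients by g made explicit: C = cg, v = wg, and the form is (α, 2b, γ).
  record Recipe (d u v A B C α b γ : ℤ) : Set where
    field
      g c w : ℤ
      0<C   : 0ℤ < C
      A⊥C   : ∀ {p} → Prime p → + p ∣ A → ¬ + p ∣ C
      c⊥w   : ∀ {p} → Prime p → + p ∣ c → ¬ + p ∣ w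
      g≡    : g ≡ gcd C v
      C≡    : C ≡ c * g
      v≡    : v ≡ w * g
      α≡    : α ≡ w * (A * w + c * C * u)
      bC    : α ∣ b * (C * C * C) - B * (v * v)
      disc  : b * b + d ≡ α * γ

  record PhiData (d u v : ℤ) (x y : ℚ) (f : Form) : Set where
    field
      {A B C α b γ} : ℤ
      xC     : x ℚ.* ι (C * C) ≡ ι A
      yC     : y ℚ.* ι (C * C * C) ≡ ι B
      recipe : Recipe d u v A B C α b γ
      f≡     : f ≡ form α (+ 2 * b) γ

  -- The congruence `bC` changes sign with (B, b), and `disc` is even in b. So -P receives the
  -- conjugate form.
  negate : ∀ {d u v A B C α b γ} → Recipe d u v A B C α b γ → Recipe d u v A (- B) C α (- b) γ
  negate {d} {u} {v} {A} {B} {C} {α} {b} {γ} r = record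
    { g = g ; c = c ; w = w ; 0<C = 0<C ; A⊥C = A⊥C ; c⊥w = c⊥w ; g≡ = g≡ ; C≡ = C≡ ; v≡ = v≡ ; α≡ = α≡
    ; bC = ∣-lin₁ bC (- 1ℤ) (lemma₁ b B (C * C * C) (v * v)) ; disc = trans (lemma₂ b d) disc }
    where
    open Recipe r
    lemma₁ : ∀ b B x y → - b * x - - B * y ≡ - 1ℤ * (b * x - B * y)
    lemma₁ = solve-∀
    lemma₂ : ∀ b d → - b * - b + d ≡ b * b + d
    lemma₂ = solve-∀

  -- Take b = μ B w². Since κ μ ≡ 1 modulo α and κ g² = C³, it satisfies b C³ ≡ B v² modulo α. This
  -- no longer mentions μ; it expresses P ≡ T when √-d is read as b.
  phiData : ∀ a₄ a₆ u v {x y f} → IsPhiForm a₄ a₆ u v (aff x y) f → PhiData (dE a₄ a₆ u v) u v x y f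
  phiData a₄ a₆ u v {x} {y} {f}
    (A , B , C , 0<C , xC , yC , gAC , _ , μ , α , κ , β , γ , e₁ , e₂ , e₃ , e₄ , e₅ , e₆) =
    go (∣ᵤ⇒∣ {g} {C} (ℕ.gcd[m,n]∣m (abs C) (abs v))) (∣ᵤ⇒∣ {g} {v} (ℕ.gcd[m,n]∣n (abs C) (abs v))) (∣ᵤ⇒∣ {α} {κ * μ - 1ℤ} e₃)
    where
    d = dE a₄ a₆ u v
    g = gcd C v
    work : ∀ d g c w q → g ≢ 0ℤ → g ≡ gcd C v → (∀ {p} → Prime p → + p ∣ c → ¬ + p ∣ w) → C ≡ c * g → v ≡ w * g → α * (g * g) ≡ v * (A * v + C * C * u) →
      κ * (g * g) ≡ C * C * C → κ * μ - 1ℤ ≡ q * α → β * (g * g) ≡ + 2 * μ * B * (v * v) →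
      γ * α * (g * g * (g * g)) ≡ μ * μ * (B * B) * (v * v * (v * v)) + d * (g * g * (g * g)) →
      PhiData d u v x y f
    work d g c w q g≢0 g≡ c⊥w C≡ v≡ e₁ e₂ e₃ e₄ e₅ = record
      { A = A ; B = B ; C = C ; α = α ; b = μ * B * (w * w) ; γ = γ ; xC = xC ; yC = yC
      ; recipe = record { g = g ; c = c ; w = w ; 0<C = 0<C ; A⊥C = gcd≡1⇒noCommonPrime A C gAC ; c⊥w = c⊥w ; g≡ = g≡ ; C≡ = C≡ ; v≡ = v≡
      ; α≡ = cancel (*-≢0 g≢0 g≢0) (≡-lin₃ 1ℤ e₁ (C * u * v) C≡ (A * (v + w * g) + c * C * u * g) v≡ (αL α g v w A c C u))
      ; bC = divides (q * B * (v * v)) (≡-lin₃ (- (μ * B * (w * w))) e₂ (- (B * (κ * μ) * (v + w * g))) v≡ (B * (v * v)) e₃ (bL α g v w q B C κ μ))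
      ; disc = cancel (*-≢0 (*-≢0 g≢0 g≢0) (*-≢0 g≢0 g≢0))
          (≡-lin₂ (- 1ℤ) e₅ (- (μ * μ * (B * B) * (v + w * g) * (v * v + w * g * (w * g)))) v≡ (dL α γ g v w B μ d)) }
      ; f≡ = trans e₆ (cong (λ z → form α z γ) (cancel (*-≢0 g≢0 g≢0)
          (≡-lin₂ 1ℤ e₄ (+ 2 * μ * B * (v + w * g)) v≡ (βL β g v w B μ))))
      }
      where
      αL : ∀ α g v w A c C u → g * g * α ≡ g * g * (w * (A * w + c * C * u))
        + 1ℤ * (α * (g * g) - v * (A * v + C * C * u)) + C * u * v * (C - c * g)
        + (A * (v + w * g) + c * C * u * g) * (v - w * g)
      αL = solve-∀
      bL : ∀ α g v w q B C κ μ → μ * B * (w * w) * (C * C * C) - B * (v * v) ≡ q * B * (v * v) * α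
        + - (μ * B * (w * w)) * (κ * (g * g) - C * C * C) + - (B * (κ * μ) * (v + w * g)) * (v - w * g)
        + B * (v * v) * (κ * μ - 1ℤ - q * α)
      bL = solve-∀
      dL : ∀ α γ g v w B μ d → let b = μ * B * (w * w) in g * g * (g * g) * (b * b + d) ≡ g * g * (g * g) * (α * γ)
        + - 1ℤ * (γ * α * (g * g * (g * g)) - (μ * μ * (B * B) * (v * v * (v * v)) + d * (g * g * (g * g))))
        + - (μ * μ * (B * B) * (v + w * g) * (v * v + w * g * (w * g))) * (v - w * g)
      dL = solve-∀
      βL : ∀ β g v w B μ → g * g * β ≡ g * g * (+ 2 * (μ * B * (w * w)))
        + 1ℤ * (β * (g * g) - + 2 * μ * B * (v * v)) + + 2 * μ * B * (v + w * g) * (v - w * g)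
      βL = solve-∀
    go : g ∣ C → g ∣ v → α ∣ κ * μ - 1ℤ → PhiData d u v x y f
    go (divides c C≡) (divides w v≡) (divides q e₃') = work d g c w q g≢0 refl c⊥w C≡ v≡ e₁ e₂ e₃' e₄ e₅
      where
      g≢0 : g ≢ 0ℤ
      g≢0 g≡0 = pos⇒≢0 0<C (trans C≡ (trans (cong (c *_) g≡0) (*-zeroʳ c)))
      c⊥w : ∀ {p} → Prime p → + p ∣ c → ¬ + p ∣ w
      -- A common prime p of c and w would make p g a common divisor of C and v, hence a divisor of
      -- g.
      c⊥w {p} pp p∣c p∣w = cop (∣ᵤ⇒∣ {+ p * g} {g} (ℕ.gcd-greatest
          (∣⇒∣ᵤ {+ p * g} {C} (subst (+ p * g ∣_) (sym C≡) (*-∣-mono p∣c (∣-refl {g}))))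
          (∣⇒∣ᵤ {+ p * g} {v} (subst (+ p * g ∣_) (sym v≡) (*-∣-mono p∣w (∣-refl {g}))))))
        where
        lemma : ∀ g q p → q * (p * g) ≡ g * (q * p)
        lemma = solve-∀
        cop : + p * g ∣ g → ⊥
        cop (divides q e) = prime∤1 pp (divides q (cancel g≢0 (trans (*-identityʳ g) (trans e (lemma g q (+ p))))))

-- The line through three points, with integral coefficients.

module Chords where
  open import Data.Integer using (ℤ; +_; -_; _+_; _-_; _*_)
  open import Data.Integer.Properties using (*-comm)
  open import Data.Integer.Tactic.RingSolver using (solve-∀)
  open import Relation.Binary.PropositionalEquality using (_≡_; trans; cong)
  open LinearCombination

  -- The line cleared of denominators: Λ = λC₁C₂C₃ and N = νC₁C₂C₃ are integers because their squares are.
  record Chord (a₄ a₆ A₁ B₁ C₁ A₂ B₂ C₂ A₃ B₃ C₃ : ℤ) : Set where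
    field
      Λ N : ℤ
      σ₁ : Λ * Λ ≡ A₁ * (C₂ * C₂ * (C₃ * C₃)) + A₂ * (C₁ * C₁ * (C₃ * C₃)) + A₃ * (C₁ * C₁ * (C₂ * C₂))
      σ₂ : a₄ * (C₁ * C₂ * C₃ * (C₁ * C₂ * C₃)) ≡ Λ * N + Λ * N
           + (A₁ * A₂ * (C₃ * C₃) + A₁ * A₃ * (C₂ * C₂) + A₂ * A₃ * (C₁ * C₁))
      σ₃ : N * N ≡ a₆ * (C₁ * C₂ * C₃ * (C₁ * C₂ * C₃)) + A₁ * A₂ * A₃
      p₁ : B₁ * (C₂ * C₃) ≡ Λ * A₁ + N * (C₁ * C₁)
      p₂ : B₂ * (C₁ * C₃) ≡ Λ * A₂ + N * (C₂ * C₂)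
      p₃ : B₃ * (C₁ * C₂) ≡ Λ * A₃ + N * (C₃ * C₃)

  module _ {a₄ a₆ A₁ B₁ C₁ A₂ B₂ C₂ A₃ B₃ C₃ : ℤ} (ch : Chord a₄ a₆ A₁ B₁ C₁ A₂ B₂ C₂ A₃ B₃ C₃) where
    open Chord ch

    -- With `chord-213` this generates all permutations of the three points, so a condition on a
    -- pair has to be proved only for the first two.
    chord-132 : Chord a₄ a₆ A₁ B₁ C₁ A₃ B₃ C₃ A₂ B₂ C₂
    chord-132 = record
      { Λ = Λ ; N = N
      ; σ₁ = trans σ₁ (l₁ A₁ C₁ A₂ C₂ A₃ C₃)
      ; σ₂ = trans (l₀ a₄ C₁ C₂ C₃) (trans σ₂ (l₂ (Λ * N + Λ * N) A₁ C₁ A₂ C₂ A₃ C₃))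
      ; σ₃ = trans σ₃ (l₃ a₆ A₁ C₁ A₂ C₂ A₃ C₃)
      ; p₁ = trans (cong (B₁ *_) (*-comm C₃ C₂)) p₁ ; p₂ = p₃ ; p₃ = p₂ }
      where
      l₀ : ∀ a C₁ C₂ C₃ → a * (C₁ * C₃ * C₂ * (C₁ * C₃ * C₂)) ≡ a * (C₁ * C₂ * C₃ * (C₁ * C₂ * C₃))
      l₀ = solve-∀
      l₁ : ∀ A₁ C₁ A₂ C₂ A₃ C₃ → A₁ * (C₂ * C₂ * (C₃ * C₃)) + A₂ * (C₁ * C₁ * (C₃ * C₃)) + A₃ * (C₁ * C₁ * (C₂ * C₂)) ≡
        A₁ * (C₃ * C₃ * (C₂ * C₂)) + A₃ * (C₁ * C₁ * (C₂ * C₂)) + A₂ * (C₁ * C₁ * (C₃ * C₃))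
      l₁ = solve-∀
      l₂ : ∀ z A₁ C₁ A₂ C₂ A₃ C₃ → z + (A₁ * A₂ * (C₃ * C₃) + A₁ * A₃ * (C₂ * C₂) + A₂ * A₃ * (C₁ * C₁)) ≡
        z + (A₁ * A₃ * (C₂ * C₂) + A₁ * A₂ * (C₃ * C₃) + A₃ * A₂ * (C₁ * C₁))
      l₂ = solve-∀
      l₃ : ∀ a A₁ C₁ A₂ C₂ A₃ C₃ → a * (C₁ * C₂ * C₃ * (C₁ * C₂ * C₃)) + A₁ * A₂ * A₃ ≡
        a * (C₁ * C₃ * C₂ * (C₁ * C₃ * C₂)) + A₁ * A₃ * A₂
      l₃ = solve-∀

    chord-213 : Chord a₄ a₆ A₂ B₂ C₂ A₁ B₁ C₁ A₃ B₃ C₃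
    chord-213 = record
      { Λ = Λ ; N = N
      ; σ₁ = trans σ₁ (l₁ A₁ C₁ A₂ C₂ A₃ C₃)
      ; σ₂ = trans (l₀ a₄ C₁ C₂ C₃) (trans σ₂ (l₂ (Λ * N + Λ * N) A₁ C₁ A₂ C₂ A₃ C₃))
      ; σ₃ = trans σ₃ (l₃ a₆ A₁ C₁ A₂ C₂ A₃ C₃)
      ; p₁ = p₂ ; p₂ = p₁ ; p₃ = trans (cong (B₃ *_) (*-comm C₂ C₁)) p₃ }
      where
      l₀ : ∀ a C₁ C₂ C₃ → a * (C₂ * C₁ * C₃ * (C₂ * C₁ * C₃)) ≡ a * (C₁ * C₂ * C₃ * (C₁ * C₂ * C₃))
      l₀ = solve-∀
      l₁ : ∀ A₁ C₁ A₂ C₂ A₃ C₃ → A₁ * (C₂ * C₂ * (C₃ * C₃)) + A₂ * (C₁ * C₁ * (C₃ * C₃)) + A₃ * (C₁ * C₁ * (C₂ * C₂)) ≡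
        A₂ * (C₁ * C₁ * (C₃ * C₃)) + A₁ * (C₂ * C₂ * (C₃ * C₃)) + A₃ * (C₂ * C₂ * (C₁ * C₁))
      l₁ = solve-∀
      l₂ : ∀ z A₁ C₁ A₂ C₂ A₃ C₃ → z + (A₁ * A₂ * (C₃ * C₃) + A₁ * A₃ * (C₂ * C₂) + A₂ * A₃ * (C₁ * C₁)) ≡
        z + (A₂ * A₁ * (C₃ * C₃) + A₂ * A₃ * (C₁ * C₁) + A₁ * A₃ * (C₂ * C₂))
      l₂ = solve-∀
      l₃ : ∀ a A₁ C₁ A₂ C₂ A₃ C₃ → a * (C₁ * C₂ * C₃ * (C₁ * C₂ * C₃)) + A₁ * A₂ * A₃ ≡
        a * (C₂ * C₁ * C₃ * (C₂ * C₁ * C₃)) + A₂ * A₁ * A₃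
      l₃ = solve-∀

    -- The value of the cubic minus (line)² at -u/v, where it factors through the three roots.
    chord-norm : ∀ u v → let K = C₁ * C₂ * C₃; θ = Λ * u * v - N * (v * v) in
      θ * θ + v * (u * u * u + a₄ * u * (v * v) - a₆ * (v * v * v)) * (K * K) ≡
      v * ((A₁ * v + C₁ * C₁ * u) * (A₂ * v + C₂ * C₂ * u) * (A₃ * v + C₃ * C₃ * u))
    chord-norm u v = ≡-lin₃ (u * u * (v * v)) σ₁ (u * (v * (v * v))) σ₂ (v * v * (v * v)) σ₃
      (lemma a₄ a₆ u v A₁ A₂ A₃ C₁ C₂ C₃ Λ N)
      where
      lemma : ∀ a₄ a₆ u v A₁ A₂ A₃ C₁ C₂ C₃ Λ N → let K = C₁ * C₂ * C₃; θ = Λ * u * v - N * (v * v) in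
        θ * θ + v * (u * u * u + a₄ * u * (v * v) - a₆ * (v * v * v)) * (K * K) ≡
        v * ((A₁ * v + C₁ * C₁ * u) * (A₂ * v + C₂ * C₂ * u) * (A₃ * v + C₃ * C₃ * u))
        + u * u * (v * v) * (Λ * Λ - (A₁ * (C₂ * C₂ * (C₃ * C₃)) + A₂ * (C₁ * C₁ * (C₃ * C₃)) + A₃ * (C₁ * C₁ * (C₂ * C₂))))
        + u * (v * (v * v)) * (a₄ * (K * K) - (Λ * N + Λ * N
           + (A₁ * A₂ * (C₃ * C₃) + A₁ * A₃ * (C₂ * C₂) + A₂ * A₃ * (C₁ * C₁))))
        + v * v * (v * v) * (N * N - (a₆ * (K * K) + A₁ * A₂ * A₃))
      lemma = solve-∀

-- Divisibility properties of one recipe, and of two recipes joined by a chord.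

module RecipeArithmetic where
  open import Data.Nat.Primality using (Prime)
  open import Data.Integer using (ℤ; +_; -_; _+_; _-_; _*_; 0ℤ; 1ℤ; _<_)
  open import Data.Integer.Properties using (*-identityʳ; *-comm; *-zeroʳ)
  open import Data.Integer.Divisibility.Signed using (_∣_; divides; _∣?_; ∣-refl; ∣-trans; ∣m⇒∣m*n)
  open import Data.Integer.Tactic.RingSolver using (solve-∀)
  open import Data.Product using (_×_; ∃-syntax; _,_; proj₂)
  open import Data.Sum using ([_,_]′)
  open import Data.Empty using (⊥-elim)
  open import Function using (id)
  open import Relation.Nullary using (¬_; yes; no)
  open import Relation.Binary.PropositionalEquality using (_≡_; _≢_; refl; sym; trans; cong; subst)
  open LinearCombination
  open Divisibility
  open Cubes
  open Composition
  open LocalConditions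
  open Ramification
  open Recipes
  open Chords

  ∤-square : ∀ {p} → Prime p → ∀ {x} → ¬ + p ∣ x → ¬ + p ∣ x * x
  ∤-square pp p∤x = ∤-* pp p∤x p∤x

  ∤-cube : ∀ {p} → Prime p → ∀ {x} → ¬ + p ∣ x → ¬ + p ∣ x * x * x
  ∤-cube pp p∤x = ∤-* pp (∤-square pp p∤x) p∤x

  module _ {d u v : ℤ} (max : MaximalOrder d) (0<d : 0ℤ < d) (v∣d : v ∣ d) where

    module _ {A B C α b γ : ℤ} (r : Recipe d u v A B C α b γ) where
      open Recipe r

      α≢0 : α ≢ 0ℤ
      α≢0 α≡0 = pos⇒≢0 (0<x²+dy² b 1ℤ 0<d (λ ()))
        (trans (cong (λ z → b * b + z) (*-identityʳ d)) (trans disc (cong (_* γ) α≡0)))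

      αg : α * (g * g) ≡ v * (A * v + C * C * u)
      αg = ≡-lin₃ (g * g) α≡ (- (A * (v + w * g) + C * C * u)) v≡ (- (w * g * C * u)) C≡ (lemma α g v w A c C u)
        where
        lemma : ∀ α g v w A c C u → α * (g * g) ≡ v * (A * v + C * C * u)
          + g * g * (α - w * (A * w + c * C * u)) + - (A * (v + w * g) + C * C * u) * (v - w * g)
          + - (w * g * C * u) * (C - c * g)
        lemma = solve-∀

      g≢0 : g ≢ 0ℤ
      g≢0 e = pos⇒≢0 0<C (trans C≡ (trans (cong (c *_) e) (*-zeroʳ c)))

      c∣C : c ∣ C
      c∣C = divides g (trans C≡ (*-comm c g))

      -- If p ∣ C, then A is prime to p and p ∣ w (A w + c C u) gives p ∣ w. As C = c g, either p ∣
      -- c, against `c⊥w`, or p ∣ g, and then p² divides w g = v and so d, which is squarefree.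
      ∣α⇒∤C : ∀ {p} → Prime p → + p ∣ α → ¬ + p ∣ C
      ∣α⇒∤C {p} pp p∣α p∣C = [ (λ p∣c → c⊥w pp p∣c p∣w) , p∤g ]′ (euclid pp c g (subst (+ p ∣_) C≡ p∣C))
        where
        p∣Aw : + p ∣ A * w + c * C * u → + p ∣ w
        p∣Aw h = [ (λ p∣A → ⊥-elim (A⊥C pp p∣A p∣C)) , id ]′
          (euclid pp A w (∣-lin₂ h 1ℤ p∣C (- (c * u)) (lemma (A * w) c C u)))
          where
          lemma : ∀ z c C u → z ≡ 1ℤ * (z + c * C * u) + - (c * u) * C
          lemma = solve-∀
        p∣w : + p ∣ w
        p∣w = [ id , p∣Aw ]′ (euclid pp w (A * w + c * C * u) (subst (+ p ∣_) α≡ p∣α))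
        p∤g : ¬ + p ∣ g
        -- `∣-square` applied to d = 0² + d·1² expresses that p² does not divide d.
        p∤g p∣g = prime∤1 pp (proj₂ (∣-square (ramified-∣d max pp (∣-trans (divides (+ p) refl) p²∣d)) {0ℤ} {1ℤ}
            (subst (+ p * + p ∣_) (lemma d) p²∣d)))
          where
          lemma : ∀ d → d ≡ 0ℤ * 0ℤ + d * (1ℤ * 1ℤ)
          lemma = solve-∀
          p²∣d : + p * + p ∣ d
          p²∣d = ∣-trans (subst (+ p * + p ∣_) (sym v≡) (*-∣-mono p∣w p∣g)) v∣d

      -- D stands for the product of the denominators Cⱼ of the two other points.
      α∣X+Yb : ∀ {X Y Λ N D G n} → G * X ≡ v * v * (Λ * u - N * v) → G * Y ≡ v * (C * D) →
        B * D ≡ Λ * A + N * (C * C) → X * X + d * (Y * Y) ≡ α * n →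
        (∀ {p} → Prime p → ¬ + p ∣ v → ¬ + p ∣ G) → α ∣ X + Y * b
      α∣X+Yb {X} {Y} {Λ} {N} {D} {G} {n} hX hY inc norm G⊥ = ∣-local-global α (X + Y * b) α≢0 loc
        where
        loc : ∀ p → Prime p → + p ∣ α → ∃[ m ] (¬ + p ∣ m) × (α ∣ m * (X + Y * b))
        loc p pp p∣α with + p ∣? v
        -- Modulo α, the relation b C³ ≡ B v² and the incidence relation turn C² G (X + Y b) into v²
        -- Λ (A v + C² u) = v Λ α g². The multiplier is prime to p because p divides neither C nor
        -- v.
        ... | no p∤v = C * C * G , ∤-* pp (∤-square pp (∣α⇒∤C pp p∣α)) (G⊥ pp p∤v) , dv bC
          where
          dv : α ∣ b * (C * C * C) - B * (v * v) → α ∣ C * C * G * (X + Y * b)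
          dv (divides t e) = divides (v * (Λ * (g * g) + D * t))
            (≡-lin₃ (C * C) hX (C * C * b) hY (v * D) e (≡-lin₂ (v * v * v) inc (- (v * Λ)) αg
              (lemma A B C D G X Y b α g t u v Λ N)))
            where
            lemma : ∀ A B C D G X Y b α g t u v Λ N → C * C * G * (X + Y * b) ≡ v * (Λ * (g * g) + D * t) * α
              + C * C * (G * X - v * v * (Λ * u - N * v)) + C * C * b * (G * Y - v * (C * D))
              + v * D * (b * (C * C * C) - B * (v * v) - t * α)
              + v * v * v * (B * D - (Λ * A + N * (C * C)))
              + - (v * Λ) * (α * (g * g) - v * (A * v + C * C * u))
            lemma = solve-∀
        -- A prime dividing v divides d, so it is ramified and divides α exactly once. Hence p ∣ X +
        -- Y b suffices, which holds because p divides the norms of θ and of b + √-d.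
        ... | yes p∣v = cof p∣α
          where
          ram = ramified-∣d max pp (∣-trans p∣v v∣d)
          p∣z : + p ∣ X + Y * b
          p∣z = subst (λ z → + p ∣ z + Y * b) (*-identityʳ X) (proj₂ (∣-product ram {X} {Y} {b} {1ℤ}
            (subst (+ p ∣_) (sym norm) (∣m⇒∣m*n n p∣α)) (∣disc {p} {d} {α} {b} {γ} p∣α disc)))
          cof : + p ∣ α → ∃[ m ] (¬ + p ∣ m) × (α ∣ m * (X + Y * b))
          cof (divides q e) = q , cofactor-∤ {p} {d} {α} {b} {γ} pp ram disc q e ,
            subst (_∣ q * (X + Y * b)) (sym e) (*-∣-mono (∣-refl {q}) p∣z)

    -- Modulo a prime dividing C₃ the line is vertical, so the points P₁ and P₂ are opposite there.
    opposite-mod : ∀ {a₄ a₆ A₁ B₁ C₁ α₁ b₁ γ₁ A₂ B₂ C₂ α₂ b₂ γ₂ A₃ B₃ C₃ p} →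
      Recipe d u v A₁ B₁ C₁ α₁ b₁ γ₁ → Recipe d u v A₂ B₂ C₂ α₂ b₂ γ₂ →
      Chord a₄ a₆ A₁ B₁ C₁ A₂ B₂ C₂ A₃ B₃ C₃ → C₃ ≢ 0ℤ →
      Prime p → + p ∣ α₁ → + p ∣ α₂ → + p ∣ C₃ → ¬ + p ∣ A₃ →
      ¬ + p ∣ + 2 → ¬ + p ∣ d → ¬ + p ∣ b₁ - b₂
    opposite-mod {a₄} {a₆} {A₁} {B₁} {C₁} {α₁} {b₁} {γ₁} {A₂} {B₂} {C₂} {α₂} {b₂} {γ₂} {A₃} {B₃} {C₃} {p}
      r₁ r₂ ch C₃≢0 pp p∣α₁ p∣α₂ p∣C₃ p∤A₃ p∤2 p∤d p∣b₁-b₂ = p∤d p∣d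
      where
      open Chord ch
      p∤v : ¬ + p ∣ v
      p∤v h = p∤d (∣-trans h v∣d)
      p∤C₁ = ∣α⇒∤C r₁ pp p∣α₁
      p∤C₂ = ∣α⇒∤C r₂ pp p∣α₂
      R = A₁ * A₁ * (C₂ * C₂ * (C₂ * C₂)) + A₁ * A₂ * (C₁ * C₁ * (C₂ * C₂)) + A₂ * A₂ * (C₁ * C₁ * (C₁ * C₁))
          + a₄ * (C₁ * C₁ * (C₁ * C₁) * (C₂ * C₂ * (C₂ * C₂)))
      S = B₁ * (C₂ * C₂ * C₂) + B₂ * (C₁ * C₁ * C₁)
      slopeL : ∀ a₄ A₁ B₁ C₁ A₂ B₂ C₂ A₃ C₃ Λ N →
        C₃ * (Λ * (B₁ * (C₂ * C₂ * C₂) + B₂ * (C₁ * C₁ * C₁))) ≡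
        C₃ * (C₃ * (A₁ * A₁ * (C₂ * C₂ * (C₂ * C₂)) + A₁ * A₂ * (C₁ * C₁ * (C₂ * C₂)) + A₂ * A₂ * (C₁ * C₁ * (C₁ * C₁))
          + a₄ * (C₁ * C₁ * (C₁ * C₁) * (C₂ * C₂ * (C₂ * C₂)))))
        + Λ * (C₂ * C₂) * (B₁ * (C₂ * C₃) - (Λ * A₁ + N * (C₁ * C₁)))
        + Λ * (C₁ * C₁) * (B₂ * (C₁ * C₃) - (Λ * A₂ + N * (C₂ * C₂)))
        + (A₁ * (C₂ * C₂) + A₂ * (C₁ * C₁)) * (Λ * Λ - (A₁ * (C₂ * C₂ * (C₃ * C₃)) + A₂ * (C₁ * C₁ * (C₃ * C₃)) + A₃ * (C₁ * C₁ * (C₂ * C₂))))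
        + - (C₁ * C₁ * (C₂ * C₂)) * (a₄ * (C₁ * C₂ * C₃ * (C₁ * C₂ * C₃)) - (Λ * N + Λ * N
           + (A₁ * A₂ * (C₃ * C₃) + A₁ * A₃ * (C₂ * C₂) + A₂ * A₃ * (C₁ * C₁))))
      slopeL = solve-∀
      -- The relation slope · (y₁ + y₂) = x₁² + x₁x₂ + x₂² + a₄, cleared of denominators.
      slope : Λ * S ≡ C₃ * R
      slope = cancel C₃≢0 (≡-lin₃ (Λ * (C₂ * C₂)) p₁ (Λ * (C₁ * C₁)) p₂ (A₁ * (C₂ * C₂) + A₂ * (C₁ * C₁)) σ₁
        (≡-lin₁ (- (C₁ * C₁ * (C₂ * C₂))) σ₂ (slopeL a₄ A₁ B₁ C₁ A₂ B₂ C₂ A₃ C₃ Λ N)))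
      -- Modulo C₃ the equation `σ₁` reads Λ² ≡ A₃ C₁² C₂², so the slope has a genuine pole at p.
      -- Together with `slope` this forces p ∣ S, that is, y₁ ≡ -y₂.
      p∤Λ : ¬ + p ∣ Λ
      p∤Λ p∣Λ = ∤-* pp p∤A₃ (∤-* pp (∤-square pp p∤C₁) (∤-square pp p∤C₂))
        (∣-lin₂ p∣Λ Λ p∣C₃ (- (A₁ * (C₂ * C₂) * C₃ + A₂ * (C₁ * C₁) * C₃)) (≡-lin₁ (- 1ℤ) σ₁ (lemma A₁ C₁ A₂ C₂ A₃ C₃ Λ)))
        where
        lemma : ∀ A₁ C₁ A₂ C₂ A₃ C₃ Λ → A₃ * (C₁ * C₁ * (C₂ * C₂)) ≡ Λ * Λ + - (A₁ * (C₂ * C₂) * C₃ + A₂ * (C₁ * C₁) * C₃) * C₃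
          + - 1ℤ * (Λ * Λ - (A₁ * (C₂ * C₂ * (C₃ * C₃)) + A₂ * (C₁ * C₁ * (C₃ * C₃)) + A₃ * (C₁ * C₁ * (C₂ * C₂))))
        lemma = solve-∀
      p∣S : + p ∣ S
      p∣S = [ (λ h → ⊥-elim (p∤Λ h)) , id ]′ (euclid pp Λ S (∣-lin₁ p∣C₃ R (trans slope (*-comm C₃ R))))
      congr₁ : + p ∣ b₁ * (C₁ * C₁ * C₁) - B₁ * (v * v)
      congr₁ = ∣-trans p∣α₁ (Recipe.bC r₁)
      congr₂ : + p ∣ b₂ * (C₂ * C₂ * C₂) - B₂ * (v * v)
      congr₂ = ∣-trans p∣α₂ (Recipe.bC r₂)
      diffL : ∀ b₁ b₂ B₁ B₂ x y v² → v² * (+ 2 * (B₁ * y)) ≡ 1ℤ * (1ℤ * (x * y * (b₁ - b₂) + - y * (b₁ * x - B₁ * v²)) + x * (b₂ * y - B₂ * v²)) + v² * (B₁ * y + B₂ * x)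
      diffL = solve-∀
      p∣B₁ : + p ∣ B₁
      -- Through `congr₁` and `congr₂`, b₁ ≡ b₂ means y₁ ≡ y₂. With y₁ ≡ -y₂ and p odd, y₁ vanishes
      -- modulo p, and then so do b₁ and d.
      p∣B₁ = [ (λ h → ⊥-elim (∤-square pp p∤v h)) , (λ h → [ (λ k → ⊥-elim (p∤2 k)) , (λ k → [ id , (λ l → ⊥-elim (∤-cube pp p∤C₂ l)) ]′
          (euclid pp B₁ (C₂ * C₂ * C₂) k)) ]′ (euclid pp (+ 2) (B₁ * (C₂ * C₂ * C₂)) h)) ]′
        (euclid pp (v * v) (+ 2 * (B₁ * (C₂ * C₂ * C₂)))
          (∣-lin₂ (∣-lin₂ (∣-lin₂ p∣b₁-b₂ (C₁ * C₁ * C₁ * (C₂ * C₂ * C₂)) congr₁ (- (C₂ * C₂ * C₂)) refl) 1ℤ congr₂ (C₁ * C₁ * C₁) refl)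
            1ℤ p∣S (v * v) (diffL b₁ b₂ B₁ B₂ (C₁ * C₁ * C₁) (C₂ * C₂ * C₂) (v * v))))
      p∣b₁ : + p ∣ b₁
      p∣b₁ = [ id , (λ h → ⊥-elim (∤-cube pp p∤C₁ h)) ]′ (euclid pp b₁ (C₁ * C₁ * C₁)
        (∣-lin₂ congr₁ 1ℤ p∣B₁ (v * v) (lemma (b₁ * (C₁ * C₁ * C₁)) B₁ (v * v))))
        where
        lemma : ∀ z B v² → z ≡ 1ℤ * (z - B * v²) + v² * B
        lemma = solve-∀
      p∣d : + p ∣ d
      p∣d = ∣-lin₂ p∣α₁ γ₁ p∣b₁ (- b₁) (≡-lin₁ 1ℤ (Recipe.disc r₁) (lemma α₁ b₁ γ₁ d))
        where
        lemma : ∀ α b γ d → d ≡ γ * α + - b * b + 1ℤ * (b * b + d - α * γ)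
        lemma = solve-∀

-- The cube attached to three collinear points.

module ChordCubes where
  open import Data.Nat.Primality using (Prime; prime[2])
  open import Data.Integer using (ℤ; +_; -_; _+_; _-_; _*_; 0ℤ; 1ℤ; _<_)
  open import Data.Integer.Properties using (*-comm)
  open import Data.Integer.Divisibility.Signed using (_∣_; divides; quotient; _∣?_; ∣-trans)
  open import Data.Integer.Tactic.RingSolver using (solve-∀)
  open import Data.Product using (_×_; ∃-syntax; _,_)
  open import Data.Sum using (_⊎_; inj₁; inj₂; [_,_]′)
  open import Data.Empty using (⊥-elim)
  open import Relation.Nullary using (¬_; yes; no)
  open import Relation.Binary.PropositionalEquality using (_≡_; _≢_; refl; sym; trans; cong; cong₂; subst)
  open LinearCombination
  open Divisibility
  open Cubes
  open Composition
  open LocalConditions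
  open Ramification
  open Recipes
  open Chords
  open RecipeArithmetic

  module _ {d u v : ℤ} (max : MaximalOrder d) (0<d : 0ℤ < d) (v∣d : v ∣ d) where

    -- The case of substance is an unramified p dividing Y = v c₁c₂c₃. It does not divide v, a
    -- divisor of d, nor c₁ and c₂, since p ∣ α₁ and p ∣ α₂ exclude p from C₁ and C₂. So p ∣ C₃ and
    -- `opposite-mod` applies.
    pairCondition : ∀ {a₄ a₆ A₁ B₁ C₁ α₁ b₁ γ₁ A₂ B₂ C₂ α₂ b₂ γ₂ A₃ B₃ C₃ α₃ b₃ γ₃ Y} →
      (r₁ : Recipe d u v A₁ B₁ C₁ α₁ b₁ γ₁) (r₂ : Recipe d u v A₂ B₂ C₂ α₂ b₂ γ₂) (r₃ : Recipe d u v A₃ B₃ C₃ α₃ b₃ γ₃) →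
      Chord a₄ a₆ A₁ B₁ C₁ A₂ B₂ C₂ A₃ B₃ C₃ →
      Y ≡ v * (Recipe.c r₁ * Recipe.c r₂ * Recipe.c r₃) →
      ∀ p → Prime p → + p ∣ α₁ → + p ∣ α₂ → Ramified d p ⊎ (¬ + p ∣ Y) ⊎ (¬ + p ∣ b₁ - b₂)
    pairCondition {Y = Y} r₁ r₂ r₃ ch Y≡ p pp p∣α₁ p∣α₂ with + p ∣? d | + p ∣? + 2 | + p ∣? Y
    ... | yes p∣d | _ | _ = inj₁ (ramified-∣d max pp p∣d)
    ... | no _ | yes p∣2 | _ = inj₁ (subst (Ramified d) (sym (prime∣prime prime[2] pp p∣2)) (ramified-2 max))
    ... | no _ | no _ | no p∤Y = inj₂ (inj₁ p∤Y)
    ... | no p∤d | no p∤2 | yes p∣Y = inj₂ (inj₂ (opposite-mod max 0<d v∣d r₁ r₂ ch (pos⇒≢0 R₃.0<C) pp p∣α₁ p∣α₂ p∣C₃ (λ h → R₃.A⊥C pp h p∣C₃) p∤2 p∤d))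
      where
      module R₁ = Recipe r₁
      module R₂ = Recipe r₂
      module R₃ = Recipe r₃
      p∣C₃ : + p ∣ _
      p∣C₃ = [ (λ h → ⊥-elim (p∤d (∣-trans h v∣d))) ,
        (λ h → [ (λ k → [ (λ l → ⊥-elim (∣α⇒∤C max 0<d v∣d r₁ pp p∣α₁ (∣-trans l (c∣C max 0<d v∣d r₁)))) ,
                          (λ l → ⊥-elim (∣α⇒∤C max 0<d v∣d r₂ pp p∣α₂ (∣-trans l (c∣C max 0<d v∣d r₂)))) ]′ (euclid pp R₁.c R₂.c k)) ,
                 (λ l → ∣-trans l (c∣C max 0<d v∣d r₃)) ]′ (euclid pp (R₁.c * R₂.c) R₃.c h)) ]′
        (euclid pp v (R₁.c * R₂.c * R₃.c) (subst (+ p ∣_) Y≡ p∣Y))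

    module _ {a₄ a₆ A₁ B₁ C₁ α₁ b₁ γ₁ A₂ B₂ C₂ α₂ b₂ γ₂ A₃ B₃ C₃ α₃ b₃ γ₃ : ℤ}
      (d≡ : d ≡ v * (u * u * u + a₄ * u * (v * v) - a₆ * (v * v * v)))
      (r₁ : Recipe d u v A₁ B₁ C₁ α₁ b₁ γ₁) (r₂ : Recipe d u v A₂ B₂ C₂ α₂ b₂ γ₂) (r₃ : Recipe d u v A₃ B₃ C₃ α₃ b₃ γ₃)
      (ch : Chord a₄ a₆ A₁ B₁ C₁ A₂ B₂ C₂ A₃ B₃ C₃) where
      open Chord ch using (Λ; N; p₁; p₂; p₃)
      private
        module R₁ = Recipe r₁
        module R₂ = Recipe r₂
        module R₃ = Recipe r₃
        c₁ = R₁.c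
        c₂ = R₂.c
        c₃ = R₃.c
        g₁ = R₁.g
        g₂ = R₂.g
        g₃ = R₃.g

        module Norm (G Y Z K a₁ a₂ a₃ θ : ℤ) (Z≡ : Z ≡ v * θ) (GY : G * Y ≡ v * K)
          (prod : α₁ * α₂ * α₃ * (G * G) ≡ v * v * v * (a₁ * a₂ * a₃))
          (normθ : θ * θ + d * (K * K) ≡ v * (a₁ * a₂ * a₃)) (G≢0 : G ≢ 0ℤ) where
          Z² : Z * Z ≡ (α₁ * α₂ * α₃ - d * (Y * Y)) * (G * G)
          Z² = ≡-lin₃ (v * v) normθ (- 1ℤ) prod (d * (G * Y + v * K)) GY
            (≡-lin₁ (Z + v * θ) Z≡ (lemma G Y Z K (a₁ * a₂ * a₃) θ v d (α₁ * α₂ * α₃)))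
            where
            lemma : ∀ G Y Z K a θ v d P → Z * Z ≡ (P - d * (Y * Y)) * (G * G) + v * v * (θ * θ + d * (K * K) - v * a)
              + - 1ℤ * (P * (G * G) - v * v * v * a) + d * (G * Y + v * K) * (G * Y - v * K)
              + (Z + v * θ) * (Z - v * θ)
            lemma = solve-∀
          -- By `Z²` the square of Z/G is the integer α₁α₂α₃ - d Y², so Z/G is an integer itself.
          X-exists : ∃[ X ] (G * X ≡ Z) × (X * X + d * (Y * Y) ≡ α₁ * α₂ * α₃)
          X-exists = go (square-∣ G Z G≢0 (divides (α₁ * α₂ * α₃ - d * (Y * Y)) Z²))
            where
            lemma : ∀ G X Y Z d P → G * G * (X * X + d * (Y * Y)) ≡ G * G * P
              + 1ℤ * (Z * Z - (P - d * (Y * Y)) * (G * G)) + - (Z + X * G) * (Z - X * G)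
            lemma = solve-∀
            go : G ∣ Z → ∃[ X ] (G * X ≡ Z) × (X * X + d * (Y * Y) ≡ α₁ * α₂ * α₃)
            go (divides X e) = X , trans (*-comm G X) (sym e) ,
              cancel (*-≢0 G≢0 G≢0) (≡-lin₂ 1ℤ Z² (- (Z + X * G)) e (lemma G X Y Z d (α₁ * α₂ * α₃)))

        G = g₁ * g₂ * g₃
        Y = v * (c₁ * c₂ * c₃)
        K = C₁ * C₂ * C₃

        GY : G * Y ≡ v * K
        GY = trans (lemma v g₁ g₂ g₃ c₁ c₂ c₃)
          (cong (v *_) (sym (cong₂ _*_ (cong₂ _*_ R₁.C≡ R₂.C≡) R₃.C≡)))
          where
          lemma : ∀ v g₁ g₂ g₃ c₁ c₂ c₃ → g₁ * g₂ * g₃ * (v * (c₁ * c₂ * c₃)) ≡ v * (c₁ * g₁ * (c₂ * g₂) * (c₃ * g₃))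
          lemma = solve-∀

        prodα : ∀ {a₁ a₂ a₃} → α₁ * (g₁ * g₁) ≡ v * a₁ → α₂ * (g₂ * g₂) ≡ v * a₂ → α₃ * (g₃ * g₃) ≡ v * a₃ →
          α₁ * α₂ * α₃ * (G * G) ≡ v * v * v * (a₁ * a₂ * a₃)
        prodα {a₁} {a₂} {a₃} e₁ e₂ e₃ = trans (lemma α₁ α₂ α₃ g₁ g₂ g₃) (trans (cong₂ _*_ (cong₂ _*_ e₁ e₂) e₃) (lemma' v a₁ a₂ a₃))
          where
          lemma : ∀ α₁ α₂ α₃ g₁ g₂ g₃ → let G = g₁ * g₂ * g₃ in
            α₁ * α₂ * α₃ * (G * G) ≡ α₁ * (g₁ * g₁) * (α₂ * (g₂ * g₂)) * (α₃ * (g₃ * g₃))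
          lemma = solve-∀
          lemma' : ∀ v a₁ a₂ a₃ → v * a₁ * (v * a₂) * (v * a₃) ≡ v * v * v * (a₁ * a₂ * a₃)
          lemma' = solve-∀

        X-exists : ∃[ X ] (G * X ≡ v * v * (Λ * u - N * v)) × (X * X + d * (Y * Y) ≡ α₁ * α₂ * α₃)
        X-exists = Norm.X-exists G Y (v * v * (Λ * u - N * v)) K (A₁ * v + C₁ * C₁ * u) (A₂ * v + C₂ * C₂ * u) (A₃ * v + C₃ * C₃ * u)
          (Λ * u * v - N * (v * v)) (lemma u v Λ N) GY
          (prodα (αg max 0<d v∣d r₁) (αg max 0<d v∣d r₂) (αg max 0<d v∣d r₃))
          (trans (cong (λ z → (Λ * u * v - N * (v * v)) * (Λ * u * v - N * (v * v)) + z * (K * K)) d≡) (chord-norm ch u v))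
          (*-≢0 {g₁ * g₂} {g₃} (*-≢0 {g₁} {g₂} (g≢0 max 0<d v∣d r₁) (g≢0 max 0<d v∣d r₂)) (g≢0 max 0<d v∣d r₃))
          where
          lemma : ∀ u v Λ N → v * v * (Λ * u - N * v) ≡ v * (Λ * u * v - N * (v * v))
          lemma = solve-∀

        G⊥ : ∀ {p} → Prime p → ¬ + p ∣ v → ¬ + p ∣ G
        G⊥ pp p∤v = ∤-* pp (∤-* pp (λ h → p∤v (∣-trans h (divides R₁.w R₁.v≡))) (λ h → p∤v (∣-trans h (divides R₂.w R₂.v≡))))
                           (λ h → p∤v (∣-trans h (divides R₃.w R₃.v≡)))

        flip : ∀ {n z} → (e : n ∣ z) → z ≡ n * quotient e
        flip {n} (divides q e) = trans e (*-comm q n)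

        build : ∃[ X ] (G * X ≡ v * v * (Λ * u - N * v)) × (X * X + d * (Y * Y) ≡ α₁ * α₂ * α₃) → Cube d α₁ b₁ α₂ b₂ α₃ b₃
        build (X , hX , norm) = record
          { X = X ; Y = Y ; norm = norm
          ; e₁ = flip m₁ ; e₂ = flip m₂ ; e₃ = flip m₃ ; e₁₂ = flip m₁₂ ; e₁₃ = flip m₁₃ ; e₂₃ = flip m₂₃ ; e₁₂₃ = flip m₁₂₃ }
          where
          k₁ : ∀ x y z → x * y * z ≡ x * (y * z)
          k₁ = solve-∀
          k₂ : ∀ x y z → x * y * z ≡ y * (x * z)
          k₂ = solve-∀
          k₃ : ∀ x y z → x * y * z ≡ z * (x * y)
          k₃ = solve-∀
          k₁₃ : ∀ x y z → x * y * z ≡ x * z * y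
          k₁₃ = solve-∀
          k₂₃ : ∀ x y z → x * y * z ≡ y * z * x
          k₂₃ = solve-∀
          m₁ : α₁ ∣ X + Y * b₁
          m₁ = α∣X+Yb max 0<d v∣d r₁ {X} {Y} {Λ} {N} {C₂ * C₃} {G} {α₂ * α₃} hX (trans GY (cong (v *_) (k₁ C₁ C₂ C₃))) p₁ (trans norm (k₁ α₁ α₂ α₃)) G⊥
          m₂ : α₂ ∣ X + Y * b₂
          m₂ = α∣X+Yb max 0<d v∣d r₂ {X} {Y} {Λ} {N} {C₁ * C₃} {G} {α₁ * α₃} hX (trans GY (cong (v *_) (k₂ C₁ C₂ C₃))) p₂ (trans norm (k₂ α₁ α₂ α₃)) G⊥
          m₃ : α₃ ∣ X + Y * b₃
          m₃ = α∣X+Yb max 0<d v∣d r₃ {X} {Y} {Λ} {N} {C₁ * C₂} {G} {α₁ * α₂} hX (trans GY (cong (v *_) (k₃ C₁ C₂ C₃))) p₃ (trans norm (k₃ α₁ α₂ α₃)) G⊥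
          α₁≢0 = α≢0 max 0<d v∣d r₁
          α₂≢0 = α≢0 max 0<d v∣d r₂
          α₃≢0 = α≢0 max 0<d v∣d r₃
          m₁₂ = pair-∣ {d} {X} {Y} α₁ b₁ γ₁ α₂ b₂ γ₂ α₃ α₁≢0 α₂≢0 R₁.disc R₂.disc norm m₁ m₂
            (pairCondition r₁ r₂ r₃ ch refl)
          m₁₃ = pair-∣ {d} {X} {Y} α₁ b₁ γ₁ α₃ b₃ γ₃ α₂ α₁≢0 α₃≢0 R₁.disc R₃.disc (trans norm (k₁₃ α₁ α₂ α₃)) m₁ m₃
            (pairCondition r₁ r₃ r₂ (chord-132 ch) (cong (v *_) (k₁₃ c₁ c₂ c₃)))
          m₂₃ = pair-∣ {d} {X} {Y} α₂ b₂ γ₂ α₃ b₃ γ₃ α₁ α₂≢0 α₃≢0 R₂.disc R₃.disc (trans norm (k₂₃ α₁ α₂ α₃)) m₂ m₃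
            (pairCondition r₂ r₃ r₁ (chord-132 (chord-213 ch)) (cong (v *_) (k₂₃ c₁ c₂ c₃)))
          tripleCondition : ∀ p → Prime p → + p ∣ α₁ → + p ∣ α₂ → + p ∣ α₃ → Ramified d p ⊎ (¬ + p ∣ Y)
          tripleCondition p pp p∣α₁ p∣α₂ p∣α₃ with + p ∣? d
          ... | yes p∣d = inj₁ (ramified-∣d max pp p∣d)
          -- As p divides no Cᵢ, hence no cᵢ, and not v either, it does not divide Y = v c₁c₂c₃.
          ... | no p∤d = inj₂ (∤-* pp (λ h → p∤d (∣-trans h v∣d)) (∤-* pp (∤-* pp
              (λ h → ∣α⇒∤C max 0<d v∣d r₁ pp p∣α₁ (∣-trans h (c∣C max 0<d v∣d r₁)))
              (λ h → ∣α⇒∤C max 0<d v∣d r₂ pp p∣α₂ (∣-trans h (c∣C max 0<d v∣d r₂))))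
              (λ h → ∣α⇒∤C max 0<d v∣d r₃ pp p∣α₃ (∣-trans h (c∣C max 0<d v∣d r₃)))))
          m₁₂₃ = triple-∣ {d} {X} {Y} α₁ b₁ γ₁ α₂ b₂ γ₂ α₃ b₃ γ₃ α₁≢0 α₂≢0 α₃≢0 R₁.disc R₂.disc R₃.disc norm
            m₁ m₂ m₃ m₁₂ m₁₃ m₂₃ tripleCondition

      chord⇒cube : Cube d α₁ b₁ α₂ b₂ α₃ b₃
      chord⇒cube = build X-exists

-- Lines and the group law over ℚ, and the descent of identities to ℤ.

module RationalLines where
  open import Data.Nat.Base using (ℕ; suc)
  import Data.Nat.Base as ℕ
  import Data.Nat.Properties as ℕ
  open import Data.Integer as ℤ using (ℤ; +_; 0ℤ)
  import Data.Integer.Properties as ℤ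
  open import Data.Integer.Divisibility.Signed using (_∣_; divides)
  open import Data.Rational as ℚ using (ℚ; _+_; _*_; _-_; -_; 0ℚ; 1ℚ; toℚᵘ; ↥_; ↧_; mkℚ)
  open import Data.Rational.Properties using (_≟_; +-*-commutativeRing; /-injective-≃; toℚᵘ-fromℚᵘ; toℚᵘ-injective; toℚᵘ-homo-+; toℚᵘ-homo-*; toℚᵘ-homo‿-; +-inverseʳ; +-identityʳ; *-zeroʳ; *-assoc; *-comm; *-identityˡ; *-identityʳ; *-inverseˡ; neg-distribˡ-*)
  import Data.Rational.Unnormalised as ℚᵘ
  import Data.Rational.Unnormalised.Properties as ℚᵘ
  open import Data.Fin using (Fin; #_)
  open import Data.Vec.Base using (lookup; []; _∷_)
  open import Data.Maybe.Base using (Maybe; nothing; just)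
  open import Level using (0ℓ)
  open import Tactic.RingSolver using (solve-∀)
  open import Tactic.RingSolver.Core.AlmostCommutativeRing using (AlmostCommutativeRing; fromCommutativeRing)
  open import Data.Product using (∃-syntax; _,_)
  open import Relation.Nullary using (yes; no; Dec)
  open import Relation.Binary.PropositionalEquality using (_≡_; _≢_; refl; sym; trans; cong; cong₂; module ≡-Reasoning)
  open Divisibility using (square-∣)
  open Chords using (Chord)

  ℚ-ring : AlmostCommutativeRing 0ℓ 0ℓ
  ℚ-ring = fromCommutativeRing +-*-commutativeRing λ x → isZero x (x ≟ 0ℚ)
    where
    isZero : ∀ x → Dec (x ≡ 0ℚ) → Maybe (0ℚ ≡ x)
    isZero x (yes e) = just (sym e)
    isZero x (no _)  = nothing

  ι-inj : ∀ {i j} → ι i ≡ ι j → i ≡ j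
  ι-inj {i} {j} e with /-injective-≃ (ℚᵘ.mkℚᵘ i 0) (ℚᵘ.mkℚᵘ j 0) e
  ... | ℚᵘ.*≡* h = trans (sym (ℤ.*-identityʳ i)) (trans h (ℤ.*-identityʳ j))

  private
    u : ∀ i → toℚᵘ (ι i) ℚᵘ.≃ ℚᵘ.mkℚᵘ i 0
    u i = toℚᵘ-fromℚᵘ (ℚᵘ.mkℚᵘ i 0)

  ι-+ : ∀ i j → ι (i ℤ.+ j) ≡ ι i + ι j
  ι-+ i j = toℚᵘ-injective (begin
    toℚᵘ (ι (i ℤ.+ j))                 ≈⟨ u (i ℤ.+ j) ⟩
    ℚᵘ.mkℚᵘ (i ℤ.+ j) 0                ≡⟨ cong₂ (λ a b → ℚᵘ.mkℚᵘ (a ℤ.+ b) 0) (ℤ.*-identityʳ i) (ℤ.*-identityʳ j) ⟨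
    ℚᵘ.mkℚᵘ i 0 ℚᵘ.+ ℚᵘ.mkℚᵘ j 0       ≈⟨ ℚᵘ.+-cong (u i) (u j) ⟨
    toℚᵘ (ι i) ℚᵘ.+ toℚᵘ (ι j)         ≈⟨ toℚᵘ-homo-+ (ι i) (ι j) ⟨
    toℚᵘ (ι i + ι j)                   ∎)
    where
    open ℚᵘ.≃-Reasoning

  ι-* : ∀ i j → ι (i ℤ.* j) ≡ ι i * ι j
  ι-* i j = toℚᵘ-injective (begin
    toℚᵘ (ι (i ℤ.* j))                 ≈⟨ u (i ℤ.* j) ⟩
    ℚᵘ.mkℚᵘ i 0 ℚᵘ.* ℚᵘ.mkℚᵘ j 0       ≈⟨ ℚᵘ.*-cong (u i) (u j) ⟨
    toℚᵘ (ι i) ℚᵘ.* toℚᵘ (ι j)         ≈⟨ toℚᵘ-homo-* (ι i) (ι j) ⟨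
    toℚᵘ (ι i * ι j)                   ∎)
    where
    open ℚᵘ.≃-Reasoning

  ι-neg : ∀ i → ι (ℤ.- i) ≡ - ι i
  ι-neg i = toℚᵘ-injective (begin
    toℚᵘ (ι (ℤ.- i))        ≈⟨ u (ℤ.- i) ⟩
    ℚᵘ.- ℚᵘ.mkℚᵘ i 0        ≈⟨ ℚᵘ.-‿cong (u i) ⟨
    ℚᵘ.- toℚᵘ (ι i)         ≈⟨ toℚᵘ-homo‿- (ι i) ⟨
    toℚᵘ (- ι i)            ∎)
    where
    open ℚᵘ.≃-Reasoning

  clearDenominator : ∀ q → q * ι (↧ q) ≡ ι (↥ q)
  clearDenominator q = toℚᵘ-injective (begin
    toℚᵘ (q * ι (↧ q))                ≈⟨ toℚᵘ-homo-* q (ι (↧ q)) ⟩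
    toℚᵘ q ℚᵘ.* toℚᵘ (ι (↧ q))        ≈⟨ ℚᵘ.*-cong (ℚᵘ.≃-refl {toℚᵘ q}) (u (↧ q)) ⟩
    toℚᵘ q ℚᵘ.* ℚᵘ.mkℚᵘ (↧ q) 0       ≈⟨ lemma q ⟩
    ℚᵘ.mkℚᵘ (↥ q) 0                   ≈⟨ u (↥ q) ⟨
    toℚᵘ (ι (↥ q))                    ∎)
    where
    open ℚᵘ.≃-Reasoning
    lemma : ∀ q → toℚᵘ q ℚᵘ.* ℚᵘ.mkℚᵘ (↧ q) 0 ℚᵘ.≃ ℚᵘ.mkℚᵘ (↥ q) 0
    lemma (mkℚ n d-1 _) = ℚᵘ.*≡* (trans (ℤ.*-identityʳ _) (cong (λ z → n ℤ.* + z) (sym (ℕ.*-identityʳ (suc d-1)))))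

  private
    kill : ∀ c {l r} → l ≡ r → c * (l - r) ≡ 0ℚ
    kill c {l} refl = trans (cong (c *_) (+-inverseʳ l)) (*-zeroʳ c)

  ≡ℚ-lin₁ : ∀ {x y l r} c → l ≡ r → x ≡ y + c * (l - r) → x ≡ y
  ≡ℚ-lin₁ {y = y} c e i = trans i (trans (cong (λ z → y + z) (kill c e)) (+-identityʳ y))

  ≡ℚ-lin₂ : ∀ {x y l r l' r'} c → l ≡ r → ∀ c' → l' ≡ r' → x ≡ y + c * (l - r) + c' * (l' - r') → x ≡ y
  ≡ℚ-lin₂ c e c' e' i = ≡ℚ-lin₁ c e (≡ℚ-lin₁ c' e' i)

  ≡ℚ-lin₃ : ∀ {x y l r l' r' l'' r''} c → l ≡ r → ∀ c' → l' ≡ r' → ∀ c'' → l'' ≡ r'' →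
        x ≡ y + c * (l - r) + c' * (l' - r') + c'' * (l'' - r'') → x ≡ y
  ≡ℚ-lin₃ c e c' e' c'' e'' i = ≡ℚ-lin₁ c e (≡ℚ-lin₂ c' e' c'' e'' i)

  cancelℚ : ∀ {p q r} → p ≢ 0ℚ → p * q ≡ p * r → q ≡ r
  cancelℚ {p} {q} {r} p≢0 e = trans (sym (inv q)) (trans (cong (ℚ.1/ p *_) e) (inv r))
    where
    instance _ = ℚ.≢-nonZero p≢0
    inv : ∀ q → ℚ.1/ p * (p * q) ≡ q
    inv q = trans (sym (*-assoc (ℚ.1/ p) p q)) (trans (cong (_* q) (*-inverseˡ p)) (*-identityˡ q))

  ι≢0 : ∀ {i} → i ≢ 0ℤ → ι i ≢ 0ℚ
  ι≢0 {i} i≢0 e = i≢0 (ι-inj {i} {0ℤ} e)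

  square-integral : ∀ q m → q * q ≡ ι m → ∃[ k ] q ≡ ι k
  square-integral q m e = go (square-∣ (↧ q) (↥ q) den≢0 (divides m (ι-inj sq)))
    where
    n = ↥ q
    δ = ↧ q
    den≢0 : δ ≢ 0ℤ
    den≢0 ()
    lemma : ∀ q e m → (q * e) * (q * e) ≡ m * (e * e) + e * e * (q * q - m)
    lemma = solve-∀ ℚ-ring
    sq : ι (n ℤ.* n) ≡ ι (m ℤ.* (δ ℤ.* δ))
    sq = begin
      ι (n ℤ.* n)                 ≡⟨ ι-* n n ⟩
      ι n * ι n                   ≡⟨ cong₂ _*_ (clearDenominator q) (clearDenominator q) ⟨
      (q * ι δ) * (q * ι δ)       ≡⟨ ≡ℚ-lin₁ (ι δ * ι δ) e (lemma q (ι δ) (ι m)) ⟩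
      ι m * (ι δ * ι δ)           ≡⟨ cong (ι m *_) (ι-* δ δ) ⟨
      ι m * ι (δ ℤ.* δ)           ≡⟨ ι-* m (δ ℤ.* δ) ⟨
      ι (m ℤ.* (δ ℤ.* δ))         ∎
      where
      open ≡-Reasoning
    go : δ ∣ n → ∃[ k ] q ≡ ι k
    go (divides k e') = k , cancelℚ (ι≢0 den≢0) (begin
      ι δ * q          ≡⟨ *-comm (ι δ) q ⟩
      q * ι δ          ≡⟨ clearDenominator q ⟩
      ι n              ≡⟨ cong ι e' ⟩
      ι (k ℤ.* δ)      ≡⟨ ι-* k δ ⟩
      ι k * ι δ        ≡⟨ *-comm (ι k) (ι δ) ⟩
      ι δ * ι k        ∎)
      where
      open ≡-Reasoning

  -- Reflected polynomials: `ι` is pushed through sums and products by induction on the syntax, so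
  -- integral identities follow from their rational images. There is neither negation nor a numeral;
  -- the `Chord` equations are arranged accordingly, without subtraction and with Λ N + Λ N for 2 Λ
  -- N.
  data Expr (n : ℕ) : Set where
    var     : Fin n → Expr n
    _⊕_ _⊗_ : Expr n → Expr n → Expr n

  infixl 6 _⊕_
  infixl 7 _⊗_

  ⟦_⟧ℤ : ∀ {n} → Expr n → (Fin n → ℤ) → ℤ
  ⟦ var i ⟧ℤ ρ = ρ i
  ⟦ e ⊕ f ⟧ℤ ρ = ⟦ e ⟧ℤ ρ ℤ.+ ⟦ f ⟧ℤ ρ
  ⟦ e ⊗ f ⟧ℤ ρ = ⟦ e ⟧ℤ ρ ℤ.* ⟦ f ⟧ℤ ρ

  ⟦_⟧ℚ : ∀ {n} → Expr n → (Fin n → ℚ) → ℚ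
  ⟦ var i ⟧ℚ ρ = ρ i
  ⟦ e ⊕ f ⟧ℚ ρ = ⟦ e ⟧ℚ ρ + ⟦ f ⟧ℚ ρ
  ⟦ e ⊗ f ⟧ℚ ρ = ⟦ e ⟧ℚ ρ * ⟦ f ⟧ℚ ρ

  ι-⟦_⟧ : ∀ {n} (e : Expr n) ρ → ι (⟦ e ⟧ℤ ρ) ≡ ⟦ e ⟧ℚ (λ i → ι (ρ i))
  ι-⟦ var i ⟧ ρ = refl
  ι-⟦ e ⊕ f ⟧ ρ = trans (ι-+ (⟦ e ⟧ℤ ρ) (⟦ f ⟧ℤ ρ)) (cong₂ _+_ (ι-⟦ e ⟧ ρ) (ι-⟦ f ⟧ ρ))
  ι-⟦ e ⊗ f ⟧ ρ = trans (ι-* (⟦ e ⟧ℤ ρ) (⟦ f ⟧ℤ ρ)) (cong₂ _*_ (ι-⟦ e ⟧ ρ) (ι-⟦ f ⟧ ρ))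

  transfer : ∀ {n} (e f : Expr n) (ρ : Fin n → ℤ) →
    ⟦ e ⟧ℚ (λ i → ι (ρ i)) ≡ ⟦ f ⟧ℚ (λ i → ι (ρ i)) → ⟦ e ⟧ℤ ρ ≡ ⟦ f ⟧ℤ ρ
  transfer e f ρ h = ι-inj (trans (ι-⟦ e ⟧ ρ) (trans h (sym (ι-⟦ f ⟧ ρ))))

  -- Vieta's formulas for the intersection of y = slope·x + ν with y² = x³ + a₄x + a₆, tangents included.
  record Line (a₄ a₆ : ℚ) (x₁ y₁ x₂ y₂ x₃ y₃ : ℚ) : Set where
    field
      slope ν : ℚ
      σ₁ : slope * slope ≡ x₁ + x₂ + x₃
      σ₂ : a₄ ≡ slope * ν + slope * ν + (x₁ * x₂ + x₁ * x₃ + x₂ * x₃)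
      σ₃ : ν * ν ≡ a₆ + x₁ * x₂ * x₃
      p₁ : y₁ ≡ slope * x₁ + ν
      p₂ : y₂ ≡ slope * x₂ + ν
      p₃ : y₃ ≡ slope * x₃ + ν

  -- Dividing the difference of the curve equations at x₁, x₂ by x₂ - x₁ gives
  -- slope (y₁ + y₂) = x₁² + x₁x₂ + x₂² + a₄, which also holds for tangents and determines the line.
  line : ∀ a₄ a₆ x₁ y₁ x₂ y₂ s →
    y₁ * y₁ ≡ x₁ * x₁ * x₁ + a₄ * x₁ + a₆ →
    s * (x₂ - x₁) ≡ y₂ - y₁ → s * (y₁ + y₂) ≡ x₁ * x₁ + x₁ * x₂ + x₂ * x₂ + a₄ →
    let x₃ = s * s - x₁ - x₂ in
    Line a₄ a₆ x₁ y₁ x₂ y₂ x₃ (- (s * (x₁ - x₃) - y₁))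
  line a₄ a₆ x₁ y₁ x₂ y₂ s e₁ e₂ e₃ = record
    { slope = s ; ν = y₁ - s * x₁
    ; σ₁ = l₁ s x₁ x₂
    ; σ₂ = ≡ℚ-lin₂ (- 1ℚ) e₃ (- s) e₂ (l₂ a₄ s x₁ y₁ x₂ y₂)
    ; σ₃ = ≡ℚ-lin₃ 1ℚ e₁ (- x₁) e₃ (- (s * x₁)) e₂ (l₃ a₄ a₆ s x₁ y₁ x₂ y₂)
    ; p₁ = l₄ s x₁ y₁
    ; p₂ = ≡ℚ-lin₁ (- 1ℚ) e₂ (l₅ s x₁ y₁ x₂ y₂)
    ; p₃ = l₆ s x₁ y₁ x₂ }
    where
    l₁ : ∀ s x₁ x₂ → s * s ≡ x₁ + x₂ + (s * s - x₁ - x₂)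
    l₁ = solve-∀ ℚ-ring
    l₂ : ∀ a₄ s x₁ y₁ x₂ y₂ → let ν = y₁ - s * x₁; x₃ = s * s - x₁ - x₂ in
      a₄ ≡ s * ν + s * ν + (x₁ * x₂ + x₁ * x₃ + x₂ * x₃)
         + - 1ℚ * (s * (y₁ + y₂) - (x₁ * x₁ + x₁ * x₂ + x₂ * x₂ + a₄)) + - s * (s * (x₂ - x₁) - (y₂ - y₁))
    l₂ = solve-∀ ℚ-ring
    l₃ : ∀ a₄ a₆ s x₁ y₁ x₂ y₂ → let ν = y₁ - s * x₁; x₃ = s * s - x₁ - x₂ in
      ν * ν ≡ a₆ + x₁ * x₂ * x₃ + 1ℚ * (y₁ * y₁ - (x₁ * x₁ * x₁ + a₄ * x₁ + a₆))
         + - x₁ * (s * (y₁ + y₂) - (x₁ * x₁ + x₁ * x₂ + x₂ * x₂ + a₄)) + - (s * x₁) * (s * (x₂ - x₁) - (y₂ - y₁))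
    l₃ = solve-∀ ℚ-ring
    l₄ : ∀ s x₁ y₁ → y₁ ≡ s * x₁ + (y₁ - s * x₁)
    l₄ = solve-∀ ℚ-ring
    l₅ : ∀ s x₁ y₁ x₂ y₂ → y₂ ≡ s * x₂ + (y₁ - s * x₁) + - 1ℚ * (s * (x₂ - x₁) - (y₂ - y₁))
    l₅ = solve-∀ ℚ-ring
    l₆ : ∀ s x₁ y₁ x₂ → let x₃ = s * s - x₁ - x₂ in - (s * (x₁ - x₃) - y₁) ≡ s * x₃ + (y₁ - s * x₁)
    l₆ = solve-∀ ℚ-ring

  data AddView (a₄ a₆ : ℤ) (x₁ y₁ x₂ y₂ : ℚ) : Point → Set where
    opposite : x₂ ≡ x₁ → y₂ ≡ - y₁ → AddView a₄ a₆ x₁ y₁ x₂ y₂ 𝒪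
    affine   : ∀ {x₃ y₃} → Line (ι a₄) (ι a₆) x₁ y₁ x₂ y₂ x₃ (- y₃) → AddView a₄ a₆ x₁ y₁ x₂ y₂ (aff x₃ y₃)

  ÷-* : ∀ p q .{{_ : ℚ.NonZero q}} → (p ℚ.÷ q) * q ≡ p
  ÷-* p q = trans (*-assoc p (ℚ.1/ q) q) (trans (cong (p *_) (*-inverseˡ q)) (*-identityʳ p))

  -- Each branch with an affine sum has one of the two slope equations required by `line` from the
  -- definition of its slope, and obtains the other from the curve equations.
  addView : ∀ a₄ a₆ x₁ y₁ x₂ y₂ → OnCurve a₄ a₆ (aff x₁ y₁) → OnCurve a₄ a₆ (aff x₂ y₂) →
    AddView a₄ a₆ x₁ y₁ x₂ y₂ (addE a₄ a₆ (aff x₁ y₁) (aff x₂ y₂))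
  addView a₄ a₆ x₁ y₁ x₂ y₂ c₁ c₂ with x₂ - x₁ ≟ 0ℚ
  ... | no dx≢0 = affine (line (ι a₄) (ι a₆) x₁ y₁ x₂ y₂ s c₁ e₂ (cancelℚ dx≢0
          (≡ℚ-lin₃ (y₁ + y₂) e₂ 1ℚ c₂ (- 1ℚ) c₁ (lemma s (ι a₄) (ι a₆) x₁ y₁ x₂ y₂))))
    where
    s = ℚ._÷_ (y₂ - y₁) (x₂ - x₁) {{ℚ.≢-nonZero dx≢0}}
    e₂ : s * (x₂ - x₁) ≡ y₂ - y₁
    e₂ = ÷-* (y₂ - y₁) (x₂ - x₁) {{ℚ.≢-nonZero dx≢0}}
    lemma : ∀ s a₄ a₆ x₁ y₁ x₂ y₂ → (x₂ - x₁) * (s * (y₁ + y₂)) ≡ (x₂ - x₁) * (x₁ * x₁ + x₁ * x₂ + x₂ * x₂ + a₄)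
      + (y₁ + y₂) * (s * (x₂ - x₁) - (y₂ - y₁)) + 1ℚ * (y₂ * y₂ - (x₂ * x₂ * x₂ + a₄ * x₂ + a₆))
      + - 1ℚ * (y₁ * y₁ - (x₁ * x₁ * x₁ + a₄ * x₁ + a₆))
    lemma = solve-∀ ℚ-ring
  ... | yes dx≡0 with y₁ + y₂ ≟ 0ℚ
  ...   | yes s≡0 = opposite (≡ℚ-lin₁ 1ℚ dx≡0 (lemma₁ x₁ x₂)) (≡ℚ-lin₁ 1ℚ s≡0 (lemma₂ y₁ y₂))
    where
    lemma₁ : ∀ x₁ x₂ → x₂ ≡ x₁ + 1ℚ * (x₂ - x₁ - 0ℚ)
    lemma₁ = solve-∀ ℚ-ring
    lemma₂ : ∀ y₁ y₂ → y₂ ≡ - y₁ + 1ℚ * (y₁ + y₂ - 0ℚ)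
    lemma₂ = solve-∀ ℚ-ring
  ...   | no s≢0 = affine (line (ι a₄) (ι a₆) x₁ y₁ x₂ y₂ s c₁ e₂ e₃)
    where
    s = ℚ._÷_ (ι (ℤ.+ 3) * x₁ * x₁ + ι a₄) (y₁ + y₂) {{ℚ.≢-nonZero s≢0}}
    e₃' : s * (y₁ + y₂) ≡ ι (ℤ.+ 3) * x₁ * x₁ + ι a₄
    e₃' = ÷-* (ι (ℤ.+ 3) * x₁ * x₁ + ι a₄) (y₁ + y₂) {{ℚ.≢-nonZero s≢0}}
    lemma₃ : ∀ z t a₄ x₁ x₂ → z ≡ x₁ * x₁ + x₁ * x₂ + x₂ * x₂ + a₄ + 1ℚ * (z - (t * x₁ * x₁ + a₄))
      + - (x₁ + x₁ + x₂) * (x₂ - x₁ - 0ℚ) + x₁ * x₁ * (t - (1ℚ + 1ℚ + 1ℚ))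
    lemma₃ = solve-∀ ℚ-ring
    e₃ : s * (y₁ + y₂) ≡ x₁ * x₁ + x₁ * x₂ + x₂ * x₂ + ι a₄
    -- The numeral `ι (+ 3)` is an atom t for the solver; `refl` supplies t = 1 + 1 + 1 by
    -- evaluation.
    e₃ = ≡ℚ-lin₃ 1ℚ e₃' (- (x₁ + x₁ + x₂)) dx≡0 (x₁ * x₁) (refl {x = ι (ℤ.+ 3)}) (lemma₃ (s * (y₁ + y₂)) (ι (ℤ.+ 3)) (ι a₄) x₁ x₂)
    lemma₂ : ∀ s a₄ a₆ x₁ y₁ x₂ y₂ → (y₁ + y₂) * (s * (x₂ - x₁)) ≡ (y₁ + y₂) * (y₂ - y₁)
      + ((y₁ + y₂) * s - (x₁ * x₁ + x₁ * x₂ + x₂ * x₂ + a₄)) * (x₂ - x₁ - 0ℚ)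
      + - 1ℚ * (y₂ * y₂ - (x₂ * x₂ * x₂ + a₄ * x₂ + a₆)) + 1ℚ * (y₁ * y₁ - (x₁ * x₁ * x₁ + a₄ * x₁ + a₆))
    lemma₂ = solve-∀ ℚ-ring
    e₂ : s * (x₂ - x₁) ≡ y₂ - y₁
    -- From x₁ = x₂ the curve equations give y₁² = y₂²; cancelling y₁ + y₂ leaves y₁ = y₂, so both
    -- sides vanish.
    e₂ = cancelℚ s≢0 (≡ℚ-lin₃ ((y₁ + y₂) * s - (x₁ * x₁ + x₁ * x₂ + x₂ * x₂ + ι a₄)) dx≡0 (- 1ℚ) c₂ 1ℚ c₁
           (lemma₂ s (ι a₄) (ι a₆) x₁ y₁ x₂ y₂))

  ι-square : ∀ {x A C} → x * ι (C ℤ.* C) ≡ ι A → x * (ι C * ι C) ≡ ι A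
  ι-square {x} {A} {C} e = trans (cong (x *_) (sym (ι-* C C))) e

  ι-cube : ∀ {y B C} → y * ι (C ℤ.* C ℤ.* C) ≡ ι B → y * (ι C * ι C * ι C) ≡ ι B
  ι-cube {y} {B} {C} e = trans (cong (y *_) (sym (trans (ι-* (C ℤ.* C) C) (cong (_* ι C) (ι-* C C))))) e

  chord : ∀ {a₄ a₆ A₁ B₁ C₁ A₂ B₂ C₂ A₃ B₃ C₃ x₁ y₁ x₂ y₂ x₃ y₃} → Line (ι a₄) (ι a₆) x₁ y₁ x₂ y₂ x₃ y₃ →
    x₁ * (ι C₁ * ι C₁) ≡ ι A₁ → x₂ * (ι C₂ * ι C₂) ≡ ι A₂ → x₃ * (ι C₃ * ι C₃) ≡ ι A₃ →
    y₁ * (ι C₁ * ι C₁ * ι C₁) ≡ ι B₁ → y₂ * (ι C₂ * ι C₂ * ι C₂) ≡ ι B₂ → y₃ * (ι C₃ * ι C₃ * ι C₃) ≡ ι B₃ →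
    Chord a₄ a₆ A₁ B₁ C₁ A₂ B₂ C₂ A₃ B₃ C₃
  chord {a₄} {a₆} {A₁} {B₁} {C₁} {A₂} {B₂} {C₂} {A₃} {B₃} {C₃} {x₁} {y₁} {x₂} {y₂} {x₃} {y₃} ℓ X₁ X₂ X₃ Y₁ Y₂ Y₃ =
    build (square-integral (s * K) (⟦ S₁ ⟧ℤ ρ₀) (trans sqΛ (sym (ι-⟦ S₁ ⟧ ρ₀))))
          (square-integral (ν * K) (⟦ S₃ ⟧ℤ ρ₀) (trans sqN (sym (ι-⟦ S₃ ⟧ ρ₀))))
    where
    open Line ℓ renaming (slope to s)
    k₁ = ι C₁
    k₂ = ι C₂
    k₃ = ι C₃
    K = k₁ * k₂ * k₃
    ρ : ℤ → ℤ → Fin 13 → ℤ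
    ρ Λ N = lookup (A₁ ∷ A₂ ∷ A₃ ∷ C₁ ∷ C₂ ∷ C₃ ∷ a₄ ∷ a₆ ∷ B₁ ∷ B₂ ∷ B₃ ∷ Λ ∷ N ∷ [])
    -- `S₁` and `S₃` do not contain the variables of Λ and N, so zeros can stand in for them while
    -- the integers Λ and N are still to be found.
    ρ₀ = ρ 0ℤ 0ℤ
    eA₁ eA₂ eA₃ eC₁ eC₂ eC₃ ea₄ ea₆ eB₁ eB₂ eB₃ eΛ eN eK S₁ S₃ : Expr 13
    eA₁ = var (# 0)
    eA₂ = var (# 1)
    eA₃ = var (# 2)
    eC₁ = var (# 3)
    eC₂ = var (# 4)
    eC₃ = var (# 5)
    ea₄ = var (# 6)
    ea₆ = var (# 7)
    eB₁ = var (# 8)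
    eB₂ = var (# 9)
    eB₃ = var (# 10)
    eΛ = var (# 11)
    eN = var (# 12)
    eK = eC₁ ⊗ eC₂ ⊗ eC₃
    S₁ = eA₁ ⊗ (eC₂ ⊗ eC₂ ⊗ (eC₃ ⊗ eC₃)) ⊕ eA₂ ⊗ (eC₁ ⊗ eC₁ ⊗ (eC₃ ⊗ eC₃)) ⊕ eA₃ ⊗ (eC₁ ⊗ eC₁ ⊗ (eC₂ ⊗ eC₂))
    S₃ = ea₆ ⊗ (eK ⊗ eK) ⊕ eA₁ ⊗ eA₂ ⊗ eA₃

    sqΛ : s * K * (s * K) ≡ ι A₁ * (k₂ * k₂ * (k₃ * k₃)) + ι A₂ * (k₁ * k₁ * (k₃ * k₃)) + ι A₃ * (k₁ * k₁ * (k₂ * k₂))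
    sqΛ = ≡ℚ-lin₁ (K * K) σ₁ (≡ℚ-lin₃ (k₂ * k₂ * (k₃ * k₃)) X₁ (k₁ * k₁ * (k₃ * k₃)) X₂ (k₁ * k₁ * (k₂ * k₂)) X₃
      (lemma s x₁ x₂ x₃ k₁ k₂ k₃ (ι A₁) (ι A₂) (ι A₃)))
      where
      lemma : ∀ s x₁ x₂ x₃ k₁ k₂ k₃ a₁ a₂ a₃ → let K = k₁ * k₂ * k₃ in s * K * (s * K) ≡
        a₁ * (k₂ * k₂ * (k₃ * k₃)) + a₂ * (k₁ * k₁ * (k₃ * k₃)) + a₃ * (k₁ * k₁ * (k₂ * k₂))
        + K * K * (s * s - (x₁ + x₂ + x₃))
        + k₂ * k₂ * (k₃ * k₃) * (x₁ * (k₁ * k₁) - a₁) + k₁ * k₁ * (k₃ * k₃) * (x₂ * (k₂ * k₂) - a₂)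
        + k₁ * k₁ * (k₂ * k₂) * (x₃ * (k₃ * k₃) - a₃)
      lemma = solve-∀ ℚ-ring

    sqN : ν * K * (ν * K) ≡ ι a₆ * (K * K) + ι A₁ * ι A₂ * ι A₃
    sqN = ≡ℚ-lin₁ (K * K) σ₃ (≡ℚ-lin₃ (x₂ * (k₂ * k₂) * (x₃ * (k₃ * k₃))) X₁ (ι A₁ * (x₃ * (k₃ * k₃))) X₂ (ι A₁ * ι A₂) X₃
      (lemma ν (ι a₆) x₁ x₂ x₃ k₁ k₂ k₃ (ι A₁) (ι A₂) (ι A₃)))
      where
      lemma : ∀ ν a₆ x₁ x₂ x₃ k₁ k₂ k₃ a₁ a₂ a₃ → let K = k₁ * k₂ * k₃ in ν * K * (ν * K) ≡
        a₆ * (K * K) + a₁ * a₂ * a₃ + K * K * (ν * ν - (a₆ + x₁ * x₂ * x₃))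
        + x₂ * (k₂ * k₂) * (x₃ * (k₃ * k₃)) * (x₁ * (k₁ * k₁) - a₁)
        + a₁ * (x₃ * (k₃ * k₃)) * (x₂ * (k₂ * k₂) - a₂) + a₁ * a₂ * (x₃ * (k₃ * k₃) - a₃)
      lemma = solve-∀ ℚ-ring

    mid : ι a₄ * (K * K) ≡ s * K * (ν * K) + s * K * (ν * K)
      + (ι A₁ * ι A₂ * (k₃ * k₃) + ι A₁ * ι A₃ * (k₂ * k₂) + ι A₂ * ι A₃ * (k₁ * k₁))
    mid = ≡ℚ-lin₁ (K * K) σ₂ (≡ℚ-lin₃ (k₃ * k₃ * (x₂ * (k₂ * k₂)) + k₂ * k₂ * (x₃ * (k₃ * k₃))) X₁
        (k₃ * k₃ * ι A₁ + k₁ * k₁ * (x₃ * (k₃ * k₃))) X₂ (k₂ * k₂ * ι A₁ + k₁ * k₁ * ι A₂) X₃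
        (lemma s ν (ι a₄) x₁ x₂ x₃ k₁ k₂ k₃ (ι A₁) (ι A₂) (ι A₃)))
      where
      lemma : ∀ s ν a₄ x₁ x₂ x₃ k₁ k₂ k₃ a₁ a₂ a₃ → let K = k₁ * k₂ * k₃ in a₄ * (K * K) ≡
        s * K * (ν * K) + s * K * (ν * K) + (a₁ * a₂ * (k₃ * k₃) + a₁ * a₃ * (k₂ * k₂) + a₂ * a₃ * (k₁ * k₁))
        + K * K * (a₄ - (s * ν + s * ν + (x₁ * x₂ + x₁ * x₃ + x₂ * x₃)))
        + (k₃ * k₃ * (x₂ * (k₂ * k₂)) + k₂ * k₂ * (x₃ * (k₃ * k₃))) * (x₁ * (k₁ * k₁) - a₁)
        + (k₃ * k₃ * a₁ + k₁ * k₁ * (x₃ * (k₃ * k₃))) * (x₂ * (k₂ * k₂) - a₂)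
        + (k₂ * k₂ * a₁ + k₁ * k₁ * a₂) * (x₃ * (k₃ * k₃) - a₃)
      lemma = solve-∀ ℚ-ring

    incident : ∀ {x y a b} k l m → y ≡ s * x + ν → x * (k * k) ≡ a → y * (k * k * k) ≡ b →
      b * (l * m) ≡ s * (k * l * m) * a + ν * (k * l * m) * (k * k)
    incident {x} {y} {a} {b} k l m e X Y = ≡ℚ-lin₃ (k * k * k * (l * m)) e (s * (k * l * m)) X (- (l * m)) Y (lemma s ν x y a b k l m)
      where
      lemma : ∀ s ν x y a b k l m → b * (l * m) ≡ s * (k * l * m) * a + ν * (k * l * m) * (k * k)
        + k * k * k * (l * m) * (y - (s * x + ν)) + s * (k * l * m) * (x * (k * k) - a) + - (l * m) * (y * (k * k * k) - b)
      lemma = solve-∀ ℚ-ring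

    perm₂ : k₂ * k₁ * k₃ ≡ K
    perm₂ = cong (_* k₃) (*-comm k₂ k₁)
    perm₃ : k₃ * k₁ * k₂ ≡ K
    perm₃ = trans (*-assoc k₃ k₁ k₂) (*-comm k₃ (k₁ * k₂))

    build : ∃[ Λ ] s * K ≡ ι Λ → ∃[ N ] ν * K ≡ ι N → Chord a₄ a₆ A₁ B₁ C₁ A₂ B₂ C₂ A₃ B₃ C₃
    build (Λ , eΛ≡) (N , eN≡) = record
      { Λ = Λ ; N = N
      ; σ₁ = transfer (eΛ ⊗ eΛ) S₁ (ρ Λ N) (trans (cong (λ L → L * L) (sym eΛ≡)) sqΛ)
      ; σ₂ = transfer (ea₄ ⊗ (eK ⊗ eK)) (eΛ ⊗ eN ⊕ eΛ ⊗ eN ⊕ (eA₁ ⊗ eA₂ ⊗ (eC₃ ⊗ eC₃) ⊕ eA₁ ⊗ eA₃ ⊗ (eC₂ ⊗ eC₂) ⊕ eA₂ ⊗ eA₃ ⊗ (eC₁ ⊗ eC₁)))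
          (ρ Λ N) (trans mid (cong₂ (λ L M → L * M + L * M + (ι A₁ * ι A₂ * (k₃ * k₃) + ι A₁ * ι A₃ * (k₂ * k₂) + ι A₂ * ι A₃ * (k₁ * k₁))) eΛ≡ eN≡))
      ; σ₃ = transfer (eN ⊗ eN) S₃ (ρ Λ N) (trans (cong (λ L → L * L) (sym eN≡)) sqN)
      ; p₁ = transfer (eB₁ ⊗ (eC₂ ⊗ eC₃)) (eΛ ⊗ eA₁ ⊕ eN ⊗ (eC₁ ⊗ eC₁)) (ρ Λ N)
          (trans (incident k₁ k₂ k₃ p₁ X₁ Y₁) (cong₂ (λ L M → L * ι A₁ + M * (k₁ * k₁)) eΛ≡ eN≡))
      ; p₂ = transfer (eB₂ ⊗ (eC₁ ⊗ eC₃)) (eΛ ⊗ eA₂ ⊕ eN ⊗ (eC₂ ⊗ eC₂)) (ρ Λ N)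
          (trans (incident k₂ k₁ k₃ p₂ X₂ Y₂) (cong₂ (λ L M → L * ι A₂ + M * (k₂ * k₂)) (trans (cong (s *_) perm₂) eΛ≡) (trans (cong (ν *_) perm₂) eN≡)))
      ; p₃ = transfer (eB₃ ⊗ (eC₁ ⊗ eC₂)) (eΛ ⊗ eA₃ ⊕ eN ⊗ (eC₃ ⊗ eC₃)) (ρ Λ N)
          (trans (incident k₃ k₁ k₂ p₃ X₃ Y₃) (cong₂ (λ L M → L * ι A₃ + M * (k₃ * k₃)) (trans (cong (s *_) perm₃) eΛ≡) (trans (cong (ν *_) perm₃) eN≡)))
      }

  curve-integral : ∀ {a₄ a₆ A B C x y} → OnCurve a₄ a₆ (aff x y) →
    x * (ι C * ι C) ≡ ι A → y * (ι C * ι C * ι C) ≡ ι B →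
    B ℤ.* B ≡ A ℤ.* A ℤ.* A ℤ.+ a₄ ℤ.* A ℤ.* (C ℤ.* C ℤ.* (C ℤ.* C)) ℤ.+ a₆ ℤ.* (C ℤ.* C ℤ.* C ℤ.* (C ℤ.* C ℤ.* C))
  curve-integral {a₄} {a₆} {A} {B} {C} {x} {y} c X Y =
    transfer (eB ⊗ eB) (eA ⊗ eA ⊗ eA ⊕ ea₄ ⊗ eA ⊗ (eC ⊗ eC ⊗ (eC ⊗ eC)) ⊕ ea₆ ⊗ (eC ⊗ eC ⊗ eC ⊗ (eC ⊗ eC ⊗ eC)))
      (lookup (A ∷ B ∷ C ∷ a₄ ∷ a₆ ∷ []))
      (≡ℚ-lin₃ (k * k * k * (k * k * k)) c
            (x * (k * k) * (x * (k * k)) + ι A * (x * (k * k)) + ι A * ι A + ι a₄ * (k * k * (k * k))) X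
            (- (y * (k * k * k) + ι B)) Y (lemma (ι a₄) (ι a₆) (ι A) (ι B) k x y))
    where
    k = ι C
    eA eB eC ea₄ ea₆ : Expr 5
    eA = var (# 0)
    eB = var (# 1)
    eC = var (# 2)
    ea₄ = var (# 3)
    ea₆ = var (# 4)
    lemma : ∀ a₄ a₆ A B k x y → B * B ≡ A * A * A + a₄ * A * (k * k * (k * k)) + a₆ * (k * k * k * (k * k * k))
      + k * k * k * (k * k * k) * (y * y - (x * x * x + a₄ * x + a₆))
      + (x * (k * k) * (x * (k * k)) + A * (x * (k * k)) + A * A + a₄ * (k * k * (k * k))) * (x * (k * k) - A)
      + - (y * (k * k * k) + B) * (y * (k * k * k) - B)
    lemma = solve-∀ ℚ-ring

  cross-multiply : ∀ {x A A' S S'} → x * ι S ≡ ι A → x * ι S' ≡ ι A' → A ℤ.* S' ≡ A' ℤ.* S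
  cross-multiply {x} {A} {A'} {S} {S'} e e' = ι-inj (begin
    ι (A ℤ.* S')         ≡⟨ ι-* A S' ⟩
    ι A * ι S'           ≡⟨ cong (_* ι S') e ⟨
    x * ι S * ι S'       ≡⟨ *-assoc x (ι S) (ι S') ⟩
    x * (ι S * ι S')     ≡⟨ cong (x *_) (*-comm (ι S) (ι S')) ⟩
    x * (ι S' * ι S)     ≡⟨ *-assoc x (ι S') (ι S) ⟨
    x * ι S' * ι S       ≡⟨ cong (_* ι S) e' ⟩
    ι A' * ι S           ≡⟨ ι-* A' S ⟨
    ι (A' ℤ.* S)         ∎)
    where
    open ≡-Reasoning

  ι-negate : ∀ {y B S} → y * ι S ≡ ι B → - y * ι S ≡ ι (ℤ.- B)
  ι-negate {y} {B} {S} e = trans (sym (neg-distribˡ-* y (ι S))) (trans (cong -_ e) (sym (ι-neg B)))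

  neg-involutiveℚ : ∀ q → - (- q) ≡ q
  neg-involutiveℚ = solve-∀ ℚ-ring

-- Uniqueness of recipes, positivity, and the cases of the group law.

module Homomorphism where
  open import Data.Nat.Base using (ℕ; z≤n; s≤s)
  import Data.Nat.Divisibility as ℕ
  open import Data.Nat.Primality using (Prime)
  open import Data.Integer using (ℤ; +_; -_; _+_; _-_; _*_; 0ℤ; 1ℤ; _<_; +<+)
  open import Data.Integer.Properties using (*-identityˡ; *-comm; <-irrefl; +-mono-≤-<; +-mono-<; <-cmp; neg-mono-<; neg-involutive; 0≤i⇒+∣i∣≡i; <⇒≤)
  open import Data.Integer.Divisibility.Signed using (_∣_; divides; ∣⇒∣ᵤ; ∣-refl; ∣m⇒∣m*n)
  import Data.Integer.GCD as ℤ
  open import Data.Integer.Tactic.RingSolver using (solve-∀)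
  import Data.Rational as ℚ
  open import Data.Product using (_×_; ∃-syntax; _,_; proj₁; proj₂)
  open import Data.Empty using (⊥-elim)
  open import Relation.Nullary using (¬_)
  open import Relation.Binary using (tri<; tri≈; tri>)
  open import Relation.Binary.PropositionalEquality using (_≡_; _≢_; refl; sym; trans; cong; subst; subst₂)
  open LinearCombination
  open Divisibility
  open Cubes
  open Composition
  open LocalConditions
  open Ramification
  open Recipes
  open Chords
  open RecipeArithmetic
  open ChordCubes
  open RationalLines using (Line; AddView; opposite; affine; addView; chord; ι-square; ι-cube; curve-integral; cross-multiply; ι-negate; neg-involutiveℚ)

  composite-comm : ∀ f g h → IsComposite f g h → IsComposite g f h
  composite-comm f g h (a₁ , a₂ , B , c , 0<a₁ , 0<a₂ , cop , f∼ , g∼ , h∼) =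
    a₂ , a₁ , B , c , 0<a₂ , 0<a₁ , trans (cong (λ z → ℤ.gcd z B) (ℤ.gcd-comm a₂ a₁)) cop , g∼ , f∼ ,
    subst (λ z → h ∼ form z B c) (*-comm a₁ a₂) h∼

  -- Translation by b turns (1, 0, d) into (1, 2b, αγ), which is united with (α, 2b, γ). The shift
  -- by α k allows for another choice of μ in the composite.
  composite-identity : ∀ {d α b γ b' γ'} k → 0ℤ < α → b * b + d ≡ α * γ → b' * b' + d ≡ α * γ' → b ≡ b' + α * k →
    IsComposite (form 1ℤ 0ℤ d) (form α (+ 2 * b) γ) (form α (+ 2 * b') γ')
  composite-identity {d} {α} {b} {γ} {b'} {γ'} k 0<α disc disc' b≡ =
    1ℤ , α , + 2 * b , γ , +<+ (s≤s z≤n) , 0<α , bézout⇒gcd≡1 1ℤ 0ℤ 1ℤ α (+ 2 * b) refl ,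
    ∼-translate {d} {1ℤ} {0ℤ} {d} {b} {α * γ} b (λ ()) (l₁ d) (trans disc (sym (*-identityˡ (α * γ)))) (l₂ b) ,
    subst (λ z → form α (+ 2 * b) γ ∼ form α (+ 2 * b) z) (sym (*-identityˡ γ))
      (∼-translate {d} {α} {b} {γ} {b} {γ} 0ℤ (pos⇒≢0 0<α) disc disc (l₃ α b)) ,
    subst (λ z → form α (+ 2 * b') γ' ∼ form z (+ 2 * b) γ) (sym (*-identityˡ α))
      (∼-translate {d} {α} {b'} {γ'} {b} {γ} k (pos⇒≢0 0<α) disc' disc b≡)
    where
    l₁ : ∀ d → 0ℤ * 0ℤ + d ≡ 1ℤ * d
    l₁ = solve-∀
    l₂ : ∀ b → b ≡ 0ℤ + 1ℤ * b
    l₂ = solve-∀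
    l₃ : ∀ α b → b ≡ b + α * 0ℤ
    l₃ = solve-∀

  -- The ideals of P and -P are conjugate, so their product is generated by θ = α. The third ideal
  -- is the unit ideal, with α₃ = 1 and b₃ = 0.
  oppositeCube : ∀ {d α b γ b'} k → b * b + d ≡ α * γ → b' ≡ - (b + α * k) → Cube d α b α b' 1ℤ 0ℤ
  oppositeCube {d} {α} {b} {γ} k disc refl = record
    { X = α ; Y = 0ℤ ; s₁ = 1ℤ ; s₂ = 1ℤ ; s₃ = α ; s₁₂ = - k ; s₁₃ = b ; s₂₃ = - (b + α * k) ; s₁₂₃ = - (γ + k * b)
    ; norm = n₀ d α ; e₁ = n₁ α b ; e₂ = n₁ α (- (b + α * k)) ; e₃ = n₃ α
    ; e₁₂ = n₁₂ d α b k ; e₁₃ = n₁₃ d α b ; e₂₃ = n₁₃ d α (- (b + α * k)) ; e₁₂₃ = ≡-lin₁ (- α) disc (n₁₂₃ d α b γ k) }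
    where
    n₀ : ∀ d α → α * α + d * (0ℤ * 0ℤ) ≡ α * α * 1ℤ
    n₀ = solve-∀
    n₁ : ∀ α b → α + 0ℤ * b ≡ α * 1ℤ
    n₁ = solve-∀
    n₃ : ∀ α → α + 0ℤ * 0ℤ ≡ 1ℤ * α
    n₃ = solve-∀
    n₁₂ : ∀ d α b k → let b' = - (b + α * k) in α * (b + b') + 0ℤ * (b * b' - d) ≡ α * α * - k
    n₁₂ = solve-∀
    n₁₃ : ∀ d α b → α * (b + 0ℤ) + 0ℤ * (b * 0ℤ - d) ≡ α * 1ℤ * b
    n₁₃ = solve-∀
    n₁₂₃ : ∀ d α b γ k → let b' = - (b + α * k) in
      α * (b * b' + b * 0ℤ + b' * 0ℤ - d) + 0ℤ * (b * b' * 0ℤ - d * (b + b' + 0ℤ)) ≡ α * α * 1ℤ * - (γ + k * b)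
      + - α * (b * b + d - α * γ)
    n₁₂₃ = solve-∀

  ∣-antisym-pos : ∀ {i j} → 0ℤ < i → 0ℤ < j → i ∣ j → j ∣ i → i ≡ j
  ∣-antisym-pos {i} {j} 0<i 0<j i∣j j∣i = trans (sym (0≤i⇒+∣i∣≡i (<⇒≤ 0<i)))
    (trans (cong +_ (ℕ.∣-antisym (∣⇒∣ᵤ i∣j) (∣⇒∣ᵤ j∣i))) (0≤i⇒+∣i∣≡i (<⇒≤ 0<j)))

  -- A is prime to C, so it is a local multiplier at every prime of C: A C'² is a multiple of C²,
  -- hence C² ∣ C'². Used in both directions, this shows that x determines C.
  denominator-∣ : ∀ {A C A' C'} → C ≢ 0ℤ → (∀ {p} → Prime p → + p ∣ A → ¬ + p ∣ C) → A * (C' * C') ≡ A' * (C * C) → C ∣ C'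
  denominator-∣ {A} {C} {A'} {C'} C≢0 A⊥C e = square-∣ C C' C≢0
    (∣-local-global (C * C) (C' * C') (*-≢0 C≢0 C≢0) λ p pp p∣C² →
      A , (λ p∣A → A⊥C pp p∣A (euclid-sq pp C p∣C²)) , divides A' e)

  module _ {d u v : ℤ} (max : MaximalOrder d) (0<d : 0ℤ < d) (v∣d : v ∣ d) where

    -- α is fixed by α g² = v (A v + C² u) with g = gcd(C, v), and b modulo α by b C³ ≡ B v², as C
    -- is prime to α. So another μ only translates the form.
    recipe-unique : ∀ {A B C α b γ α' b' γ'} → Recipe d u v A B C α b γ → Recipe d u v A B C α' b' γ' →
      (α' ≡ α) × (∃[ k ] b' ≡ b + α * k)
    recipe-unique {A} {B} {C} {α} {b} {γ} {α'} {b'} {γ'} r r' = α'≡α , fromDivides α∣b'-b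
      where
      module R = Recipe r
      module R' = Recipe r'
      α'≡α : α' ≡ α
      α'≡α = cancel {R.g * R.g} (*-≢0 (g≢0 max 0<d v∣d r) (g≢0 max 0<d v∣d r)) (trans (*-comm (R.g * R.g) α')
        (trans (cong (λ g → α' * (g * g)) (trans R.g≡ (sym R'.g≡)))
        (trans (αg max 0<d v∣d r') (trans (sym (αg max 0<d v∣d r)) (*-comm α (R.g * R.g))))))
      lemma : ∀ b b' B c v² → c * (b' - b) ≡ 1ℤ * (b' * c - B * v²) + - 1ℤ * (b * c - B * v²)
      lemma = solve-∀
      α∣b'-b : α ∣ b' - b
      α∣b'-b = ∣-local-global α (b' - b) (α≢0 max 0<d v∣d r) λ p pp p∣α →
        C * C * C , ∤-cube pp (∣α⇒∤C max 0<d v∣d r pp p∣α) ,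
        ∣-lin₂ (subst (_∣ b' * (C * C * C) - B * (v * v)) α'≡α R'.bC) 1ℤ R.bC (- 1ℤ) (lemma b b' B (C * C * C) (v * v))
      lemma' : ∀ b b' q α → b' ≡ b + α * q + 1ℤ * (b' - b - q * α)
      lemma' = solve-∀
      fromDivides : α ∣ b' - b → ∃[ k ] b' ≡ b + α * k
      fromDivides (divides q e) = q , ≡-lin₁ 1ℤ e (lemma' b b' q α)

    -- 3u² + a₄v² > 0 makes the cubic increasing left of -u/v, where it is negative; so no point lies there.
    α-pos : ∀ {a₄ a₆ A B C α b γ} → Recipe d u v A B C α b γ →
      d ≡ v * (u * u * u + a₄ * u * (v * v) - a₆ * (v * v * v)) →
      B * B ≡ A * A * A + a₄ * A * (C * C * (C * C)) + a₆ * (C * C * C * (C * C * C)) →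
      0ℤ < u → 0ℤ < v → 0ℤ < + 3 * (u * u) + a₄ * (v * v) → 0ℤ < α
    α-pos {a₄} {a₆} {A} {B} {C} {α} r d≡ curve 0<u 0<v 0<M = *-pos-cancelˡ {g * g} (0<square (g≢0 max 0<d v∣d r))
      (subst (0ℤ <_) (trans (sym (αg max 0<d v∣d r)) (*-comm α (g * g))) (*-pos 0<v 0<a))
      where
      open Recipe r
      a = A * v + C * C * u
      t = C * C * u
      M = + 3 * (u * u) + a₄ * (v * v)
      -- From the Taylor expansion of the cubic at -u/v: v⁴B² + d C⁶ = v a Q, so a Q > 0. For a < 0
      -- the first summand of Q is nonnegative and the other two are positive, which would make a Q
      -- negative.
      Q = a * a + + 3 * (- a * t) + C * C * (C * C) * M
      factorL : ∀ d a₄ a₆ A B C u v → let a = A * v + C * C * u; t = C * C * u in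
        v * v * B * (v * v * B) + d * (C * C * C * (C * C * C)) ≡
        v * (a * (a * a + + 3 * (- a * t) + C * C * (C * C) * (+ 3 * (u * u) + a₄ * (v * v))))
        + C * C * C * (C * C * C) * (d - v * (u * u * u + a₄ * u * (v * v) - a₆ * (v * v * v)))
        + v * v * (v * v) * (B * B - (A * A * A + a₄ * A * (C * C * (C * C)) + a₆ * (C * C * C * (C * C * C))))
      factorL = solve-∀
      C³≢0 : C * C * C ≢ 0ℤ
      C³≢0 = *-≢0 (*-≢0 (pos⇒≢0 0<C) (pos⇒≢0 0<C)) (pos⇒≢0 0<C)
      0<aQ : 0ℤ < a * Q
      0<aQ = *-pos-cancelˡ 0<v (subst (0ℤ <_)
        (≡-lin₂ (C * C * C * (C * C * C)) d≡ (v * v * (v * v)) curve (factorL d a₄ a₆ A B C u v))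
        (0<x²+dy² (v * v * B) (C * C * C) 0<d λ e → ⊥-elim (C³≢0 e)))
      0<C² : 0ℤ < C * C
      0<C² = *-pos 0<C 0<C
      0<Q : 0ℤ < - a → 0ℤ < Q
      0<Q 0<-a = +-mono-< (+-mono-≤-< (0≤square a) (*-pos {+ 3} (+<+ (s≤s z≤n)) (*-pos 0<-a (*-pos 0<C² 0<u)))) (*-pos (*-pos 0<C² 0<C²) 0<M)
      sumL : ∀ a Q → a * Q + - a * Q ≡ 0ℤ
      sumL = solve-∀
      0<a : 0ℤ < a
      0<a with <-cmp 0ℤ a
      ... | tri< h _ _ = h
      ... | tri≈ _ e _ = ⊥-elim (<-irrefl refl (subst (λ z → 0ℤ < z * Q) (sym e) 0<aQ))
      ... | tri> _ _ h = ⊥-elim (<-irrefl (sym (sumL a Q)) (+-mono-< 0<aQ (*-pos (neg-mono-< h) (0<Q (neg-mono-< h)))))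

  module _ (a₄ a₆ u v : ℤ) (ms : MapSuitable a₄ a₆ u v) (fd : FundamentalDisc (- DE a₄ a₆ u v)) where

    private
      d = dE a₄ a₆ u v
      0<u = proj₁ ms
      0<v = proj₁ (proj₂ ms)
      0<M = proj₁ (proj₂ (proj₂ ms))

      0<d : 0ℤ < d
      0<d = *-pos-cancelˡ {+ 4} (+<+ (s≤s z≤n)) (proj₂ (proj₂ (proj₂ ms)))

      max : MaximalOrder d
      max = fundamental⇒maximal d fd

      v∣d : v ∣ d
      v∣d = ∣m⇒∣m*n _ (∣-refl {v})

      positive : ∀ {x y f} → OnCurve a₄ a₆ (aff x y) → (φ : PhiData d u v x y f) → 0ℤ < PhiData.α φ
      positive {x} {y} c φ = α-pos max 0<d v∣d {a₄} {a₆} recipe refl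
          (curve-integral {a₄} {a₆} {A} {B} {C} {x} {y} c (ι-square {x} {A} {C} xC) (ι-cube {y} {B} {C} yC)) 0<u 0<v 0<M
        where
        open PhiData φ

      sameDenominator : ∀ {x y y' f f'} (φ : PhiData d u v x y f) (φ' : PhiData d u v x y' f') →
        (PhiData.C φ' ≡ PhiData.C φ) × (PhiData.A φ' ≡ PhiData.A φ)
      sameDenominator {x} φ φ' = C'≡C , A'≡A
        where
        module P = PhiData φ
        module P' = PhiData φ'
        module R = Recipe P.recipe
        module R' = Recipe P'.recipe
        cross : P.A * (P'.C * P'.C) ≡ P'.A * (P.C * P.C)
        cross = cross-multiply {x} {P.A} {P'.A} {P.C * P.C} {P'.C * P'.C} P.xC P'.xC
        C'≡C : P'.C ≡ P.C
        C'≡C = ∣-antisym-pos R'.0<C R.0<C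
          (denominator-∣ {P'.A} {P'.C} {P.A} {P.C} (pos⇒≢0 R'.0<C) R'.A⊥C (sym cross))
          (denominator-∣ {P.A} {P.C} {P'.A} {P'.C} (pos⇒≢0 R.0<C) R.A⊥C cross)
        A'≡A : P'.A ≡ P.A
        A'≡A = cancel {P.C * P.C} (*-≢0 (pos⇒≢0 R.0<C) (pos⇒≢0 R.0<C))
          (trans (*-comm (P.C * P.C) P'.A) (trans (sym cross) (trans (cong (λ z → P.A * (z * z)) C'≡C) (*-comm P.A (P.C * P.C)))))

      phi-unique : ∀ {x y f f'} (φ : PhiData d u v x y f) (φ' : PhiData d u v x y f') →
        (PhiData.α φ' ≡ PhiData.α φ) × (∃[ k ] PhiData.b φ' ≡ PhiData.b φ + PhiData.α φ * k)
      phi-unique {x} {y} φ φ' = go (sameDenominator φ φ')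
        where
        module P = PhiData φ
        module P' = PhiData φ'
        go : (P'.C ≡ P.C) × (P'.A ≡ P.A) → (P'.α ≡ P.α) × (∃[ k ] P'.b ≡ P.b + P.α * k)
        go (C≡ , A≡) = recipe-unique max 0<d v∣d P.recipe
          (subst (λ C → Recipe d u v P.A P.B C P'.α P'.b P'.γ) C≡ (subst (λ A → Recipe d u v A P.B P'.C P'.α P'.b P'.γ) A≡
            (subst (λ B → Recipe d u v P'.A B P'.C P'.α P'.b P'.γ) B≡ P'.recipe)))
          where
          C³≢0 : P.C * P.C * P.C ≢ 0ℤ
          C³≢0 = *-≢0 (*-≢0 (pos⇒≢0 (Recipe.0<C P.recipe)) (pos⇒≢0 (Recipe.0<C P.recipe))) (pos⇒≢0 (Recipe.0<C P.recipe))
          cross : P.B * (P'.C * P'.C * P'.C) ≡ P'.B * (P.C * P.C * P.C)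
          cross = cross-multiply {y} {P.B} {P'.B} {P.C * P.C * P.C} {P'.C * P'.C * P'.C} P.yC P'.yC
          B≡ : P'.B ≡ P.B
          B≡ = cancel {P.C * P.C * P.C} C³≢0 (trans (*-comm (P.C * P.C * P.C) P'.B)
            (trans (sym cross) (trans (cong (λ z → P.B * (z * z * z)) C≡) (*-comm P.B (P.C * P.C * P.C)))))

      negatePhi : ∀ {x y y' f} → y' ≡ ℚ.- y → (φ : PhiData d u v x y f) →
        PhiData d u v x y' (form (PhiData.α φ) (+ 2 * - PhiData.b φ) (PhiData.γ φ))
      negatePhi {x} {y} e φ = record
        { xC = xC ; yC = trans (cong (ℚ._* ι (C * C * C)) e) (ι-negate {y} {B} {C * C * C} yC) ; recipe = negate recipe ; f≡ = refl }
        where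
        open PhiData φ

    identityCase : ∀ {x y g h} → OnCurve a₄ a₆ (aff x y) → PhiData d u v x y g → PhiData d u v x y h →
      IsComposite (form 1ℤ 0ℤ d) g h
    identityCase c φ φ' = subst₂ (IsComposite (form 1ℤ 0ℤ d)) (sym P.f≡) (sym P'.f≡) (go (phi-unique φ' φ))
      where
      module P = PhiData φ
      module P' = PhiData φ'
      go : (P.α ≡ P'.α) × (∃[ k ] P.b ≡ P'.b + P'.α * k) →
        IsComposite (form 1ℤ 0ℤ d) (form P.α (+ 2 * P.b) P.γ) (form P'.α (+ 2 * P'.b) P'.γ)
      go (α≡ , k , b≡) = subst (λ z → IsComposite (form 1ℤ 0ℤ d) (form P.α (+ 2 * P.b) P.γ) (form z (+ 2 * P'.b) P'.γ)) α≡
        (composite-identity {d} {P.α} {P.b} {P.γ} {P'.b} {P'.γ} k (positive c φ) (Recipe.disc P.recipe)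
          (trans (Recipe.disc P'.recipe) (cong (_* P'.γ) (sym α≡))) (trans b≡ (cong (λ z → P'.b + z * k) (sym α≡))))

    oppositeCase : ∀ {x y f g} → OnCurve a₄ a₆ (aff x y) → PhiData d u v x y f → PhiData d u v x (ℚ.- y) g →
      IsComposite f g (form 1ℤ 0ℤ d)
    oppositeCase {x} {y} c φ φ' = subst₂ (λ f g → IsComposite f g (form 1ℤ 0ℤ d)) (sym P.f≡) (sym P'.f≡)
      -- Negating the second recipe gives one for P itself, so uniqueness compares b with -b'.
      (go (phi-unique φ (negatePhi (sym (neg-involutiveℚ y)) φ')))
      where
      module P = PhiData φ
      module P' = PhiData φ'
      go : (P'.α ≡ P.α) × (∃[ k ] - P'.b ≡ P.b + P.α * k) →
        IsComposite (form P.α (+ 2 * P.b) P.γ) (form P'.α (+ 2 * P'.b) P'.γ) (form 1ℤ 0ℤ d)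
      go (α≡ , k , b≡) = subst (λ z → IsComposite (form P.α (+ 2 * P.b) P.γ) (form z (+ 2 * P'.b) P'.γ) (form 1ℤ 0ℤ d)) (sym α≡)
        (cube⇒composite {d} {P.α} {P.b} {P.γ} {P.α} {P'.b} {P'.γ} {1ℤ} {0ℤ} {d} max 0<d (positive c φ) (positive c φ) (λ ())
          (Recipe.disc P.recipe) (trans (Recipe.disc P'.recipe) (cong (_* P'.γ) α≡)) (lemma d)
          (oppositeCube {d} {P.α} {P.b} {P.γ} {P'.b} k (Recipe.disc P.recipe) (trans (sym (neg-involutive P'.b)) (cong -_ b≡))))
        where
        lemma : ∀ d → 0ℤ * 0ℤ + d ≡ 1ℤ * d
        lemma = solve-∀

    lineCase : ∀ {x₁ y₁ x₂ y₂ x₃ y₃ f g h} → OnCurve a₄ a₆ (aff x₁ y₁) → OnCurve a₄ a₆ (aff x₂ y₂) →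
      Line (ι a₄) (ι a₆) x₁ y₁ x₂ y₂ x₃ (ℚ.- y₃) →
      PhiData d u v x₁ y₁ f → PhiData d u v x₂ y₂ g → PhiData d u v x₃ y₃ h → IsComposite f g h
    lineCase {x₁} {y₁} {x₂} {y₂} {x₃} {y₃} {f} {g} {h} c₁ c₂ ℓ φ₁ φ₂ φ₃ =
      subst₂ (λ f g → IsComposite f g h) (sym P₁.f≡) (sym P₂.f≡)
        (subst (IsComposite (form P₁.α (+ 2 * P₁.b) P₁.γ) (form P₂.α (+ 2 * P₂.b) P₂.γ))
          -- The line passes through -P₃, whose recipe carries -b₃; the conjugation in
          -- `cube⇒composite` turns this back into b₃.
          (trans (cong (λ b → form P₃.α (+ 2 * b) P₃.γ) (neg-involutive P₃.b)) (sym P₃.f≡))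
          (cube⇒composite {d} {P₁.α} {P₁.b} {P₁.γ} {P₂.α} {P₂.b} {P₂.γ} {P₃.α} { - P₃.b} {P₃.γ} max 0<d
            (positive c₁ φ₁) (positive c₂ φ₂) (α≢0 max 0<d v∣d P₃.recipe)
            (Recipe.disc P₁.recipe) (Recipe.disc P₂.recipe) (Recipe.disc r₃)
            (chord⇒cube max 0<d v∣d refl P₁.recipe P₂.recipe r₃ ch)))
      where
      module P₁ = PhiData φ₁
      module P₂ = PhiData φ₂
      module P₃ = PhiData φ₃
      r₃ = negate P₃.recipe
      ch : Chord a₄ a₆ P₁.A P₁.B P₁.C P₂.A P₂.B P₂.C P₃.A (- P₃.B) P₃.C
      ch = chord {a₄} {a₆} {P₁.A} {P₁.B} {P₁.C} {P₂.A} {P₂.B} {P₂.C} {P₃.A} { - P₃.B} {P₃.C} {x₁} {y₁} {x₂} {y₂} {x₃} {ℚ.- y₃} ℓ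
        (ι-square {x₁} {P₁.A} {P₁.C} P₁.xC) (ι-square {x₂} {P₂.A} {P₂.C} P₂.xC) (ι-square {x₃} {P₃.A} {P₃.C} P₃.xC)
        (ι-cube {y₁} {P₁.B} {P₁.C} P₁.yC) (ι-cube {y₂} {P₂.B} {P₂.C} P₂.yC)
        (ι-cube {ℚ.- y₃} { - P₃.B} {P₃.C} (ι-negate {y₃} {P₃.B} {P₃.C * P₃.C * P₃.C} P₃.yC))

    affineCase : ∀ {x₁ y₁ x₂ y₂ R f g h} → OnCurve a₄ a₆ (aff x₁ y₁) → OnCurve a₄ a₆ (aff x₂ y₂) →
      AddView a₄ a₆ x₁ y₁ x₂ y₂ R →
      PhiData d u v x₁ y₁ f → PhiData d u v x₂ y₂ g → IsPhiForm a₄ a₆ u v R h → IsComposite f g h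
    affineCase c₁ c₂ (opposite refl refl) φ₁ φ₂ refl = oppositeCase c₁ φ₁ φ₂
    affineCase c₁ c₂ (affine ℓ) φ₁ φ₂ φ₃ = lineCase c₁ c₂ ℓ φ₁ φ₂ (phiData a₄ a₆ u v φ₃)

open import Data.Integer using (ℤ; +_; -_; _+_; _*_; 0ℤ; 1ℤ; +<+)
open import Data.Integer.Tactic.RingSolver using (solve-∀)
open import Data.Nat.Base using (z≤n; s≤s)
open import Relation.Binary.PropositionalEquality using (_≡_; refl)
open Recipes using (phiData)
open RationalLines using (addView)
open Homomorphism

theorem1p1 : (a₄ a₆ : ℤ) → IsElliptic a₄ a₆ →
    (u v : ℤ) → MapSuitable a₄ a₆ u v → FundamentalDisc (- DE a₄ a₆ u v) →
    (P Q : Point) → OnCurve a₄ a₆ P → OnCurve a₄ a₆ Q →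
    (f g h : Form) →
    IsPhiForm a₄ a₆ u v P f → IsPhiForm a₄ a₆ u v Q g →
    IsPhiForm a₄ a₆ u v (addE a₄ a₆ P Q) h →
    IsComposite f g h
theorem1p1 a₄ a₆ _ u v ms fd 𝒪 𝒪 _ _ _ _ _ refl refl refl =
  composite-identity {d} {1ℤ} {0ℤ} {d} {0ℤ} {d} 0ℤ (+<+ (s≤s z≤n)) (lemma d) (lemma d) refl
  where
  d = dE a₄ a₆ u v
  lemma : ∀ d → 0ℤ * 0ℤ + d ≡ 1ℤ * d
  lemma = solve-∀
theorem1p1 a₄ a₆ _ u v ms fd 𝒪 (aff x y) _ c _ _ _ refl φ φ' =
  identityCase a₄ a₆ u v ms fd {x} {y} c (phiData a₄ a₆ u v {x} {y} φ) (phiData a₄ a₆ u v {x} {y} φ')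
theorem1p1 a₄ a₆ _ u v ms fd (aff x y) 𝒪 c _ f _ h φ refl φ' =
  composite-comm (form 1ℤ 0ℤ (dE a₄ a₆ u v)) f h (identityCase a₄ a₆ u v ms fd {x} {y} c (phiData a₄ a₆ u v {x} {y} φ) (phiData a₄ a₆ u v {x} {y} φ'))
theorem1p1 a₄ a₆ _ u v ms fd (aff x₁ y₁) (aff x₂ y₂) c₁ c₂ _ _ _ φ₁ φ₂ φ₃ =
  affineCase a₄ a₆ u v ms fd {x₁} {y₁} {x₂} {y₂} c₁ c₂ (addView a₄ a₆ x₁ y₁ x₂ y₂ c₁ c₂) (phiData a₄ a₆ u v {x₁} {y₁} φ₁) (phiData a₄ a₆ u v {x₂} {y₂} φ₂) φ₃
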